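{- For any integer $n\geq 1$, $$N_{n}(t)=\left(\frac{1+yt}{1+y}\right)^{n+1}D_{n}^{(\mathrm{hk},\mathrm{pk})}\left(\frac{(1+y)^{2}t}{(y+t)(1+yt)},\frac{y+t}{1+yt}\right).$$ Equivalently, $$D_{n}^{(\mathrm{hk},\mathrm{pk})}(y,t)=\left(\frac{1+u}{1+uv}\right)^{n+1}N_{n}(v),$$ where $$u=\frac{1+t^{2}-2yt-(1-t)\sqrt{(1+t)^{2}-4yt}}{2(1-y)t},\qquad v=\frac{(1+t)^{2}-2yt-(1+t)\sqrt{(1+t)^{2}-4yt}}{2yt}.$$ Furthermore, $$D_{n}^{(\mathrm{hk},\mathrm{pk})}(y,t)=\sum_{k=0}^{\lfloor (n-1)/2\rfloor}\frac{1}{k+1}\binom{2k}{k}\binom{n-1}{2k}y^{k+1}t^{k+1}(1+t)^{n-2k-1},$$ and the number of Dyck paths of semilength $n$ with $k$ hooks and $j$ peaks is $$\frac{1}{k+1}\binom{2k}{k}\binom{n-1}{2k}\binom{n-2k-1}{j-k-1}.$$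
   Context: A Dyck path of semilength $n$ is a lattice path from $(0,0)$ to $(2n,0)$ consisting of up steps $U=(1,1)$ and down steps $D=(1,-1)$ that never goes below the $x$-axis; it is encoded by its Dyck word in the letters $U,D$. $\mathcal{D}_n$ is the set of Dyck paths of semilength $n$. For a Dyck path $\mu$, a peak is an occurrence of the consecutive subword $UD$ and a hook is an occurrence of the consecutive subword $DDU$ in its Dyck word; $\mathrm{pk}(\mu)$ and $\mathrm{hk}(\mu)$ are the numbers of peaks and hooks of $\mu$. For $n\ge1$, $D_n^{(\mathrm{hk},\mathrm{pk})}(y,t)=\sum_{\mu\in\mathcal{D}_n}y^{\mathrm{hk}(\mu)+1}t^{\mathrm{pk}(\mu)}$, and the $n$th Narayana polynomial is $N_n(t)=\frac1n\sum_{k=1}^n\binom nk\binom n{k-1}t^k$. Binomial coefficients $\binom ab$ are $0$ when $b<0$ or when $0\le a<b$. Here $y,t$ are indeterminates; the first identity is an identity of rational functions in $y,t$. In the second identity, $\sqrt{(1+t)^2-4yt}$ is the formal power series in $t$ over $\mathbb{Q}[y]$ with constant term $1$, so that $u$ and $v$ are formal power series in $t$ with coefficients in $\mathbb{Q}[y]$. -}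

module Defs where

open import Level using (0ℓ)
open import Algebra.Bundles using (CommutativeRing; RawRing)
open import Algebra.Morphism.Structures using (IsRingMonomorphism)
import Algebra.Morphism.RingMonomorphism as RingMonomorphism
import Algebra.Properties.Ring as RingProperties
import Algebra.Properties.Semiring.Exp as Exp
import Algebra.Solver.Ring.NaturalCoefficients.Default as SemiringSolver
open import Data.Empty using (⊥-elim)
open import Data.Integer.Base as ℤ using (ℤ; +_; -[1+_])
open import Data.List.Base as List using (List; []; _∷_; _++_; length; filter; foldr; map; upTo)
open import Data.Nat.Base as ℕ using (ℕ; zero; suc; _∸_; NonZero)
open import Data.Nat.Combinatorics using (_C_)
open import Data.Nat.Properties using (_≟_)
open import Data.Product.Base using (_×_; _,_)
open import Data.Rational.Base as ℚ using (ℚ; 0ℚ; 1ℚ)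
import Data.Rational.Properties as ℚₚ
open import Data.Sum.Base using (_⊎_; inj₁; inj₂; [_,_]′)
open import Relation.Binary.PropositionalEquality as ≡ using (_≡_)
import Relation.Binary.Reasoning.Setoid as SetoidReasoning
open import Relation.Nullary.Decidable using (Dec; yes; no; _×-dec_)
open import Relation.Nullary.Negation using (¬_)

data Step : Set where
  U D : Step

Word : Set
Word = List Step

-- DyckFrom h w: the path w started at height h never goes below the axis
-- and ends on it.
data DyckFrom : ℕ → Word → Set where
  end  : DyckFrom 0 []
  up   : ∀ {h w} → DyckFrom (suc h) w → DyckFrom h (U ∷ w)
  down : ∀ {h w} → DyckFrom h w → DyckFrom (suc h) (D ∷ w)

dyckFrom? : ∀ h w → Dec (DyckFrom h w)
dyckFrom? zero    []      = yes end
dyckFrom? (suc h) []      = no λ ()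
dyckFrom? h       (U ∷ w) with dyckFrom? (suc h) w
... | yes p = yes (up p)
... | no ¬p = no λ { (up p) → ¬p p }
dyckFrom? zero    (D ∷ w) = no λ ()
dyckFrom? (suc h) (D ∷ w) with dyckFrom? h w
... | yes p = yes (down p)
... | no ¬p = no λ { (down p) → ¬p p }

-- All words of length m, each listed once.
words : ℕ → List Word
words zero    = [] ∷ []
words (suc m) = map (U ∷_) (words m) ++ map (D ∷_) (words m)

𝒟 : ℕ → List Word
𝒟 n = filter (dyckFrom? 0) (words (2 ℕ.* n))

pk : Word → ℕ
pk []                = 0
pk (U ∷ w@(D ∷ _))   = suc (pk w)
pk (_ ∷ w)           = pk w

hk : Word → ℕ
hk []                  = 0
hk (D ∷ w@(D ∷ U ∷ _)) = suc (hk w)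
hk (_ ∷ w)             = hk w

#paths : (n k j : ℕ) → ℕ
#paths n k j = length (filter (λ μ → (hk μ ≟ k) ×-dec (pk μ ≟ j)) (𝒟 n))

-- Binomial coefficients with integer arguments. For a negative upper
-- argument this is a(a-1)⋯(a-b+1)/b!.
binom : ℤ → ℤ → ℤ
binom _          -[1+ _ ] = + 0
binom (+ a)      (+ b)    = + (a C b)
binom (-[1+ a ]) (+ b)    = (ℤ.- (+ 1)) ℤ.^ b ℤ.* + ((a ℕ.+ b) C b)

record IsDomain (R : CommutativeRing 0ℓ 0ℓ) : Set where
  open CommutativeRing R
  field
    1≉0           : ¬ 1# ≈ 0#
    zero-product  : ∀ x y → x * y ≈ 0# → x ≈ 0# ⊎ y ≈ 0#

  *≉0 : ∀ {x y} → ¬ x ≈ 0# → ¬ y ≈ 0# → ¬ x * y ≈ 0#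
  *≉0 x≉0 y≉0 xy≈0 = [ x≉0 , y≉0 ]′ (zero-product _ _ xy≈0)

ℚ-ring : CommutativeRing 0ℓ 0ℓ
ℚ-ring = ℚₚ.+-*-commutativeRing

ℚ-isDomain : IsDomain ℚ-ring
ℚ-isDomain = record { 1≉0 = λ () ; zero-product = zp }
  where
  zp : ∀ p q → p ℚ.* q ≡ 0ℚ → p ≡ 0ℚ ⊎ q ≡ 0ℚ
  zp p q pq≡0 with p ℚₚ.≟ 0ℚ
  ... | yes p≡0 = inj₁ p≡0
  ... | no  p≢0 = inj₂ (begin
    q                        ≡⟨ ℚₚ.*-identityˡ q ⟨
    1ℚ ℚ.* q                 ≡⟨ ≡.cong (ℚ._* q) (ℚₚ.*-inverseˡ p) ⟨
    ((ℚ.1/ p) ℚ.* p) ℚ.* q   ≡⟨ ℚₚ.*-assoc (ℚ.1/ p) p q ⟩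
    (ℚ.1/ p) ℚ.* (p ℚ.* q)   ≡⟨ ≡.cong ((ℚ.1/ p) ℚ.*_) pq≡0 ⟩
    (ℚ.1/ p) ℚ.* 0ℚ          ≡⟨ ℚₚ.*-zeroʳ (ℚ.1/ p) ⟩
    0ℚ                       ∎)
    where
    open ≡.≡-Reasoning
    instance _ = ℚ.≢-nonZero p≢0

module PowerSeries (R : CommutativeRing 0ℓ 0ℓ) where
  open CommutativeRing R
  open SetoidReasoning setoid
  private module Solver = SemiringSolver commutativeSemiring

  Series : Set
  Series = ℕ → Carrier

  _≐_ : Series → Series → Set
  f ≐ g = ∀ n → f n ≈ g n

  -- The same relation as a record, so that f and g can be inferred from
  -- the type of an equality proof.
  infix 4 _≋_
  record _≋_ (f g : Series) : Set where
    constructor coeffwise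
    field at : f ≐ g
  open _≋_ public

  tail : Series → Series
  tail f n = f (suc n)

  const : Carrier → Series
  const a zero    = a
  const a (suc _) = 0#

  X : Series
  X zero          = 0#
  X (suc zero)    = 1#
  X (suc (suc _)) = 0#

  _⊕_ : Series → Series → Series
  (f ⊕ g) n = f n + g n

  ⊖_ : Series → Series
  (⊖ f) n = - f n

  -- (f ⊛ g) n = f 0 * g n + f 1 * g (n - 1) + ⋯ + f n * g 0
  _⊛_ : Series → Series → Series
  (f ⊛ g) zero    = f 0 * g 0
  (f ⊛ g) (suc n) = f 0 * g (suc n) + (tail f ⊛ g) n

  ⊛-cong : ∀ {f f′ g g′} → f ≐ f′ → g ≐ g′ → (f ⊛ g) ≐ (f′ ⊛ g′)
  ⊛-cong p q zero    = *-cong (p 0) (q 0)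
  ⊛-cong p q (suc n) =
    +-cong (*-cong (p 0) (q (suc n))) (⊛-cong (λ i → p (suc i)) q n)

  ⊛-zeroˡ : ∀ g → (const 0# ⊛ g) ≐ const 0#
  ⊛-zeroˡ g zero    = zeroˡ _
  ⊛-zeroˡ g (suc n) = begin
    0# * g (suc n) + (tail (const 0#) ⊛ g) n  ≈⟨ +-cong (zeroˡ _) (⊛-cong tail0 (λ _ → refl) n) ⟩
    0# + (const 0# ⊛ g) n                     ≈⟨ +-identityˡ _ ⟩
    (const 0# ⊛ g) n                          ≈⟨ ⊛-zeroˡ g n ⟩
    const 0# n                                ≈⟨ tail0 n ⟨
    0#                                        ∎
    where
    tail0 : tail (const 0#) ≐ const 0#
    tail0 zero    = refl
    tail0 (suc _) = refl

  ⊛-identityˡ : ∀ g → (const 1# ⊛ g) ≐ g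
  ⊛-identityˡ g zero    = *-identityˡ _
  ⊛-identityˡ g (suc n) = begin
    1# * g (suc n) + (tail (const 1#) ⊛ g) n  ≈⟨ +-cong (*-identityˡ _) (⊛-cong tail1 (λ _ → refl) n) ⟩
    g (suc n) + (const 0# ⊛ g) n              ≈⟨ +-congˡ (⊛-zeroˡ g n) ⟩
    g (suc n) + const 0# n                    ≈⟨ +-congˡ (tail1 n) ⟨
    g (suc n) + 0#                            ≈⟨ +-identityʳ _ ⟩
    g (suc n)                                 ∎
    where
    tail1 : tail (const 1#) ≐ const 0#
    tail1 zero    = refl
    tail1 (suc _) = refl

  ⊛-distribʳ : ∀ h f g → ((f ⊕ g) ⊛ h) ≐ ((f ⊛ h) ⊕ (g ⊛ h))
  ⊛-distribʳ h f g zero    = distribʳ _ _ _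
  ⊛-distribʳ h f g (suc n) = begin
    (f 0 + g 0) * h (suc n) + ((tail f ⊕ tail g) ⊛ h) n
      ≈⟨ +-congˡ (⊛-distribʳ h (tail f) (tail g) n) ⟩
    (f 0 + g 0) * h (suc n) + ((tail f ⊛ h) n + (tail g ⊛ h) n)
      ≈⟨ shuffle _ _ _ _ _ ⟩
    (f 0 * h (suc n) + (tail f ⊛ h) n) + (g 0 * h (suc n) + (tail g ⊛ h) n) ∎
    where
    shuffle : ∀ a b c d e → (a + b) * c + (d + e) ≈ (a * c + d) + (b * c + e)
    shuffle = solve 5 (λ a b c d e →
      (a :+ b) :* c :+ (d :+ e)
        := (a :* c :+ d) :+ (b :* c :+ e)) refl
      where open Solver

  ⊛-sucʳ : ∀ f g n → (f ⊛ g) (suc n) ≈ (f ⊛ tail g) n + f (suc n) * g 0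
  ⊛-sucʳ f g zero    = refl
  ⊛-sucʳ f g (suc n) = begin
    f 0 * g (suc (suc n)) + (tail f ⊛ g) (suc n)
      ≈⟨ +-congˡ (⊛-sucʳ (tail f) g n) ⟩
    f 0 * g (suc (suc n)) + ((tail f ⊛ tail g) n + f (suc (suc n)) * g 0)
      ≈⟨ +-assoc _ _ _ ⟨
    (f ⊛ tail g) (suc n) + f (suc (suc n)) * g 0 ∎

  ⊛-comm : ∀ f g → (f ⊛ g) ≐ (g ⊛ f)
  ⊛-comm f g zero    = *-comm _ _
  ⊛-comm f g (suc n) = begin
    f 0 * g (suc n) + (tail f ⊛ g) n  ≈⟨ +-cong (*-comm _ _) (⊛-comm (tail f) g n) ⟩
    g (suc n) * f 0 + (g ⊛ tail f) n  ≈⟨ +-comm _ _ ⟩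
    (g ⊛ tail f) n + g (suc n) * f 0  ≈⟨ ⊛-sucʳ g f n ⟨
    (g ⊛ f) (suc n)                   ∎

  ⊛-scale : ∀ a f g n → ((λ i → a * f i) ⊛ g) n ≈ a * (f ⊛ g) n
  ⊛-scale a f g zero    = *-assoc _ _ _
  ⊛-scale a f g (suc n) = begin
    (a * f 0) * g (suc n) + ((λ i → a * f (suc i)) ⊛ g) n
      ≈⟨ +-cong (*-assoc _ _ _) (⊛-scale a (tail f) g n) ⟩
    a * (f 0 * g (suc n)) + a * (tail f ⊛ g) n  ≈⟨ distribˡ _ _ _ ⟨
    a * (f ⊛ g) (suc n)                         ∎

  ⊛-assoc : ∀ f g h → ((f ⊛ g) ⊛ h) ≐ (f ⊛ (g ⊛ h))
  ⊛-assoc f g h zero    = *-assoc _ _ _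
  ⊛-assoc f g h (suc n) = begin
    (f 0 * g 0) * h (suc n) + (((λ i → f 0 * g (suc i)) ⊕ (tail f ⊛ g)) ⊛ h) n
      ≈⟨ +-congˡ (⊛-distribʳ h _ _ n) ⟩
    (f 0 * g 0) * h (suc n) + (((λ i → f 0 * g (suc i)) ⊛ h) n + ((tail f ⊛ g) ⊛ h) n)
      ≈⟨ +-congˡ (+-cong (⊛-scale _ _ _ n) (⊛-assoc (tail f) g h n)) ⟩
    (f 0 * g 0) * h (suc n) + (f 0 * (tail g ⊛ h) n + (tail f ⊛ (g ⊛ h)) n)
      ≈⟨ shuffle _ _ _ _ _ ⟩
    f 0 * (g 0 * h (suc n) + (tail g ⊛ h) n) + (tail f ⊛ (g ⊛ h)) n ∎
    where
    shuffle : ∀ a b c d e → (a * b) * c + (a * d + e) ≈ a * (b * c + d) + e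
    shuffle = solve 5 (λ a b c d e →
      (a :* b) :* c :+ (a :* d :+ e)
        := a :* (b :* c :+ d) :+ e) refl
      where open Solver

  commutativeRing : CommutativeRing 0ℓ 0ℓ
  commutativeRing = record
    { Carrier = Series ; _≈_ = _≋_ ; _+_ = _⊕_ ; _*_ = _⊛_ ; -_ = ⊖_
    ; 0# = const 0# ; 1# = const 1#
    ; isCommutativeRing = record
      { isRing = record
        { +-isAbelianGroup = record
          { isGroup = record
            { isMonoid = record
              { isSemigroup = record
                { isMagma = record
                  { isEquivalence = record
                    { refl = coeffwise λ _ → refl
                    ; sym = λ p → coeffwise λ n → sym (at p n)
                    ; trans = λ p q → coeffwise λ n → trans (at p n) (at q n) }
                  ; ∙-cong = λ p q → coeffwise λ n → +-cong (at p n) (at q n) }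
                ; assoc = λ f g h → coeffwise λ n → +-assoc _ _ _ }
              ; identity = (λ f → coeffwise λ n → trans (+-congʳ (const0 n)) (+-identityˡ _))
                         , (λ f → coeffwise λ n → trans (+-congˡ (const0 n)) (+-identityʳ _)) }
            ; inverse = (λ f → coeffwise λ n → trans (-‿inverseˡ _) (sym (const0 n)))
                      , (λ f → coeffwise λ n → trans (-‿inverseʳ _) (sym (const0 n)))
            ; ⁻¹-cong = λ p → coeffwise λ n → -‿cong (at p n) }
          ; comm = λ f g → coeffwise λ n → +-comm _ _ }
        ; *-cong = λ p q → coeffwise (⊛-cong (at p) (at q))
        ; *-assoc = λ f g h → coeffwise (⊛-assoc f g h)
        ; *-identity = (λ f → coeffwise (⊛-identityˡ f))
                     , (λ f → coeffwise λ n → trans (⊛-comm f _ n) (⊛-identityˡ f n))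
        ; distrib = (λ f g h → coeffwise λ n → trans (⊛-comm f _ n)
                      (trans (⊛-distribʳ f g h n)
                        (+-cong (⊛-comm g f n) (⊛-comm h f n))))
                  , (λ f g h → coeffwise (⊛-distribʳ f g h)) }
      ; *-comm = λ f g → coeffwise (⊛-comm f g) } }
    where
    const0 : ∀ n → const 0# n ≈ 0#
    const0 zero    = refl
    const0 (suc _) = refl

-- Polynomials R[x]: coefficient lists, constant term first, identified
-- when all coefficients agree (so trailing zeros do not matter).
module Polynomial (R : CommutativeRing 0ℓ 0ℓ) where
  open CommutativeRing R
  open SetoidReasoning setoid
  private
    module S = PowerSeries R
    module SR = CommutativeRing S.commutativeRing

  Poly : Set
  Poly = List Carrier

  coeff : Poly → S.Series
  coeff []      _       = 0#
  coeff (a ∷ p) zero    = a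
  coeff (a ∷ p) (suc i) = coeff p i

  infix 4 _≋_
  record _≋_ (p q : Poly) : Set where
    constructor coeffwise
    field at : ∀ i → coeff p i ≈ coeff q i
  open _≋_ public

  const : Carrier → Poly
  const a = a ∷ []

  X : Poly
  X = 0# ∷ 1# ∷ []

  _⊕_ : Poly → Poly → Poly
  []      ⊕ q       = q
  (a ∷ p) ⊕ []      = a ∷ p
  (a ∷ p) ⊕ (b ∷ q) = (a + b) ∷ (p ⊕ q)

  ⊖_ : Poly → Poly
  ⊖_ = map (-_)

  _⊛_ : Poly → Poly → Poly
  []      ⊛ q = []
  (a ∷ p) ⊛ q = map (a *_) q ⊕ (0# ∷ (p ⊛ q))

  polyRawRing : RawRing 0ℓ 0ℓ
  polyRawRing = record
    { Carrier = Poly ; _≈_ = _≋_ ; _+_ = _⊕_ ; _*_ = _⊛_ ; -_ = ⊖_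
    ; 0# = [] ; 1# = const 1# }

  coeff-⊕ : ∀ p q i → coeff (p ⊕ q) i ≈ coeff p i + coeff q i
  coeff-⊕ []      q       i       = sym (+-identityˡ _)
  coeff-⊕ (a ∷ p) []      i       = sym (+-identityʳ _)
  coeff-⊕ (a ∷ p) (b ∷ q) zero    = refl
  coeff-⊕ (a ∷ p) (b ∷ q) (suc i) = coeff-⊕ p q i

  coeff-⊖ : ∀ p i → coeff (⊖ p) i ≈ - coeff p i
  coeff-⊖ []      i       = sym (RingProperties.-0#≈0# ring)
  coeff-⊖ (a ∷ p) zero    = refl
  coeff-⊖ (a ∷ p) (suc i) = coeff-⊖ p i

  coeff-scale : ∀ a p i → coeff (map (a *_) p) i ≈ a * coeff p i
  coeff-scale a []      i       = sym (zeroʳ a)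
  coeff-scale a (b ∷ p) zero    = refl
  coeff-scale a (b ∷ p) (suc i) = coeff-scale a p i

  coeff-const : ∀ a → coeff (const a) S.≐ S.const a
  coeff-const a zero    = refl
  coeff-const a (suc i) = refl

  coeff-[] : coeff [] S.≐ S.const 0#
  coeff-[] zero    = refl
  coeff-[] (suc i) = refl

  coeff-⊛ : ∀ p q → coeff (p ⊛ q) S.≐ (coeff p S.⊛ coeff q)
  coeff-⊛ [] q i = trans (coeff-[] i) (sym (trans
    (S.⊛-cong {g = coeff q} coeff-[] (λ _ → refl) i) (S.⊛-zeroˡ (coeff q) i)))
  coeff-⊛ (a ∷ p) q zero = begin
    coeff (map (a *_) q ⊕ (0# ∷ (p ⊛ q))) 0  ≈⟨ coeff-⊕ (map (a *_) q) _ 0 ⟩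
    coeff (map (a *_) q) 0 + 0#              ≈⟨ +-identityʳ _ ⟩
    coeff (map (a *_) q) 0                   ≈⟨ coeff-scale a q 0 ⟩
    a * coeff q 0                            ∎
  coeff-⊛ (a ∷ p) q (suc i) = trans (coeff-⊕ (map (a *_) q) _ (suc i))
    (+-cong (coeff-scale a q (suc i)) (coeff-⊛ p q i))

  coeff-isRingMonomorphism : IsRingMonomorphism polyRawRing SR.rawRing coeff
  coeff-isRingMonomorphism = record
    { isRingHomomorphism = record
      { isSemiringHomomorphism = record
        { isNearSemiringHomomorphism = record
          { +-isMonoidHomomorphism = record
            { isMagmaHomomorphism = record
              { isRelHomomorphism = record { cong = λ p≋q → S.coeffwise (at p≋q) }
              ; homo = λ p q → S.coeffwise (coeff-⊕ p q) }
            ; ε-homo = S.coeffwise coeff-[] }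
          ; *-homo = λ p q → S.coeffwise (coeff-⊛ p q) }
        ; 1#-homo = S.coeffwise (coeff-const 1#) }
      ; -‿homo = λ p → S.coeffwise (coeff-⊖ p) }
    ; injective = λ p≋q → coeffwise (S.at p≋q) }

  commutativeRing : CommutativeRing 0ℓ 0ℓ
  commutativeRing = record
    { RawRing polyRawRing
    ; isCommutativeRing =
        RingMonomorphism.isCommutativeRing coeff-isRingMonomorphism SR.isCommutativeRing }

  isDomain : IsDomain R → IsDomain commutativeRing
  isDomain dom = record { 1≉0 = λ e → 1≉0 (at e 0) ; zero-product = zp }
    where
    open IsDomain dom
    absorbˡ : ∀ {a b c} → a ≈ 0# → a * b + c ≈ 0# → c ≈ 0#
    absorbˡ {a} {b} {c} a≈0 e = begin
      c          ≈⟨ +-identityˡ c ⟨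
      0# + c     ≈⟨ +-congʳ (trans (*-congʳ a≈0) (zeroˡ b)) ⟨
      a * b + c  ≈⟨ e ⟩
      0#         ∎
    absorbʳ : ∀ {a b c} → b ≈ 0# → c + a * b ≈ 0# → c ≈ 0#
    absorbʳ b≈0 e = absorbˡ b≈0 (trans (trans (+-comm _ _) (+-congˡ (*-comm _ _))) e)
    cons : ∀ {a p} → a ≈ 0# → p ≋ [] → (a ∷ p) ≋ []
    cons {a} {p} a≈0 p≈0 = coeffwise go
      where
      go : ∀ i → coeff (a ∷ p) i ≈ 0#
      go zero    = a≈0
      go (suc i) = at p≈0 i
    zp : ∀ p q → (p ⊛ q) ≋ [] → p ≋ [] ⊎ q ≋ []
    zp []      q       e = inj₁ (coeffwise λ _ → refl)
    zp (a ∷ p) []      e = inj₂ (coeffwise λ _ → refl)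
    zp (a ∷ p) (b ∷ q) e =
      [ (λ a≈0 → [ (λ p≈0 → inj₁ (cons a≈0 p≈0)) , inj₂ ]′
          (zp p (b ∷ q) (coeffwise λ i → trans (coeff-⊛ p (b ∷ q) i) (absorbˡ a≈0 (c (suc i))))))
      , (λ b≈0 → [ inj₁ , (λ q≈0 → inj₂ (cons b≈0 q≈0)) ]′
          (zp (a ∷ p) q (coeffwise λ i → trans (coeff-⊛ (a ∷ p) q i) (absorbʳ b≈0
            (trans (sym (S.⊛-sucʳ (coeff (a ∷ p)) (coeff (b ∷ q)) i)) (c (suc i)))))))
      ]′ (zero-product a b (c 0))
      where
      c : ∀ i → (coeff (a ∷ p) S.⊛ coeff (b ∷ q)) i ≈ 0#
      c i = trans (sym (coeff-⊛ (a ∷ p) (b ∷ q) i)) (at e i)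

module Fractions (R : CommutativeRing 0ℓ 0ℓ) (dom : IsDomain R) where
  open CommutativeRing R
  open IsDomain dom
  open SetoidReasoning setoid
  private module Solver = SemiringSolver commutativeSemiring

  infix 9 _/_[_]

  record Fraction : Set where
    constructor _/_[_]
    field
      num   : Carrier
      den   : Carrier
      den≉0 : ¬ den ≈ 0#
  open Fraction public

  _≐_ : Fraction → Fraction → Set
  x ≐ y = num x * den y ≈ num y * den x

  infix 4 _≋_
  record _≋_ (x y : Fraction) : Set where
    constructor cross
    field uncross : x ≐ y
  open _≋_ public

  infixl 6 _⊕_
  infixl 7 _⊛_
  infix  8 ⊖_

  _⊕_ _⊛_ : Fraction → Fraction → Fraction
  x ⊕ y = (num x * den y + num y * den x) / (den x * den y) [ *≉0 (den≉0 x) (den≉0 y) ]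
  x ⊛ y = (num x * num y) / (den x * den y) [ *≉0 (den≉0 x) (den≉0 y) ]

  ⊖_ : Fraction → Fraction
  ⊖ x = (- num x) / den x [ den≉0 x ]

  embed : Carrier → Fraction
  embed a = a / 1# [ 1≉0 ]

  cancelʳ : ∀ {a b c} → ¬ c ≈ 0# → a * c ≈ b * c → a ≈ b
  cancelʳ {a} {b} {c} c≉0 e with zero-product (a - b) c (begin
    (a - b) * c        ≈⟨ distribʳ c a (- b) ⟩
    a * c + - b * c    ≈⟨ +-cong e (sym (RingProperties.-‿distribˡ-* ring b c)) ⟩
    b * c - b * c      ≈⟨ -‿inverseʳ (b * c) ⟩
    0#                 ∎)
  ... | inj₁ a-b≈0 = RingProperties.x∙y⁻¹≈ε⇒x≈y ring a b a-b≈0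
  ... | inj₂ c≈0   = ⊥-elim (c≉0 c≈0)

  ≐-trans : ∀ {x y z} → x ≐ y → y ≐ z → x ≐ z
  ≐-trans {a / b [ _ ]} {c / d [ d≉0 ]} {e / f [ _ ]} p q = cancelʳ d≉0 (begin
    (a * f) * d  ≈⟨ s₁ a f d ⟩
    (a * d) * f  ≈⟨ *-congʳ p ⟩
    (c * b) * f  ≈⟨ s₁ c b f ⟩
    (c * f) * b  ≈⟨ *-congʳ q ⟩
    (e * d) * b  ≈⟨ s₁ e d b ⟩
    (e * b) * d  ∎)
    where
    s₁ : ∀ x y z → (x * y) * z ≈ (x * z) * y
    s₁ = solve 3 (λ x y z →
      (x :* y) :* z
        := (x :* z) :* y) refl
      where open Solver

  ⊕-cong : ∀ {x x′ y y′} → x ≐ x′ → y ≐ y′ → (x ⊕ y) ≐ (x′ ⊕ y′)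
  ⊕-cong {a / b [ _ ]} {a′ / b′ [ _ ]} {c / d [ _ ]} {c′ / d′ [ _ ]} p q = begin
    (a * d + c * b) * (b′ * d′)                ≈⟨ s₁ a b c d b′ d′ ⟩
    (a * b′) * (d * d′) + (c * d′) * (b * b′)  ≈⟨ +-cong (*-congʳ p) (*-congʳ q) ⟩
    (a′ * b) * (d * d′) + (c′ * d) * (b * b′)  ≈⟨ s₂ a′ b c′ d b′ d′ ⟩
    (a′ * d′ + c′ * b′) * (b * d)              ∎
    where
    s₁ : ∀ a b c d b′ d′ → (a * d + c * b) * (b′ * d′) ≈ (a * b′) * (d * d′) + (c * d′) * (b * b′)
    s₁ = solve 6 (λ a b c d b′ d′ →
      (a :* d :+ c :* b) :* (b′ :* d′)
        := (a :* b′) :* (d :* d′) :+ (c :* d′) :* (b :* b′)) refl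
      where open Solver
    s₂ : ∀ a b c d b′ d′ → (a * b) * (d * d′) + (c * d) * (b * b′) ≈ (a * d′ + c * b′) * (b * d)
    s₂ = solve 6 (λ a b c d b′ d′ →
      (a :* b) :* (d :* d′) :+ (c :* d) :* (b :* b′)
        := (a :* d′ :+ c :* b′) :* (b :* d)) refl
      where open Solver

  ⊛-cong : ∀ {x x′ y y′} → x ≐ x′ → y ≐ y′ → (x ⊛ y) ≐ (x′ ⊛ y′)
  ⊛-cong {a / b [ _ ]} {a′ / b′ [ _ ]} {c / d [ _ ]} {c′ / d′ [ _ ]} p q = begin
    (a * c) * (b′ * d′)    ≈⟨ s a c b′ d′ ⟩
    (a * b′) * (c * d′)    ≈⟨ *-cong p q ⟩
    (a′ * b) * (c′ * d)    ≈⟨ s a′ b c′ d ⟩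
    (a′ * c′) * (b * d)    ∎
    where
    s : ∀ a b c d → (a * b) * (c * d) ≈ (a * c) * (b * d)
    s = solve 4 (λ a b c d →
      (a :* b) :* (c :* d)
        := (a :* c) :* (b :* d)) refl
      where open Solver

  ⊖-cong : ∀ {x y} → x ≐ y → (⊖ x) ≐ (⊖ y)
  ⊖-cong {a / b [ _ ]} {c / d [ _ ]} p = begin
    - a * d    ≈⟨ RingProperties.-‿distribˡ-* ring a d ⟨
    - (a * d)  ≈⟨ -‿cong p ⟩
    - (c * b)  ≈⟨ RingProperties.-‿distribˡ-* ring c b ⟩
    - c * b    ∎

  ⊕-assoc : ∀ x y z → ((x ⊕ y) ⊕ z) ≐ (x ⊕ (y ⊕ z))
  ⊕-assoc (a / b [ _ ]) (c / d [ _ ]) (e / f [ _ ]) = s a b c d e f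
    where
    s : ∀ a b c d e f → ((a * d + c * b) * f + e * (b * d)) * (b * (d * f))
                      ≈ (a * (d * f) + (c * f + e * d) * b) * ((b * d) * f)
    s = solve 6 (λ a b c d e f →
      ((a :* d :+ c :* b) :* f :+ e :* (b :* d)) :* (b :* (d :* f))
        := (a :* (d :* f) :+ (c :* f :+ e :* d) :* b) :* ((b :* d) :* f)) refl
      where open Solver

  ⊕-comm : ∀ x y → (x ⊕ y) ≐ (y ⊕ x)
  ⊕-comm (a / b [ _ ]) (c / d [ _ ]) = s a b c d
    where
    s : ∀ a b c d → (a * d + c * b) * (d * b) ≈ (c * b + a * d) * (b * d)
    s = solve 4 (λ a b c d →
      (a :* d :+ c :* b) :* (d :* b)
        := (c :* b :+ a :* d) :* (b :* d)) refl
      where open Solver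

  ⊕-identityˡ : ∀ x → (embed 0# ⊕ x) ≐ x
  ⊕-identityˡ (a / b [ _ ]) = begin
    (0# * b + a * 1#) * b  ≈⟨ *-congʳ (trans (+-congʳ (zeroˡ b)) (+-identityˡ _)) ⟩
    (a * 1#) * b           ≈⟨ *-assoc a 1# b ⟩
    a * (1# * b)           ∎

  ⊕-inverseˡ : ∀ x → ((⊖ x) ⊕ x) ≐ embed 0#
  ⊕-inverseˡ (a / b [ _ ]) = begin
    (- a * b + a * b) * 1#  ≈⟨ *-identityʳ _ ⟩
    - a * b + a * b         ≈⟨ distribʳ b (- a) a ⟨
    (- a + a) * b           ≈⟨ *-congʳ (-‿inverseˡ a) ⟩
    0# * b                  ≈⟨ zeroˡ b ⟩
    0#                      ≈⟨ zeroˡ (b * b) ⟨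
    0# * (b * b)            ∎

  ⊛-assoc : ∀ x y z → ((x ⊛ y) ⊛ z) ≐ (x ⊛ (y ⊛ z))
  ⊛-assoc (a / b [ _ ]) (c / d [ _ ]) (e / f [ _ ]) = *-cong (*-assoc a c e) (sym (*-assoc b d f))

  ⊛-comm : ∀ x y → (x ⊛ y) ≐ (y ⊛ x)
  ⊛-comm (a / b [ _ ]) (c / d [ _ ]) = *-cong (*-comm a c) (*-comm d b)

  ⊛-identityˡ : ∀ x → (embed 1# ⊛ x) ≐ x
  ⊛-identityˡ (a / b [ _ ]) = s a b
    where
    s : ∀ a b → (1# * a) * b ≈ a * (1# * b)
    s = solve 2 (λ a b →
      (con 1 :* a) :* b
        := a :* (con 1 :* b)) refl
      where open Solver

  ⊛-distribˡ : ∀ x y z → (x ⊛ (y ⊕ z)) ≐ ((x ⊛ y) ⊕ (x ⊛ z))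
  ⊛-distribˡ (a / b [ _ ]) (c / d [ _ ]) (e / f [ _ ]) = s a b c d e f
    where
    s : ∀ a b c d e f → (a * (c * f + e * d)) * ((b * d) * (b * f))
                      ≈ ((a * c) * (b * f) + (a * e) * (b * d)) * (b * (d * f))
    s = solve 6 (λ a b c d e f →
      (a :* (c :* f :+ e :* d)) :* ((b :* d) :* (b :* f))
        := ((a :* c) :* (b :* f) :+ (a :* e) :* (b :* d)) :* (b :* (d :* f))) refl
      where open Solver

  commutativeRing : CommutativeRing 0ℓ 0ℓ
  commutativeRing = record
    { Carrier = Fraction ; _≈_ = _≋_ ; _+_ = _⊕_ ; _*_ = _⊛_ ; -_ = ⊖_
    ; 0# = embed 0# ; 1# = embed 1#
    ; isCommutativeRing = record
      { isRing = record
        { +-isAbelianGroup = record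
          { isGroup = record
            { isMonoid = record
              { isSemigroup = record
                { isMagma = record
                  { isEquivalence = record
                    { refl = cross refl
                    ; sym = λ p → cross (sym (uncross p))
                    ; trans = tr }
                  ; ∙-cong = +-c }
                ; assoc = λ x y z → cross (⊕-assoc x y z) }
              ; identity = +-idˡ , (λ x → tr (+-com x (embed 0#)) (+-idˡ x)) }
            ; inverse = +-invˡ , (λ x → tr (+-com x (⊖ x)) (+-invˡ x))
            ; ⁻¹-cong = λ {x} {y} p → cross (⊖-cong {x} {y} (uncross p)) }
          ; comm = +-com }
        ; *-cong = λ {x} {x′} {y} {y′} p q → cross (⊛-cong {x} {x′} {y} {y′} (uncross p) (uncross q))
        ; *-assoc = λ x y z → cross (⊛-assoc x y z)
        ; *-identity = *-idˡ , (λ x → tr (*-com x (embed 1#)) (*-idˡ x))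
        ; distrib = dˡ
                  , (λ x y z → tr (*-com (y ⊕ z) x) (tr (dˡ x y z) (+-c (*-com x y) (*-com x z)))) }
      ; *-comm = *-com } }
    where
    tr : ∀ {x y z} → x ≋ y → y ≋ z → x ≋ z
    tr {x} {y} {z} p q = cross (≐-trans {x} {y} {z} (uncross p) (uncross q))
    +-c : ∀ {x x′ y y′} → x ≋ x′ → y ≋ y′ → x ⊕ y ≋ x′ ⊕ y′
    +-c {x} {x′} {y} {y′} p q = cross (⊕-cong {x} {x′} {y} {y′} (uncross p) (uncross q))
    +-com : ∀ x y → x ⊕ y ≋ y ⊕ x
    +-com x y = cross (⊕-comm x y)
    +-idˡ : ∀ x → embed 0# ⊕ x ≋ x
    +-idˡ x = cross (⊕-identityˡ x)
    +-invˡ : ∀ x → (⊖ x) ⊕ x ≋ embed 0#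
    +-invˡ x = cross (⊕-inverseˡ x)
    *-com : ∀ x y → x ⊛ y ≋ y ⊛ x
    *-com x y = cross (⊛-comm x y)
    *-idˡ : ∀ x → embed 1# ⊛ x ≋ x
    *-idˡ x = cross (⊛-identityˡ x)
    dˡ : ∀ x y z → x ⊛ (y ⊕ z) ≋ (x ⊛ y) ⊕ (x ⊛ z)
    dˡ x y z = cross (⊛-distribˡ x y z)

-- The polynomials D_n(a , b) and N_n(a) evaluated at elements a, b of a
-- commutative ring R with coefficient map ι. Substituting into D_n or N_n
-- means evaluating in the ring where the substituted elements live.
module Evaluation (R : CommutativeRing 0ℓ 0ℓ) (ι : ℚ → CommutativeRing.Carrier R) where
  open CommutativeRing R
  open Exp semiring public using (_^_)

  # : ℕ → Carrier
  # m = ι (+ m ℚ./ 1)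

  ∑ : ∀ {A : Set} → List A → (A → Carrier) → Carrier
  ∑ xs f = foldr (λ x s → f x + s) 0# xs

  𝐃 : ℕ → Carrier → Carrier → Carrier
  𝐃 n a b = ∑ (𝒟 n) λ μ → a ^ (hk μ ℕ.+ 1) * b ^ pk μ

  𝐍 : (n : ℕ) .{{_ : NonZero n}} → Carrier → Carrier
  𝐍 n a = ι (+ 1 ℚ./ n) * ∑ (map suc (upTo n)) λ k → (# (n C k) * # (n C (k ∸ 1))) * a ^ k

module ℚ[y] where
  open Polynomial ℚ-ring public using (commutativeRing; isDomain)
  open CommutativeRing commutativeRing public

  ι : ℚ → Carrier
  ι = Polynomial.const ℚ-ring

  y : Carrier
  y = Polynomial.X ℚ-ring

-- ℚ[y,t] is realised as (ℚ[y])[t].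
module ℚ[y,t] where
  open Polynomial ℚ[y].commutativeRing public using (commutativeRing)
  open CommutativeRing commutativeRing public

  ι : ℚ → Carrier
  ι q = Polynomial.const ℚ[y].commutativeRing (ℚ[y].ι q)

  y t : Carrier
  y = Polynomial.const ℚ[y].commutativeRing ℚ[y].y
  t = Polynomial.X ℚ[y].commutativeRing

  open Evaluation commutativeRing ι public

  isDomain : IsDomain commutativeRing
  isDomain = Polynomial.isDomain ℚ[y].commutativeRing (ℚ[y].isDomain ℚ-isDomain)

  open IsDomain isDomain public

  open Polynomial ℚ[y].commutativeRing using () renaming (at to atₜ)
  open Polynomial ℚ-ring using () renaming (at to atᵧ)

  1+y≉0 : ¬ 1# + y ≈ 0#
  1+y≉0 e with () ← atᵧ (atₜ e 0) 0

  y+t≉0 : ¬ y + t ≈ 0#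
  y+t≉0 e with () ← atᵧ (atₜ e 1) 0

  1+yt≉0 : ¬ 1# + y * t ≈ 0#
  1+yt≉0 e with () ← atᵧ (atₜ e 0) 0

-- The field ℚ(y,t) of rational functions; p / q [ q≉0 ] is the fraction of
-- the polynomials p and q, and embed p is p / 1.
module ℚ⟨y,t⟩ where
  open Fractions ℚ[y,t].commutativeRing ℚ[y,t].isDomain public using (commutativeRing; _/_[_]; embed)
  open CommutativeRing commutativeRing public

  t : Carrier
  t = embed ℚ[y,t].t

  open Evaluation commutativeRing (λ q → embed (ℚ[y,t].ι q)) public

module ℚ[y]⟦t⟧ where
  open PowerSeries ℚ[y].commutativeRing public using (commutativeRing)
  open CommutativeRing commutativeRing public

  ι : ℚ → Carrier
  ι q = PowerSeries.const ℚ[y].commutativeRing (ℚ[y].ι q)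

  y t : Carrier
  y = PowerSeries.const ℚ[y].commutativeRing ℚ[y].y
  t = PowerSeries.X ℚ[y].commutativeRing

  open Evaluation commutativeRing ι public

  IsSqrt : Carrier → Carrier → Set
  IsSqrt s f = (s 0 ℚ[y].≈ ℚ[y].1#) × (s ^ 2 ≈ f)

  -- q is the quotient a / b; it is unique as ℚ[y]⟦t⟧ has no zero divisors.
  _IsQuotient_÷_ : Carrier → Carrier → Carrier → Set
  q IsQuotient a ÷ b = (¬ b ≈ 0#) × (q * b ≈ a)

  -- The defining equations of √((1+t)² - 4yt), u, v and (1+u)/(1+uv) as
  -- elements of ℚ[y]⟦t⟧; that u and v are power series is the assertion that
  -- this type is inhabited.
  record Substitution : Set where
    field
      √Δ u v ratio : Carrier
      √Δ-def    : IsSqrt √Δ ((1# + t) ^ 2 - # 4 * y * t)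
      u-def     : u IsQuotient (1# + t ^ 2 - # 2 * y * t - (1# - t) * √Δ)
                    ÷ (# 2 * (1# - y) * t)
      v-def     : v IsQuotient ((1# + t) ^ 2 - # 2 * y * t - (1# + t) * √Δ)
                    ÷ (# 2 * y * t)
      ratio-def : ratio IsQuotient (1# + u) ÷ (1# + u * v)

{-# OPTIONS --safe #-}
module Submission where

-- Splitting off the letters of a word one at a time, and remembering whether
-- the letters just read are U, D or DD, yields a linear system whose solution
-- shows that the generating series F of the nonempty Dyck paths (x marking
-- semilength, y^(hk+1) replaced by y^hk) satisfies F = x (t + (1 + t) F + y
-- F²). Hence F = t x M, where M is the series of Motzkin paths with level steps
-- weighted 1 + t and up steps weighted y t, and inserting the level steps into
-- ballot paths gives the closed formula for D_n. By the reflection principle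
-- N_n(s) is s times the Motzkin polynomial with weights 1 + s and s. Motzkin
-- polynomials are homogeneous under (1 + s, s) ↦ (ρ (1 + s), ρ² s), so both
-- substitutions reduce to identities of the form ρ (1 + s) = 1 + b and ρ² s = a
-- b.

open import Defs
open import Level using (0ℓ)
open import Algebra.Bundles using (CommutativeRing; RawRing)
open import Algebra.Morphism.Structures using (IsRingHomomorphism)
import Algebra.Morphism.Construct.Composition as Composition
import Algebra.Morphism.Construct.Identity as Identity
import Algebra.Properties.CommutativeSemiring.Exp as CExp
import Algebra.Properties.Ring as RingProperties
import Algebra.Solver.Ring as RingSolver
open import Algebra.Solver.Ring.AlmostCommutativeRing using (fromCommutativeRing; _-Raw-AlmostCommutative⟶_)
import Algebra.Solver.Ring.NaturalCoefficients.Default as SemiringSolver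
open import Data.Empty using (⊥-elim)
open import Data.Integer.Base as ℤ using (ℤ; +_)
import Data.Integer.Properties as ℤₚ
open import Data.List.Base as List using (List; []; _∷_; _++_; filter; length; map; upTo)
import Data.List.Properties as Listₚ
import Data.Maybe.Base as Maybe
open import Data.Nat.Base as ℕ using (ℕ; zero; suc; _∸_; z≤n; s≤s; ⌊_/2⌋; NonZero)
open import Data.Nat.Combinatorics using (_C_; nCk≡nC[n∸k]; k>n⇒nCk≡0; nCk+nC[k+1]≡[n+1]C[k+1]; nC1≡n)
import Data.Nat.Properties as ℕₚ
open import Data.Nat.Solver using (module +-*-Solver)
open import Data.Product.Base using (_×_; _,_; proj₂)
open import Data.Rational.Base as ℚ using (ℚ; 0ℚ; 1ℚ)
import Data.Rational.Properties as ℚₚ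
open import Data.Rational.Unnormalised.Base as ℚᵘ using (mkℚᵘ; *≡*)
import Data.Rational.Unnormalised.Properties as ℚᵘₚ
open import Data.Sum.Base using (inj₁; inj₂; [_,_]′)
open import Function.Base using (_∘_)
open import Relation.Binary.Consequences using (dec⇒weaklyDec)
open import Relation.Binary.PropositionalEquality as ≡ using (_≡_; _≢_)
import Relation.Binary.Reasoning.Setoid as SetoidReasoning
open import Relation.Nullary.Decidable using (Dec; yes; no; _×-dec_)
open import Relation.Nullary.Negation using (¬_)

-- Formal power series

-- `𝒟 n` is a filter of the list of all words: it has a recursion along letters but no ready
-- factorisation of paths. So no bijection is built. Series guessed from a factorisation are checked
-- to solve the recursion of the words, and induction on the length identifies the two. The
-- quadratic equation becomes linear on passing to all powers of F, which obey the recurrence of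
-- Motzkin paths by starting height; hence every count carries a height although only height 0
-- matters in the end. The exponent n + 1 in both substitutions is (n - 1) + 2: the Motzkin
-- polynomials have length n - 1, and the prefactors ab and s, related by ρ², supply the rest. The
-- radical substitution needs two directions: series meeting the definitions of the root, u, v and
-- the ratio are constructed as fixed points, and any such series are shown to satisfy the two
-- conditions on ρ. Division of series is replaced by cancellation in polynomial identities, of t by
-- shifting and of other factors by their nonzero constant term.

module SeriesProperties (R : CommutativeRing 0ℓ 0ℓ) where
  open CommutativeRing R
  open PowerSeries R hiding (commutativeRing; _≐_)
  private module S = CommutativeRing (PowerSeries.commutativeRing R)
  open SetoidReasoning setoid

  infix 4 _≈[_]_
  _≈[_]_ : Series → ℕ → Series → Set
  f ≈[ n ] g = ∀ i → i ℕ.< n → f i ≈ g i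

  -- The first n coefficients of `K f` depend only on the first n of `f`. Then `f ↦ c + X · K f`
  -- gains one coefficient per application and has a fixed point by iteration.
  Nonexpansive : (Series → Series) → Set
  Nonexpansive K = ∀ {n f g} → f ≈[ n ] g → K f ≈[ n ] K g

  id-nonexpansive : Nonexpansive (λ f → f)
  id-nonexpansive p = p

  const-nonexpansive : ∀ f → Nonexpansive (λ _ → f)
  const-nonexpansive f _ _ _ = refl

  ⊕-nonexpansive : ∀ {K L} → Nonexpansive K → Nonexpansive L → Nonexpansive (λ f → K f ⊕ L f)
  ⊕-nonexpansive k l p i i<n = +-cong (k p i i<n) (l p i i<n)

  ⊖-nonexpansive : ∀ {K} → Nonexpansive K → Nonexpansive (λ f → ⊖ K f)
  ⊖-nonexpansive k p i i<n = -‿cong (k p i i<n)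

  ⊛-agree : ∀ {f f′ g g′ n} → f ≈[ n ] f′ → g ≈[ n ] g′ → (f ⊛ g) ≈[ n ] (f′ ⊛ g′)
  ⊛-agree p q zero    0<n = *-cong (p 0 0<n) (q 0 0<n)
  ⊛-agree p q (suc i) (s≤s i<n) = +-cong
    (*-cong (p 0 (s≤s z≤n)) (q (suc i) (s≤s i<n)))
    (⊛-agree (λ j j<n → p (suc j) (s≤s j<n)) (λ j j<n → q j (ℕₚ.m≤n⇒m≤1+n j<n)) i i<n)

  ⊛-nonexpansive : ∀ {K L} → Nonexpansive K → Nonexpansive L → Nonexpansive (λ f → K f ⊛ L f)
  ⊛-nonexpansive k l p = ⊛-agree (k p) (l p)

  X⊛-zero : ∀ f → (X ⊛ f) 0 ≈ 0#
  X⊛-zero f = zeroˡ (f 0)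

  X⊛-suc : ∀ f n → (X ⊛ f) (suc n) ≈ f n
  X⊛-suc f n = begin
    0# * f (suc n) + (tail X ⊛ f) n
      ≈⟨ +-cong (zeroˡ _) (⊛-cong {f = tail X} {f′ = const 1#} {g = f} tailX (λ _ → refl) n) ⟩
    0# + (const 1# ⊛ f) n            ≈⟨ +-identityˡ _ ⟩
    (const 1# ⊛ f) n                 ≈⟨ ⊛-identityˡ f n ⟩
    f n                              ∎
    where
    tailX : ∀ i → tail X i ≈ const 1# i
    tailX zero    = refl
    tailX (suc i) = refl

  const⊛ : ∀ a f n → (const a ⊛ f) n ≈ a * f n
  const⊛ a f zero    = refl
  const⊛ a f (suc n) = begin
    a * f (suc n) + (tail (const a) ⊛ f) n
      ≈⟨ +-congˡ (⊛-cong {f = tail (const a)} {f′ = const 0#} {g = f} tail0 (λ _ → refl) n) ⟩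
    a * f (suc n) + (const 0# ⊛ f) n        ≈⟨ +-congˡ (⊛-zeroˡ f n) ⟩
    a * f (suc n) + const 0# n              ≈⟨ +-congˡ (const0 n) ⟩
    a * f (suc n) + 0#                      ≈⟨ +-identityʳ _ ⟩
    a * f (suc n)                           ∎
    where
    const0 : ∀ i → const 0# i ≈ 0#
    const0 zero    = refl
    const0 (suc i) = refl
    tail0 : ∀ i → tail (const a) i ≈ const 0# i
    tail0 zero    = refl
    tail0 (suc i) = refl

  0#-at : ∀ n → S.0# n ≈ 0#
  0#-at zero    = refl
  0#-at (suc n) = refl

  module Solution (c : Carrier) (K : Series → Series) (K-nonexpansive : Nonexpansive K) where

    infixr 5 _∷ₛ_
    _∷ₛ_ : Carrier → Series → Series
    (a ∷ₛ f) zero    = a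
    (a ∷ₛ f) (suc n) = f n

    approx : ℕ → Series
    approx zero    = const 0#
    approx (suc n) = c ∷ₛ K (approx n)

    -- The diagonal of the iterates: coefficient n no longer changes from `approx (suc n)` on.
    solution : Series
    solution n = approx (suc n) n

    ∷ₛ-agree : ∀ {a n f g} → f ≈[ n ] g → (a ∷ₛ f) ≈[ suc n ] (a ∷ₛ g)
    ∷ₛ-agree p zero    _         = refl
    ∷ₛ-agree p (suc i) (s≤s i<n) = p i i<n

    approx-step : ∀ n → approx (suc n) ≈[ n ] approx n
    approx-step zero    i ()
    approx-step (suc n) = ∷ₛ-agree (K-nonexpansive (approx-step n))

    approx-stable : ∀ {m n} → m ℕ.≤′ n → approx n ≈[ m ] approx m
    approx-stable (ℕ.≤′-reflexive ≡.refl) i i<m = refl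
    approx-stable {n = suc n} (ℕ.≤′-step m≤n) i i<m =
      trans (approx-step n i (ℕₚ.<-≤-trans i<m (ℕₚ.≤′⇒≤ m≤n))) (approx-stable m≤n i i<m)

    solution-agree : ∀ n → approx n ≈[ n ] solution
    solution-agree n i i<n = approx-stable (ℕₚ.≤⇒≤′ i<n) i ℕₚ.≤-refl

    solution-suc : ∀ n → solution (suc n) ≈ K solution n
    solution-suc n = K-nonexpansive (solution-agree (suc n)) n ℕₚ.≤-refl

    solution-≋ : solution ≋ const c ⊕ (X ⊛ K solution)
    solution-≋ = coeffwise λ
      { zero    → sym (trans (+-congˡ (X⊛-zero (K solution))) (+-identityʳ _))
      ; (suc n) → trans (solution-suc n) (sym (trans (+-identityˡ _) (X⊛-suc (K solution) n))) }

  module Cancellation (dom : IsDomain R) where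
    open IsDomain dom

    -- The bound n stands in for strong induction: once all earlier coefficients of `g` vanish,
    -- coefficient n of the product is `f 0 * g n`.
    ⊛-zero-factor : ∀ f g → ¬ f 0 ≈ 0# → f ⊛ g ≋ S.0# → ∀ n i → i ℕ.< n → g i ≈ 0#
    ⊛-zero-factor f g f₀≉0 e (suc n) i (s≤s i≤n) with ℕₚ.m≤n⇒m<n∨m≡n i≤n
    ... | inj₁ i<n    = ⊛-zero-factor f g f₀≉0 e n i i<n
    ... | inj₂ ≡.refl with zero-product (f 0) (g n) (leading n (⊛-zero-factor f g f₀≉0 e n))
      where
      leading : ∀ n → (∀ i → i ℕ.< n → g i ≈ 0#) → f 0 * g n ≈ 0#
      leading zero    _ = at e 0
      leading (suc n) p = begin
        f 0 * g (suc n)                     ≈⟨ +-identityʳ _ ⟨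
        f 0 * g (suc n) + 0#                ≈⟨ +-congˡ (0#-at n) ⟨
        f 0 * g (suc n) + S.0# n            ≈⟨ +-congˡ (at (S.zeroʳ (tail f)) n) ⟨
        f 0 * g (suc n) + (tail f ⊛ S.0#) n
          ≈⟨ +-congˡ (⊛-agree {n = suc n} (λ _ _ → refl) (λ j j<n → trans (0#-at j) (sym (p j j<n))) n ℕₚ.≤-refl) ⟩
        f 0 * g (suc n) + (tail f ⊛ g) n    ≈⟨ at e (suc n) ⟩
        0#                                  ∎
    ...   | inj₁ f₀≈0 = ⊥-elim (f₀≉0 f₀≈0)
    ...   | inj₂ gₙ≈0 = gₙ≈0

    ⊛-cancelˡ : ∀ f {g h} → ¬ f 0 ≈ 0# → f ⊛ g ≋ f ⊛ h → g ≋ h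
    ⊛-cancelˡ f {g} {h} f₀≉0 e = RingProperties.x∙y⁻¹≈ε⇒x≈y S.ring g h (coeffwise λ n →
      trans (⊛-zero-factor f (g ⊕ (⊖ h)) f₀≉0 diff (suc n) n ℕₚ.≤-refl) (sym (0#-at n)))
      where
      diff : f ⊛ (g ⊕ (⊖ h)) ≋ S.0#
      diff = S.trans (S.distribˡ f g (⊖ h))
        (S.trans (S.+-cong e (S.sym (RingProperties.-‿distribʳ-* S.ring f h))) (S.-‿inverseʳ (f ⊛ h)))

  -- `X` has constant term zero, out of reach of `⊛-cancelˡ`; the factor t in the denominators of u
  -- and v is removed by shifting coefficients.
  X-cancelˡ : ∀ {f g} → X ⊛ f ≋ X ⊛ g → f ≋ g
  X-cancelˡ {f} {g} e = coeffwise λ n →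
    trans (sym (X⊛-suc f n)) (trans (at e (suc n)) (X⊛-suc g n))

-- Dyck words

filter-U : ∀ h ws → filter (dyckFrom? h) (map (U ∷_) ws) ≡ map (U ∷_) (filter (dyckFrom? (suc h)) ws)
filter-U h []       = ≡.refl
-- `dyckFrom?` splits on the height before the letter, so U needs a clause for each shape of the
-- height.
filter-U zero (w ∷ ws) with dyckFrom? 1 w
... | yes _ = ≡.cong ((U ∷ w) ∷_) (filter-U 0 ws)
... | no  _ = filter-U 0 ws
filter-U (suc h) (w ∷ ws) with dyckFrom? (suc (suc h)) w
... | yes _ = ≡.cong ((U ∷ w) ∷_) (filter-U (suc h) ws)
... | no  _ = filter-U (suc h) ws

filter-D-zero : ∀ ws → filter (dyckFrom? 0) (map (D ∷_) ws) ≡ []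
filter-D-zero []       = ≡.refl
filter-D-zero (w ∷ ws) = filter-D-zero ws

filter-D-suc : ∀ h ws → filter (dyckFrom? (suc h)) (map (D ∷_) ws) ≡ map (D ∷_) (filter (dyckFrom? h) ws)
filter-D-suc h []       = ≡.refl
filter-D-suc h (w ∷ ws) with dyckFrom? h w
... | yes _ = ≡.cong ((D ∷ w) ∷_) (filter-D-suc h ws)
... | no  _ = filter-D-suc h ws

-- Finite sums, binomial transforms, ballot and Motzkin weights

module Sums (R : CommutativeRing 0ℓ 0ℓ) where
  open CommutativeRing R
  open SetoidReasoning setoid
  open SemiringSolver commutativeSemiring using (solve; _:+_; _:*_; _:=_; con)

  ∑ : ∀ {A : Set} → List A → (A → Carrier) → Carrier
  ∑ xs f = List.foldr (λ x s → f x + s) 0# xs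

  ∑-cong : ∀ {A : Set} (xs : List A) {f g : A → Carrier} → (∀ x → f x ≈ g x) → ∑ xs f ≈ ∑ xs g
  ∑-cong []       e = refl
  ∑-cong (x ∷ xs) e = +-cong (e x) (∑-cong xs e)

  ∑-++ : ∀ {A : Set} (xs ys : List A) f → ∑ (xs ++ ys) f ≈ ∑ xs f + ∑ ys f
  ∑-++ []       ys f = sym (+-identityˡ _)
  ∑-++ (x ∷ xs) ys f = trans (+-congˡ (∑-++ xs ys f)) (sym (+-assoc _ _ _))

  ∑-map : ∀ {A B : Set} (g : A → B) xs f → ∑ (map g xs) f ≡ ∑ xs (f ∘ g)
  ∑-map g []       f = ≡.refl
  ∑-map g (x ∷ xs) f = ≡.cong (λ z → f (g x) + z) (∑-map g xs f)

  ∑-distribˡ : ∀ {A : Set} c (xs : List A) f → c * ∑ xs f ≈ ∑ xs (λ x → c * f x)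
  ∑-distribˡ c []       f = zeroʳ c
  ∑-distribˡ c (x ∷ xs) f = trans (distribˡ c _ _) (+-congˡ (∑-distribˡ c xs f))

  ∑-+ : ∀ {A : Set} (xs : List A) f g → ∑ xs (λ x → f x + g x) ≈ ∑ xs f + ∑ xs g
  ∑-+ []       f g = sym (+-identityˡ _)
  ∑-+ (x ∷ xs) f g = trans (+-congˡ (∑-+ xs f g)) (s (f x) (g x) (∑ xs f) (∑ xs g))
    where
    s : ∀ a b c d → (a + b) + (c + d) ≈ (a + c) + (b + d)
    s = solve 4 (λ a b c d → (a :+ b) :+ (c :+ d) := (a :+ c) :+ (b :+ d)) refl

  ∑< : ℕ → (ℕ → Carrier) → Carrier
  ∑< n = ∑ (upTo n)

  ∑<-suc : ∀ n f → ∑< (suc n) f ≡ f 0 + ∑< n (f ∘ suc)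
  ∑<-suc n f = ≡.cong (λ z → f 0 + z) (≡.trans
    (≡.cong (λ xs → ∑ xs f) (≡.sym (Listₚ.map-upTo suc n)))
    (∑-map suc (upTo n) f))

  ∑<-cong : ∀ n {f g} → (∀ i → i ℕ.< n → f i ≈ g i) → ∑< n f ≈ ∑< n g
  ∑<-cong zero    e = refl
  ∑<-cong (suc n) {f} {g} e = begin
    ∑< (suc n) f            ≡⟨ ∑<-suc n f ⟩
    f 0 + ∑< n (f ∘ suc)    ≈⟨ +-cong (e 0 (s≤s z≤n)) (∑<-cong n (λ i i<n → e (suc i) (s≤s i<n))) ⟩
    g 0 + ∑< n (g ∘ suc)    ≡⟨ ∑<-suc n g ⟨
    ∑< (suc n) g            ∎

  ∑<-last : ∀ n f → ∑< (suc n) f ≈ ∑< n f + f n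
  ∑<-last n f = begin
    ∑ (upTo (suc n)) f          ≡⟨ ≡.cong (λ xs → ∑ xs f) (Listₚ.upTo-∷ʳ n) ⟨
    ∑ (upTo n List.∷ʳ n) f      ≈⟨ ∑-++ (upTo n) (n ∷ []) f ⟩
    ∑< n f + (f n + 0#)         ≈⟨ +-congˡ (+-identityʳ _) ⟩
    ∑< n f + f n                ∎

  ∑<-zero : ∀ n f → (∀ i → f i ≈ 0#) → ∑< n f ≈ 0#
  ∑<-zero zero    f z = refl
  ∑<-zero (suc n) f z = trans (reflexive (∑<-suc n f))
    (trans (+-cong (z 0) (∑<-zero n (f ∘ suc) (z ∘ suc))) (+-identityˡ 0#))

  ∑<-single : ∀ {n k} f → (∀ i → i ≢ k → f i ≈ 0#) → k ℕ.< n → ∑< n f ≈ f k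
  ∑<-single {suc n} {zero}  f z _ = trans (reflexive (∑<-suc n f))
    (trans (+-congˡ (∑<-zero n (f ∘ suc) (λ i → z (suc i) λ ()))) (+-identityʳ _))
  ∑<-single {suc n} {suc k} f z (s≤s k<n) = trans (reflexive (∑<-suc n f))
    (trans (+-cong (z 0 λ ()) (∑<-single (f ∘ suc) (λ i i≢k → z (suc i) (i≢k ∘ ℕₚ.suc-injective)) k<n)) (+-identityˡ _))

  ∑<-outside : ∀ {n k} f → (∀ i → i ≢ k → f i ≈ 0#) → n ℕ.≤ k → ∑< n f ≈ 0#
  ∑<-outside {zero}  f z _ = refl
  ∑<-outside {suc n} {suc k} f z (s≤s n≤k) = trans (reflexive (∑<-suc n f))
    (trans (+-cong (z 0 λ ()) (∑<-outside (f ∘ suc) (λ i i≢k → z (suc i) (i≢k ∘ ℕₚ.suc-injective)) n≤k)) (+-identityˡ _))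

  -- This is the sum of C(m,i) p^(m-i) q^i f(i), or (p + qE)^m applied to `f` at 0 with E the shift.
  -- The recursive form lets it inherit recurrences of `f`; `Bin-closed` recovers the sum.
  Bin : (p q : Carrier) → ℕ → (ℕ → Carrier) → Carrier
  Bin p q zero    f = f 0
  Bin p q (suc m) f = p * Bin p q m f + q * Bin p q m (f ∘ suc)

  Bin-cong : ∀ {p q} m {f g} → (∀ i → f i ≈ g i) → Bin p q m f ≈ Bin p q m g
  Bin-cong zero    e = e 0
  Bin-cong (suc m) e = +-cong (*-congˡ (Bin-cong m e)) (*-congˡ (Bin-cong m (e ∘ suc)))

  Bin-+ : ∀ {p q} m f g → Bin p q m (λ i → f i + g i) ≈ Bin p q m f + Bin p q m g
  Bin-+ zero    f g = refl
  Bin-+ {p} {q} (suc m) f g =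
    trans (+-cong (*-congˡ (Bin-+ m f g)) (*-congˡ (Bin-+ m (f ∘ suc) (g ∘ suc))))
      (s p q (Bin p q m f) (Bin p q m g) (Bin p q m (f ∘ suc)) (Bin p q m (g ∘ suc)))
    where
    s : ∀ p q a b c d → p * (a + b) + q * (c + d) ≈ (p * a + q * c) + (p * b + q * d)
    s = solve 6 (λ p q a b c d → p :* (a :+ b) :+ q :* (c :+ d) := (p :* a :+ q :* c) :+ (p :* b :+ q :* d)) refl

  Bin-*ˡ : ∀ {p q} m c f → Bin p q m (λ i → c * f i) ≈ c * Bin p q m f
  Bin-*ˡ zero    c f = refl
  Bin-*ˡ {p} {q} (suc m) c f =
    trans (+-cong (*-congˡ (Bin-*ˡ m c f)) (*-congˡ (Bin-*ˡ m c (f ∘ suc))))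
      (s p q c (Bin p q m f) (Bin p q m (f ∘ suc)))
    where
    s : ∀ p q c x y → p * (c * x) + q * (c * y) ≈ c * (p * x + q * y)
    s = solve 5 (λ p q c x y → p :* (c :* x) :+ q :* (c :* y) := c :* (p :* x :+ q :* y)) refl

  -- β c h i and M b c h n are the weights of the ballot, respectively Motzkin
  -- paths of length i, n from height h down to 0: an up step weighs c, a level
  -- step b. A Motzkin path is a ballot path with level steps inserted.
  β : Carrier → ℕ → ℕ → Carrier
  β c zero    zero    = 1#
  β c (suc h) zero    = 0#
  β c zero    (suc i) = c * β c 1 i
  β c (suc h) (suc i) = β c h i + c * β c (suc (suc h)) i

  M : (b c : Carrier) → ℕ → ℕ → Carrier
  M b c h n = Bin b 1# n (β c h)

  M-zero-suc : ∀ b c n → M b c 0 (suc n) ≈ b * M b c 0 n + c * M b c 1 n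
  M-zero-suc b c n = +-congˡ (trans (*-identityˡ _) (Bin-*ˡ n c (β c 1)))

  -- The recursion of `Bin` decides whether the first step is level; if not, the recursion of `β`
  -- makes it a down or an up step.
  M-suc-suc : ∀ b c h n → M b c (suc h) (suc n) ≈ b * M b c (suc h) n + (M b c h n + c * M b c (suc (suc h)) n)
  M-suc-suc b c h n = +-congˡ (trans (*-identityˡ _) (trans (Bin-+ n (β c h) _)
    (+-congˡ (Bin-*ˡ n c (β c (suc (suc h)))))))

-- The linear system of Dyck words and its solution

module DyckIdentities (R : CommutativeRing 0ℓ 0ℓ) where
  open CommutativeRing R
  open SemiringSolver commutativeSemiring

  -- The origin of the quadratic, with θ = xψ: the equation for `û` asks for ψH + b(1 + θ), where H
  -- = x(1 + aθ), and this expands to b + (1 + b)θ + aθ².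
  step-u : ∀ x ψ a b h → x * (b + (1# + b) * (x * ψ) + a * ((x * ψ) * (x * ψ))) * h
    ≈ x * (ψ * ((x * (1# + a * (x * ψ))) * h) + b * ((1# + x * ψ) * h))
  step-u = solve 5 (λ x ψ a b h → x :* (b :+ (con 1 :+ b) :* (x :* ψ) :+ a :* ((x :* ψ) :* (x :* ψ))) :* h
    := x :* (ψ :* ((x :* (con 1 :+ a :* (x :* ψ))) :* h) :+ b :* ((con 1 :+ x :* ψ) :* h))) refl

  step-d₀ : ∀ x ψ → (1# + x * ψ) * 1# ≈ 1# + x * (ψ * 1#)
  step-d₀ = solve 2 (λ x ψ → (con 1 :+ x :* ψ) :* con 1 := con 1 :+ x :* (ψ :* con 1)) refl

  step-d : ∀ x ψ g h → (1# + x * ψ) * ((x * g) * h) ≈ x * (ψ * ((x * g) * h) + g * h)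
  step-d = solve 4 (λ x ψ g h → (con 1 :+ x :* ψ) :* ((x :* g) :* h) := x :* (ψ :* ((x :* g) :* h) :+ g :* h)) refl

  step-e₀ : ∀ x ψ a → (1# + a * (x * ψ)) * 1# ≈ 1# + x * (a * (ψ * 1#))
  step-e₀ = solve 3 (λ x ψ a → (con 1 :+ a :* (x :* ψ)) :* con 1 := con 1 :+ x :* (a :* (ψ :* con 1))) refl

  step-e : ∀ x ψ a h → let g = 1# + a * (x * ψ) in g * ((x * g) * h) ≈ x * (a * (ψ * ((x * g) * h)) + g * h)
  step-e = solve 4 (λ x ψ a h → let g = con 1 :+ a :* (x :* ψ) in
    g :* ((x :* g) :* h) := x :* (a :* (ψ :* ((x :* g) :* h)) :+ g :* h)) refl

  step-θ : ∀ x a b θ h → (x * (x * (b + (1# + b) * θ + a * (θ * θ)))) * h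
    ≈ x * (x * (b * h + (1# + b) * (θ * h) + a * (θ * (θ * h))))
  step-θ = solve 5 (λ x a b θ h → (x :* (x :* (b :+ (con 1 :+ b) :* θ :+ a :* (θ :* θ)))) :* h
    := x :* (x :* (b :* h :+ (con 1 :+ b) :* (θ :* h) :+ a :* (θ :* (θ :* h))))) refl

  motzkin : ∀ a b p m₀ m₁ m₂ → b * (p * m₀) + (1# + b) * (b * p * m₁) + a * (b * (b * p) * m₂)
    ≈ b * p * ((1# + b) * m₁ + (m₀ + a * b * m₂))
  motzkin = solve 6 (λ a b p m₀ m₁ m₂ → b :* (p :* m₀) :+ (con 1 :+ b) :* (b :* p :* m₁) :+ a :* (b :* (b :* p) :* m₂)
    := b :* p :* ((con 1 :+ b) :* m₁ :+ (m₀ :+ a :* b :* m₂))) refl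

  motzkin₀ : ∀ a b m₁ m₂ → (1# + b) * (b * 1# * m₁) + a * (b * (b * 1#) * m₂)
    ≈ b * 1# * ((1# + b) * m₁ + a * b * m₂)
  motzkin₀ = solve 4 (λ a b m₁ m₂ → (con 1 :+ b) :* (b :* con 1 :* m₁) :+ a :* (b :* (b :* con 1) :* m₂)
    := b :* con 1 :* ((con 1 :+ b) :* m₁ :+ a :* b :* m₂)) refl

module DyckSums (R : CommutativeRing 0ℓ 0ℓ) (a b : CommutativeRing.Carrier R) where
  open CommutativeRing R
  open SetoidReasoning setoid
  open CExp commutativeSemiring using (_^_)
  open Sums R
  open SeriesProperties R
  private
    module P = PowerSeries R
    module S = CommutativeRing P.commutativeRing
    module I = DyckIdentities P.commutativeRing
    open P using (X; const)

  wt : Word → Carrier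
  wt w = a ^ hk w * b ^ pk w

  W : ℕ → ℕ → (Word → Carrier) → Carrier
  W h m = ∑ (filter (dyckFrom? h) (words m))

  W-split : ∀ h m φ → W h (suc m) φ
    ≈ W (suc h) m (φ ∘ (U ∷_)) + ∑ (filter (dyckFrom? h) (map (D ∷_) (words m))) φ
  W-split h m φ = begin
    ∑ (filter (dyckFrom? h) (map (U ∷_) (words m) ++ map (D ∷_) (words m))) φ
      ≡⟨ ≡.cong (λ ws → ∑ ws φ) (Listₚ.filter-++ (dyckFrom? h) (map (U ∷_) (words m)) _) ⟩
    ∑ (filter (dyckFrom? h) (map (U ∷_) (words m)) ++ filter (dyckFrom? h) (map (D ∷_) (words m))) φ
      ≈⟨ ∑-++ (filter (dyckFrom? h) (map (U ∷_) (words m))) _ φ ⟩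
    ∑ (filter (dyckFrom? h) (map (U ∷_) (words m))) φ + ∑ (filter (dyckFrom? h) (map (D ∷_) (words m))) φ
      ≈⟨ +-congʳ (reflexive (≡.cong (λ ws → ∑ ws φ) (filter-U h (words m)))) ⟩
    ∑ (map (U ∷_) (filter (dyckFrom? (suc h)) (words m))) φ + ∑ (filter (dyckFrom? h) (map (D ∷_) (words m))) φ
      ≈⟨ +-congʳ (reflexive (∑-map (U ∷_) (filter (dyckFrom? (suc h)) (words m)) φ)) ⟩
    W (suc h) m (φ ∘ (U ∷_)) + ∑ (filter (dyckFrom? h) (map (D ∷_) (words m))) φ ∎

  W-zero-suc : ∀ m φ → W 0 (suc m) φ ≈ W 1 m (φ ∘ (U ∷_))
  W-zero-suc m φ = begin
    W 0 (suc m) φ                     ≈⟨ W-split 0 m φ ⟩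
    W 1 m (φ ∘ (U ∷_)) + ∑ (filter (dyckFrom? 0) (map (D ∷_) (words m))) φ
      ≈⟨ +-congˡ (reflexive (≡.cong (λ ws → ∑ ws φ) (filter-D-zero (words m)))) ⟩
    W 1 m (φ ∘ (U ∷_)) + 0#           ≈⟨ +-identityʳ _ ⟩
    W 1 m (φ ∘ (U ∷_))                ∎

  W-suc-suc : ∀ h m φ → W (suc h) (suc m) φ ≈ W (suc (suc h)) m (φ ∘ (U ∷_)) + W h m (φ ∘ (D ∷_))
  W-suc-suc h m φ = begin
    W (suc h) (suc m) φ ≈⟨ W-split (suc h) m φ ⟩
    W (suc (suc h)) m (φ ∘ (U ∷_)) + ∑ (filter (dyckFrom? (suc h)) (map (D ∷_) (words m))) φ
      ≈⟨ +-congˡ (reflexive (≡.cong (λ ws → ∑ ws φ) (filter-D-suc h (words m)))) ⟩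
    W (suc (suc h)) m (φ ∘ (U ∷_)) + ∑ (map (D ∷_) (filter (dyckFrom? h) (words m))) φ
      ≈⟨ +-congˡ (reflexive (∑-map (D ∷_) (filter (dyckFrom? h) (words m)) φ)) ⟩
    W (suc (suc h)) m (φ ∘ (U ∷_)) + W h m (φ ∘ (D ∷_)) ∎

  -- Whether a letter completes a peak or a hook depends on the letters around
  -- it, so u, d and e sum over the continuations of a path that has just made
  -- the steps U, D and DD.
  u d e : ℕ → ℕ → Carrier
  u h m = W (suc h) m (λ w → wt (U ∷ w))
  d h m = W h m (λ w → wt (D ∷ w))
  e h m = W h m (λ w → wt (D ∷ D ∷ w))

  ∑-scale : ∀ h m c {φ χ} → (∀ w → φ w ≈ c * χ w) → W h m φ ≈ c * W h m χ
  ∑-scale h m c p = trans (∑-cong (filter (dyckFrom? h) (words m)) p)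
                          (sym (∑-distribˡ c (filter (dyckFrom? h) (words m)) _))

  -- A D right after U completes a peak, whence `b`; a further U completes nothing.
  u-suc : ∀ h m → u h (suc m) ≈ u (suc h) m + b * d h m
  u-suc h m = trans (W-suc-suc h m _) (+-congˡ (∑-scale h m b λ w → begin
    a ^ hk (D ∷ w) * (b * b ^ pk (D ∷ w))  ≈⟨ *-assoc _ _ _ ⟨
    a ^ hk (D ∷ w) * b * b ^ pk (D ∷ w)    ≈⟨ *-congʳ (*-comm _ _) ⟩
    b * a ^ hk (D ∷ w) * b ^ pk (D ∷ w)    ≈⟨ *-assoc _ _ _ ⟩
    b * wt (D ∷ w)                         ∎))

  d-zero-suc : ∀ m → d 0 (suc m) ≈ u 0 m
  d-zero-suc m = W-zero-suc m _

  d-suc-suc : ∀ h m → d (suc h) (suc m) ≈ u (suc h) m + e h m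
  d-suc-suc h m = W-suc-suc h m _

  hook : ∀ w → wt (D ∷ D ∷ U ∷ w) ≈ a * wt (U ∷ w)
  hook w = *-assoc a _ _

  e-zero-suc : ∀ m → e 0 (suc m) ≈ a * u 0 m
  e-zero-suc m = trans (W-zero-suc m _) (∑-scale 1 m a hook)

  -- Only the two letters before a U matter for a hook, so a further D stays in the state DD.
  e-suc-suc : ∀ h m → e (suc h) (suc m) ≈ a * u (suc h) m + e h m
  e-suc-suc h m = trans (W-suc-suc h m _) (+-congʳ (∑-scale (suc (suc h)) m a hook))

  -- `X` marks single steps, so the semilength variable of the quadratic is X². Writing F = Xψ and
  -- leaving one X on each side gives the fixed-point form ψ = X · K ψ.
  K : P.Series → P.Series
  K f = const b S.+ (S.1# S.+ const b) S.* (X S.* f) S.+ const a S.* ((X S.* f) S.* (X S.* f))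

  K-nonexpansive : Nonexpansive K
  K-nonexpansive = ⊕-nonexpansive {λ f → const b S.+ (S.1# S.+ const b) S.* (X S.* f)}
      {λ f → const a S.* ((X S.* f) S.* (X S.* f))}
    (⊕-nonexpansive {λ _ → const b} {λ f → (S.1# S.+ const b) S.* (X S.* f)} (const-nonexpansive _)
      (⊛-nonexpansive {λ _ → S.1# S.+ const b} {λ f → X S.* f} (const-nonexpansive _) X*))
    (⊛-nonexpansive {λ _ → const a} {λ f → (X S.* f) S.* (X S.* f)} (const-nonexpansive _)
      (⊛-nonexpansive {λ f → X S.* f} {λ f → X S.* f} X* X*))
    where
    X* : Nonexpansive (λ f → X S.* f)
    X* = ⊛-nonexpansive {λ _ → X} {λ f → f} (const-nonexpansive X) id-nonexpansive

  open Solution 0# K K-nonexpansive using () renaming (solution to ψ; solution-≋ to ψ-eq₀)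
  open CExp S.commutativeSemiring using () renaming (_^_ to _^ₛ_)

  -- θ = Xψ is the generating series, by number of steps, of the nonempty Dyck
  -- paths. Cutting a path from height h at its last visits to the heights
  -- below contributes H = X(1 + aθ) per level, since each nonempty factor then
  -- follows a descent of length at least 2.
  θ G H : P.Series
  θ = X S.* ψ
  G = S.1# S.+ const a S.* θ
  H = X S.* G

  ψ-eq : ψ S.≈ X S.* K ψ
  ψ-eq = S.trans ψ-eq₀ (S.+-identityˡ (X S.* K ψ))

  -- The part before the last visit to the starting level. After U it is a nonempty Dyck path whose
  -- first letter is already read, hence ψ; after a single D, an optional one that creates no hook,
  -- hence 1 + θ; after DD, an optional one that creates a hook, hence G.
  û d̂ ê : ℕ → P.Series
  û h = ψ S.* H ^ₛ h
  d̂ h = (S.1# S.+ θ) S.* H ^ₛ h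
  ê h = G S.* H ^ₛ h

  û-eq : ∀ h → û h S.≈ X S.* (û (suc h) S.+ const b S.* d̂ h)
  û-eq h = S.trans (S.*-congʳ {x = H ^ₛ h} ψ-eq) (I.step-u X ψ (const a) (const b) (H ^ₛ h))

  û-suc : ∀ h m → û h (suc m) ≈ û (suc h) m + b * d̂ h m
  û-suc h m = trans (P.at (û-eq h) (suc m)) (trans (X⊛-suc _ m) (+-congˡ (const⊛ b (d̂ h) m)))

  û-zero : ∀ h → û h 0 ≈ 0#
  û-zero h = trans (P.at (û-eq h) 0) (X⊛-zero (û (suc h) S.+ const b S.* d̂ h))

  d̂-zero-zero : d̂ 0 0 ≈ 1#
  d̂-zero-zero = trans (P.at (I.step-d₀ X ψ) 0) (trans (+-congˡ (X⊛-zero (û 0))) (+-identityʳ _))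

  d̂-zero-suc : ∀ m → d̂ 0 (suc m) ≈ û 0 m
  d̂-zero-suc m = trans (P.at (I.step-d₀ X ψ) (suc m)) (trans (+-identityˡ _) (X⊛-suc (û 0) m))

  d̂-suc-zero : ∀ h → d̂ (suc h) 0 ≈ 0#
  d̂-suc-zero h = trans (P.at (I.step-d X ψ G (H ^ₛ h)) 0) (X⊛-zero (û (suc h) S.+ ê h))

  d̂-suc-suc : ∀ h m → d̂ (suc h) (suc m) ≈ û (suc h) m + ê h m
  d̂-suc-suc h m = trans (P.at (I.step-d X ψ G (H ^ₛ h)) (suc m)) (X⊛-suc (û (suc h) S.+ ê h) m)

  ê-zero-zero : ê 0 0 ≈ 1#
  ê-zero-zero = trans (P.at (I.step-e₀ X ψ (const a)) 0) (trans (+-congˡ (X⊛-zero (const a S.* û 0))) (+-identityʳ _))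

  ê-zero-suc : ∀ m → ê 0 (suc m) ≈ a * û 0 m
  ê-zero-suc m = trans (P.at (I.step-e₀ X ψ (const a)) (suc m))
    (trans (+-identityˡ _) (trans (X⊛-suc (const a S.* û 0) m) (const⊛ a (û 0) m)))

  ê-suc-zero : ∀ h → ê (suc h) 0 ≈ 0#
  ê-suc-zero h = trans (P.at (I.step-e X ψ (const a) (H ^ₛ h)) 0) (X⊛-zero (const a S.* û (suc h) S.+ ê h))

  ê-suc-suc : ∀ h m → ê (suc h) (suc m) ≈ a * û (suc h) m + ê h m
  ê-suc-suc h m = trans (P.at (I.step-e X ψ (const a) (H ^ₛ h)) (suc m))
    (trans (X⊛-suc (const a S.* û (suc h) S.+ ê h) m) (+-congʳ (const⊛ a (û (suc h)) m)))

  one-word : 1# * 1# + 0# ≈ 1#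
  one-word = trans (+-identityʳ _) (*-identityˡ _)

  -- Both families obey the same recurrences, each of which lowers m while the height varies;
  -- induction on m for all heights identifies them.
  mutual
    u≈û : ∀ m h → u h m ≈ û h m
    u≈û zero    h = sym (û-zero h)
    u≈û (suc m) h = trans (u-suc h m) (trans (+-cong (u≈û m (suc h)) (*-congˡ (d≈d̂ m h))) (sym (û-suc h m)))

    d≈d̂ : ∀ m h → d h m ≈ d̂ h m
    d≈d̂ zero    zero    = trans one-word (sym d̂-zero-zero)
    d≈d̂ zero    (suc h) = sym (d̂-suc-zero h)
    d≈d̂ (suc m) zero    = trans (d-zero-suc m) (trans (u≈û m 0) (sym (d̂-zero-suc m)))
    d≈d̂ (suc m) (suc h) = trans (d-suc-suc h m) (trans (+-cong (u≈û m (suc h)) (e≈ê m h)) (sym (d̂-suc-suc h m)))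

    e≈ê : ∀ m h → e h m ≈ ê h m
    e≈ê zero    zero    = trans one-word (sym ê-zero-zero)
    e≈ê zero    (suc h) = sym (ê-suc-zero h)
    e≈ê (suc m) zero    = trans (e-zero-suc m) (trans (*-congˡ (u≈û m 0)) (sym (ê-zero-suc m)))
    e≈ê (suc m) (suc h) = trans (e-suc-suc h m)
      (trans (+-cong (*-congˡ (u≈û m (suc h))) (e≈ê m h)) (sym (ê-suc-suc h m)))

  -- Multiplying the quadratic by θ^h makes it linear in the powers of θ: a Motzkin recurrence with
  -- down weight b, level weight 1 + b and up weight a.
  θ-power : ∀ h → let t = θ ^ₛ h in θ ^ₛ suc h
    S.≈ X S.* (X S.* (const b S.* t S.+ (S.1# S.+ const b) S.* (θ S.* t) S.+ const a S.* (θ S.* (θ S.* t))))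
  θ-power h = S.trans (S.*-congʳ {x = θ ^ₛ h} (S.*-congˡ {x = X} ψ-eq)) (I.step-θ X (const a) (const b) θ (θ ^ₛ h))

  T : ℕ → ℕ → Carrier
  T h n = (θ ^ₛ h) (2 ℕ.* n)

  T-zero : ∀ h → T (suc h) 0 ≈ 0#
  T-zero h = trans (P.at (θ-power h) 0) (zeroˡ _)

  T-suc : ∀ h n → T (suc h) (suc n) ≈ b * T h n + (1# + b) * T (suc h) n + a * T (suc (suc h)) n
  T-suc h n = begin
    (θ ^ₛ suc h) (2 ℕ.* suc n)  ≡⟨ ≡.cong (θ ^ₛ suc h) (ℕₚ.*-suc 2 n) ⟩
    (θ ^ₛ suc h) (suc (suc m))  ≈⟨ P.at (θ-power h) (suc (suc m)) ⟩
    (X S.* (X S.* r)) (suc (suc m)) ≈⟨ X⊛-suc (X S.* r) (suc m) ⟩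
    (X S.* r) (suc m)           ≈⟨ X⊛-suc r m ⟩
    r m ≈⟨ +-cong (+-cong (const⊛ b t m)
            (trans (P.at (S.distribʳ (θ S.* t) S.1# (const b)) m)
              (trans (+-cong (P.at (S.*-identityˡ (θ S.* t)) m) (const⊛ b (θ S.* t) m))
                (sym (trans (distribʳ _ _ _) (+-congʳ (*-identityˡ _)))))))
            (const⊛ a (θ S.* (θ S.* t)) m) ⟩
    b * T h n + (1# + b) * T (suc h) n + a * T (suc (suc h)) n ∎
    where
    m = 2 ℕ.* n
    t = θ ^ₛ h
    r = const b S.* t S.+ (S.1# S.+ const b) S.* (θ S.* t) S.+ const a S.* (θ S.* (θ S.* t))

  private module J = DyckIdentities R

  -- The power h + 1 of θ plays the part of height h. Splitting off b^(h+1) turns the weights b and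
  -- a of down and up steps into 1 and ab.
  T≈M : ∀ n h → T (suc h) (suc n) ≈ b ^ suc h * M (1# + b) (a * b) h n
  T≈M zero h = begin
    T (suc h) 1 ≈⟨ T-suc h 0 ⟩
    b * T h 0 + (1# + b) * T (suc h) 0 + a * T (suc (suc h)) 0
      ≈⟨ +-cong (+-congˡ (trans (*-congˡ (T-zero h)) (zeroʳ _))) (trans (*-congˡ (T-zero (suc h))) (zeroʳ _)) ⟩
    b * T h 0 + 0# + 0#  ≈⟨ trans (+-identityʳ _) (+-identityʳ _) ⟩
    b * T h 0            ≈⟨ base h ⟩
    b ^ suc h * β (a * b) h 0 ∎
    where
    base : ∀ h → b * T h 0 ≈ b ^ suc h * β (a * b) h 0
    base zero    = sym (*-identityʳ _)
    base (suc h) = trans (*-congˡ (T-zero h)) (trans (zeroʳ _) (sym (zeroʳ _)))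
  T≈M (suc n) zero = begin
    T 1 (suc (suc n)) ≈⟨ T-suc 0 (suc n) ⟩
    b * T 0 (suc n) + (1# + b) * T 1 (suc n) + a * T 2 (suc n)
      -- `T 0 (suc n)` is a coefficient of θ^0 = 1 at a positive index, hence zero: no down step
      -- leaves height 0.
      ≈⟨ +-cong (+-cong (zeroʳ _) (*-congˡ (T≈M n 0))) (*-congˡ (T≈M n 1)) ⟩
    0# + (1# + b) * (b * 1# * m₀) + a * (b * (b * 1#) * m₁)
      ≈⟨ +-congʳ (+-identityˡ _) ⟩
    (1# + b) * (b * 1# * m₀) + a * (b * (b * 1#) * m₁)
      ≈⟨ J.motzkin₀ a b m₀ m₁ ⟩
    b * 1# * ((1# + b) * m₀ + a * b * m₁)
      ≈⟨ *-congˡ (M-zero-suc (1# + b) (a * b) n) ⟨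
    b ^ 1 * M (1# + b) (a * b) 0 (suc n) ∎
    where
    m₀ = M (1# + b) (a * b) 0 n
    m₁ = M (1# + b) (a * b) 1 n
  T≈M (suc n) (suc h) = begin
    T (suc (suc h)) (suc (suc n)) ≈⟨ T-suc (suc h) (suc n) ⟩
    b * T (suc h) (suc n) + (1# + b) * T (suc (suc h)) (suc n) + a * T (suc (suc (suc h))) (suc n)
      ≈⟨ +-cong (+-cong (*-congˡ (T≈M n h)) (*-congˡ (T≈M n (suc h)))) (*-congˡ (T≈M n (suc (suc h)))) ⟩
    b * (b ^ suc h * m₀) + (1# + b) * (b * b ^ suc h * m₁) + a * (b * (b * b ^ suc h) * m₂)
      ≈⟨ J.motzkin a b (b ^ suc h) m₀ m₁ m₂ ⟩
    b * b ^ suc h * ((1# + b) * m₁ + (m₀ + a * b * m₂))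
      ≈⟨ *-congˡ (M-suc-suc (1# + b) (a * b) h n) ⟨
    b ^ suc (suc h) * M (1# + b) (a * b) (suc h) (suc n) ∎
    where
    m₀ = M (1# + b) (a * b) h n
    m₁ = M (1# + b) (a * b) (suc h) n
    m₂ = M (1# + b) (a * b) (suc (suc h)) n

  𝐃≈M : ∀ n → ∑ (𝒟 (suc n)) (λ μ → a ^ (hk μ ℕ.+ 1) * b ^ pk μ) ≈ a * b * M (1# + b) (a * b) 0 n
  𝐃≈M n = begin
    ∑ (𝒟 (suc n)) (λ μ → a ^ (hk μ ℕ.+ 1) * b ^ pk μ)
      ≈⟨ ∑-scale 0 (2 ℕ.* suc n) a (λ w → trans
           (*-congʳ (reflexive (≡.cong (a ^_) (ℕₚ.+-comm (hk w) 1)))) (*-assoc _ _ _)) ⟩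
    a * W 0 (2 ℕ.* suc n) wt ≈⟨ *-congˡ (begin
      -- `2 ℕ.* suc n` computes to `suc l`, and a nonempty Dyck word starts with U.
      W 0 (suc l) wt          ≈⟨ W-zero-suc l wt ⟩
      u 0 l                   ≈⟨ u≈û l 0 ⟩
      û 0 l                   ≈⟨ P.at (S.*-identityʳ ψ) l ⟩
      ψ l                     ≈⟨ X⊛-suc ψ l ⟨
      θ (suc l)               ≈⟨ P.at (S.*-identityʳ θ) (suc l) ⟨
      T 1 (suc n)             ≈⟨ T≈M n 0 ⟩
      b * 1# * m              ≈⟨ *-congʳ (*-identityʳ b) ⟩
      b * m                   ∎) ⟩
    a * (b * m)               ≈⟨ *-assoc _ _ _ ⟨
    a * b * m                 ∎
    where
    l = n ℕ.+ suc (n ℕ.+ 0)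
    m = M (1# + b) (a * b) 0 n

-- Binomial coefficients and ballot numbers

module BinomialIdentities where
  open import Data.Nat.Base using (_+_; _*_; _<_)
  open ≡ using (refl; sym; trans; cong; cong₂; subst; module ≡-Reasoning)
  open ≡-Reasoning

  pascal : ∀ n k → suc n C suc k ≡ n C k + n C suc k
  pascal n k = sym (nCk+nC[k+1]≡[n+1]C[k+1] n k)

  -- The rule (k+1) C(n,k+1) = (n-k) C(n,k), arranged to avoid truncated subtraction.
  absorption : ∀ n k → suc k * (n C suc k) + k * (n C k) ≡ n * (n C k)
  absorption zero    zero    = refl
  absorption zero    (suc k) = cong₂ _+_
    (trans (cong (suc (suc k) *_) (k>n⇒nCk≡0 {0} {suc (suc k)} (s≤s z≤n))) (ℕₚ.*-zeroʳ (suc (suc k))))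
    (trans (cong (suc k *_) (k>n⇒nCk≡0 {0} {suc k} (s≤s z≤n))) (ℕₚ.*-zeroʳ (suc k)))
  absorption (suc n) zero    = begin
    1 * (suc n C 1) + 0  ≡⟨ ℕₚ.+-identityʳ _ ⟩
    1 * (suc n C 1)      ≡⟨ ℕₚ.*-identityˡ _ ⟩
    suc n C 1            ≡⟨ nC1≡n (suc n) ⟩
    suc n                ≡⟨ ℕₚ.*-identityʳ _ ⟨
    suc n * 1            ∎
  absorption (suc n) (suc k) = begin
    suc (suc k) * (suc n C suc (suc k)) + suc k * (suc n C suc k)
      ≡⟨ cong₂ (λ x y → suc (suc k) * x + suc k * y) (pascal n (suc k)) (pascal n k) ⟩
    suc (suc k) * (b + c) + suc k * (a + b)
      ≡⟨ s₁ k a b c ⟩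
    (suc (suc k) * c + suc k * b) + (suc k * b + k * a) + (a + b)
      ≡⟨ cong₂ (λ x y → x + y + (a + b)) (absorption n (suc k)) (absorption n k) ⟩
    n * b + n * a + (a + b)
      ≡⟨ s₂ n a b ⟩
    suc n * (a + b)
      ≡⟨ cong (suc n *_) (pascal n k) ⟨
    suc n * (suc n C suc k) ∎
    where
    a = n C k
    b = n C suc k
    c = n C suc (suc k)
    open +-*-Solver
    s₁ : ∀ k a b c → suc (suc k) * (b + c) + suc k * (a + b)
      ≡ (suc (suc k) * c + suc k * b) + (suc k * b + k * a) + (a + b)
    s₁ = solve 4 (λ k a b c → (con 2 :+ k) :* (b :+ c) :+ (con 1 :+ k) :* (a :+ b)
      := ((con 2 :+ k) :* c :+ (con 1 :+ k) :* b) :+ ((con 1 :+ k) :* b :+ k :* a) :+ (a :+ b)) refl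
    s₂ : ∀ n a b → n * b + n * a + (a + b) ≡ suc n * (a + b)
    s₂ = solve 3 (λ n a b → n :* b :+ n :* a :+ (a :+ b) := (con 1 :+ n) :* (a :+ b)) refl

  -- C(n, k-1) with value 0 at k = 0, where the truncated `k ∸ 1` would give 1.
  _C⁻_ : ℕ → ℕ → ℕ
  n C⁻ zero  = 0
  n C⁻ suc k = n C k

  pascal⁻ : ∀ n k → suc n C k ≡ n C⁻ k + n C k
  pascal⁻ n zero    = refl
  pascal⁻ n (suc k) = pascal n k

  absorption⁻ : ∀ n k → k * (n C k) + k * (n C⁻ k) ≡ suc n * (n C⁻ k)
  absorption⁻ n zero    = sym (ℕₚ.*-zeroʳ n)
  absorption⁻ n (suc k) = begin
    suc k * (n C suc k) + (n C k + k * (n C k))  ≡⟨ s (suc k * (n C suc k)) (n C k) (k * (n C k)) ⟩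
    n C k + (suc k * (n C suc k) + k * (n C k))  ≡⟨ cong (λ z → n C k + z) (absorption n k) ⟩
    suc n * (n C k)                              ∎
    where
    open +-*-Solver
    s : ∀ x y z → x + (y + z) ≡ y + (x + z)
    s = solve 3 (λ x y z → x :+ (y :+ z) := y :+ (x :+ z)) refl

  -- The Narayana number is the determinant C(n,j)² - C(n,j-1) C(n,j+1), the form that the
  -- reflection principle delivers; here it is multiplied by n + 1 and freed of subtraction.
  narayana : ∀ n j → (suc n C suc j) * (suc n C j) + suc n * ((n C⁻ j) * (n C suc j)) ≡ suc n * ((n C j) * (n C j))
  narayana n j = begin
    (suc n C suc j) * (suc n C j) + suc n * (a * c)
      ≡⟨ cong₂ (λ x y → x * y + suc n * (a * c)) (pascal n j) (pascal⁻ n j) ⟩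
    (b + c) * (a + b) + suc n * (a * c)
      ≡⟨ cong (λ z → (b + c) * (a + b) + z) (trans (sym (ℕₚ.*-assoc (suc n) a c)) (cong (_* c) (sym h₂))) ⟩
    (b + c) * (a + b) + (j * b + j * a) * c
      ≡⟨ s₁ j a b c ⟩
    b * b + suc j * c * b + (a * b + suc j * (a * c))
      ≡⟨ cong (λ z → b * b + suc j * c * b + z) key ⟩
    b * b + suc j * c * b + j * (b * b)
      ≡⟨ s₂ j b c ⟩
    b * b + (suc j * c + j * b) * b
      ≡⟨ cong (λ x → b * b + x * b) (absorption n j) ⟩
    b * b + n * b * b
      ≡⟨ cong (λ z → b * b + z) (ℕₚ.*-assoc n b b) ⟩
    suc n * (b * b) ∎
    where
    a = n C⁻ j
    b = n C j
    c = n C suc j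
    h₂ : j * b + j * a ≡ suc n * a
    h₂ = absorption⁻ n j
    open +-*-Solver
    s₁ : ∀ j a b c → (b + c) * (a + b) + (j * b + j * a) * c ≡ b * b + suc j * c * b + (a * b + suc j * (a * c))
    s₁ = solve 4 (λ j a b c → (b :+ c) :* (a :+ b) :+ (j :* b :+ j :* a) :* c
      := b :* b :+ (con 1 :+ j) :* c :* b :+ (a :* b :+ (con 1 :+ j) :* (a :* c))) refl
    s₂ : ∀ j b c → b * b + suc j * c * b + j * (b * b) ≡ b * b + (suc j * c + j * b) * b
    s₂ = solve 3 (λ j b c → b :* b :+ (con 1 :+ j) :* c :* b :+ j :* (b :* b)
      := b :* b :+ ((con 1 :+ j) :* c :+ j :* b) :* b) refl
    s₃ : ∀ j a b c → a * b + suc j * (a * c) + j * (a * b) ≡ a * b + a * (suc j * c + j * b)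
    s₃ = solve 4 (λ j a b c → a :* b :+ (con 1 :+ j) :* (a :* c) :+ j :* (a :* b)
      := a :* b :+ a :* ((con 1 :+ j) :* c :+ j :* b)) refl
    s₄ : ∀ n a b → a * b + a * (n * b) ≡ suc n * a * b
    s₄ = solve 3 (λ n a b → a :* b :+ a :* (n :* b) := (con 1 :+ n) :* a :* b) refl
    s₅ : ∀ j a b → (j * b + j * a) * b ≡ j * (b * b) + j * (a * b)
    s₅ = solve 3 (λ j a b → (j :* b :+ j :* a) :* b := j :* (b :* b) :+ j :* (a :* b)) refl
    -- Combines (j+1)c = (n-j)b with (n-j+1)a = jb; adding jab to both sides replaces the
    -- subtractions.
    key : a * b + suc j * (a * c) ≡ j * (b * b)
    key = ℕₚ.+-cancelʳ-≡ (j * (a * b)) _ _ (begin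
      a * b + suc j * (a * c) + j * (a * b)  ≡⟨ s₃ j a b c ⟩
      a * b + a * (suc j * c + j * b)        ≡⟨ cong (λ x → a * b + a * x) (absorption n j) ⟩
      a * b + a * (n * b)                    ≡⟨ s₄ n a b ⟩
      suc n * a * b                          ≡⟨ cong (_* b) h₂ ⟨
      (j * b + j * a) * b                    ≡⟨ s₅ j a b ⟩
      j * (b * b) + j * (a * b)              ∎)

  -- The number of ballot paths with k up steps from height h down to 0.
  ballot : ℕ → ℕ → ℕ
  ballot zero    h       = 1
  ballot (suc k) zero    = ballot k 1
  ballot (suc k) (suc h) = ballot k (suc (suc h)) + ballot (suc k) h

  +2*suc : ∀ h k → h + 2 * suc k ≡ suc (suc (h + 2 * k))
  +2*suc h k = begin
    h + 2 * suc k          ≡⟨ cong (λ z → h + z) (ℕₚ.*-suc 2 k) ⟩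
    h + suc (suc (2 * k))  ≡⟨ ℕₚ.+-suc h _ ⟩
    suc (h + suc (2 * k))  ≡⟨ cong suc (ℕₚ.+-suc h _) ⟩
    suc (suc (h + 2 * k))  ∎

  central : ∀ k → suc (2 * k) C k ≡ suc (2 * k) C suc k
  central k = trans (nCk≡nC[n∸k] (ℕₚ.m≤n⇒m≤1+n (ℕₚ.m≤m+n k _))) (cong (suc (2 * k) C_) (begin
    suc (2 * k) ∸ k      ≡⟨ cong (λ x → suc (k + x) ∸ k) (ℕₚ.+-identityʳ k) ⟩
    suc (k + k) ∸ k      ≡⟨ cong (_∸ k) (ℕₚ.+-suc k k) ⟨
    (k + suc k) ∸ k      ≡⟨ ℕₚ.m+n∸m≡n k (suc k) ⟩
    suc k                ∎))

  -- A path with k + 1 up steps has length n; those from height h that cross the axis are counted,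
  -- after reflection, by C(n,k). The induction checks by Pascal's rule that the difference obeys
  -- the ballot recursion.
  reflection : ∀ n k h → n ≡ h + 2 * suc k → ballot (suc k) h + n C k ≡ n C suc k
  reflection zero    k h e with () ← trans e (+2*suc h k)
  reflection (suc n) zero zero refl = refl
  reflection (suc n) (suc k) zero e = begin
    ballot (suc k) 1 + suc n C suc k         ≡⟨ cong (λ z → ballot (suc k) 1 + z) (pascal n k) ⟩
    ballot (suc k) 1 + (n C k + n C suc k)   ≡⟨ ℕₚ.+-assoc (ballot (suc k) 1) (n C k) _ ⟨
    ballot (suc k) 1 + n C k + n C suc k     ≡⟨ cong (_+ n C suc k) (reflection n k 1 n≡) ⟩
    n C suc k + n C suc k
    -- No down step leaves height 0, so Pascal's rule lacks a summand; the symmetry of the two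
    -- middle coefficients of row 2k + 3 supplies it.
    ≡⟨ cong (λ z → n C suc k + z)
         (subst (λ m → m C suc k ≡ m C suc (suc k)) (sym n≡) (central (suc k))) ⟩
    n C suc k + n C suc (suc k)              ≡⟨ pascal n (suc k) ⟨
    suc n C suc (suc k)                      ∎
    where
    n≡ : n ≡ 1 + 2 * suc k
    n≡ = ℕₚ.suc-injective (trans e (+2*suc 0 (suc k)))
  reflection (suc n) zero (suc h) e = begin
    suc (ballot 1 h) + 1      ≡⟨ cong suc (reflection n 0 h (ℕₚ.suc-injective e)) ⟩
    suc (n C 1)               ≡⟨ pascal n 0 ⟨
    suc n C 1                 ∎
  reflection (suc n) (suc k) (suc h) e = begin
    x + y + suc n C suc k            ≡⟨ cong (λ z → x + y + z) (pascal n k) ⟩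
    x + y + (n C k + n C suc k)      ≡⟨ s x y (n C k) (n C suc k) ⟩
    (x + n C k) + (y + n C suc k)
      ≡⟨ cong₂ _+_ (reflection n k (suc (suc h)) (trans n≡ (+2*suc h (suc k)))) (reflection n (suc k) h n≡) ⟩
    n C suc k + n C suc (suc k)      ≡⟨ pascal n (suc k) ⟨
    suc n C suc (suc k)              ∎
    where
    x = ballot (suc k) (suc (suc h))
    y = ballot (suc (suc k)) h
    n≡ = ℕₚ.suc-injective e
    open +-*-Solver
    s : ∀ x y a b → x + y + (a + b) ≡ (x + a) + (y + b)
    s = solve 4 (λ x y a b → x :+ y :+ (a :+ b) := (x :+ a) :+ (y :+ b)) refl

  -- At k + 1, reflection gives B = b - a, and (k+1)b = (k+2)a, so (k+2)B = (k+2)b - (k+1)b = b.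
  catalan : ∀ k → suc k * ballot k 0 ≡ (2 * k) C k
  catalan zero    = refl
  catalan (suc k) = ℕₚ.+-cancelʳ-≡ (suc k * b) _ _ (begin
    suc (suc k) * B + suc k * b   ≡⟨ cong (λ z → suc (suc k) * B + z) absorb ⟩
    suc (suc k) * B + suc (suc k) * a ≡⟨ ℕₚ.*-distribˡ-+ (suc (suc k)) B a ⟨
    suc (suc k) * (B + a)         ≡⟨ cong (suc (suc k) *_) (reflection n k 0 refl) ⟩
    b + suc k * b                 ∎)
    where
    n = 2 * suc k
    a = n C k
    b = n C suc k
    B = ballot (suc k) 0
    open +-*-Solver
    s : ∀ k a → 2 * suc k * a ≡ suc (suc k) * a + k * a
    s = solve 2 (λ k a → con 2 :* (con 1 :+ k) :* a := (con 2 :+ k) :* a :+ k :* a) refl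
    absorb : suc k * b ≡ suc (suc k) * a
    absorb = ℕₚ.+-cancelʳ-≡ (k * a) _ _ (trans (absorption n k) (s k a))

open BinomialIdentities

-- Motzkin paths and Narayana polynomials

-- The detour through unnormalised rationals avoids the gcd by which `ℚ./` normalises.
/1-+ : ∀ i j → (i ℤ.+ j) ℚ./ 1 ≡ (i ℚ./ 1) ℚ.+ (j ℚ./ 1)
/1-+ i j = ℚₚ.toℚᵘ-injective (begin
  ℚ.toℚᵘ ((i ℤ.+ j) ℚ./ 1)                  ≈⟨ ℚₚ.toℚᵘ-fromℚᵘ (mkℚᵘ (i ℤ.+ j) 0) ⟩
  mkℚᵘ (i ℤ.+ j) 0
    ≈⟨ *≡* (≡.cong (ℤ._* + 1) (≡.cong₂ ℤ._+_ (≡.sym (ℤₚ.*-identityʳ i)) (≡.sym (ℤₚ.*-identityʳ j)))) ⟩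
  mkℚᵘ i 0 ℚᵘ.+ mkℚᵘ j 0                    ≈⟨ ℚᵘₚ.+-cong (ℚₚ.toℚᵘ-fromℚᵘ (mkℚᵘ i 0)) (ℚₚ.toℚᵘ-fromℚᵘ (mkℚᵘ j 0)) ⟨
  ℚ.toℚᵘ (i ℚ./ 1) ℚᵘ.+ ℚ.toℚᵘ (j ℚ./ 1)    ≈⟨ ℚₚ.toℚᵘ-homo-+ (i ℚ./ 1) (j ℚ./ 1) ⟨
  ℚ.toℚᵘ ((i ℚ./ 1) ℚ.+ (j ℚ./ 1))          ∎)
  where open ℚᵘₚ.≃-Reasoning

/1-* : ∀ i j → (i ℤ.* j) ℚ./ 1 ≡ (i ℚ./ 1) ℚ.* (j ℚ./ 1)
/1-* i j = ℚₚ.toℚᵘ-injective (begin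
  ℚ.toℚᵘ ((i ℤ.* j) ℚ./ 1)                  ≈⟨ ℚₚ.toℚᵘ-fromℚᵘ (mkℚᵘ (i ℤ.* j) 0) ⟩
  mkℚᵘ i 0 ℚᵘ.* mkℚᵘ j 0                    ≈⟨ ℚᵘₚ.*-cong (ℚₚ.toℚᵘ-fromℚᵘ (mkℚᵘ i 0)) (ℚₚ.toℚᵘ-fromℚᵘ (mkℚᵘ j 0)) ⟨
  ℚ.toℚᵘ (i ℚ./ 1) ℚᵘ.* ℚ.toℚᵘ (j ℚ./ 1)    ≈⟨ ℚₚ.toℚᵘ-homo-* (i ℚ./ 1) (j ℚ./ 1) ⟨
  ℚ.toℚᵘ ((i ℚ./ 1) ℚ.* (j ℚ./ 1))          ∎)
  where open ℚᵘₚ.≃-Reasoning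

/1-neg : ∀ i → (ℤ.- i) ℚ./ 1 ≡ ℚ.- (i ℚ./ 1)
/1-neg i = ℚₚ.toℚᵘ-injective (begin
  ℚ.toℚᵘ ((ℤ.- i) ℚ./ 1)    ≈⟨ ℚₚ.toℚᵘ-fromℚᵘ (mkℚᵘ (ℤ.- i) 0) ⟩
  ℚᵘ.- mkℚᵘ i 0             ≈⟨ ℚᵘₚ.-‿cong (ℚₚ.toℚᵘ-fromℚᵘ (mkℚᵘ i 0)) ⟨
  ℚᵘ.- ℚ.toℚᵘ (i ℚ./ 1)     ≈⟨ ℚₚ.toℚᵘ-homo‿- (i ℚ./ 1) ⟨
  ℚ.toℚᵘ (ℚ.- (i ℚ./ 1))    ∎)
  where open ℚᵘₚ.≃-Reasoning

1/n*n/1≡1 : ∀ n → (+ 1 ℚ./ suc n) ℚ.* (+ suc n ℚ./ 1) ≡ 1ℚ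
1/n*n/1≡1 n = ℚₚ.toℚᵘ-injective (begin
  ℚ.toℚᵘ ((+ 1 ℚ./ suc n) ℚ.* (+ suc n ℚ./ 1)) ≈⟨ ℚₚ.toℚᵘ-homo-* (+ 1 ℚ./ suc n) (+ suc n ℚ./ 1) ⟩
  ℚ.toℚᵘ (+ 1 ℚ./ suc n) ℚᵘ.* ℚ.toℚᵘ (+ suc n ℚ./ 1)
    ≈⟨ ℚᵘₚ.*-cong (ℚₚ.toℚᵘ-fromℚᵘ (mkℚᵘ (+ 1) n)) (ℚₚ.toℚᵘ-fromℚᵘ (mkℚᵘ (+ suc n) 0)) ⟩
  mkℚᵘ (+ 1) n ℚᵘ.* mkℚᵘ (+ suc n) 0
    ≈⟨ *≡* (≡.trans (ℤₚ.*-identityʳ _) (≡.cong +_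
         (≡.trans (ℕₚ.*-identityˡ (suc n)) (≡.sym (≡.trans (ℕₚ.*-identityˡ _) (ℕₚ.*-identityʳ (suc n))))))) ⟩
  ℚ.toℚᵘ 1ℚ                               ∎)
  where open ℚᵘₚ.≃-Reasoning

-- # n and inv n stand for n and 1/(n + 1). They are fields because a cast of n
-- to ℚ normalises to a term from which n cannot be inferred.
record Casting (R : CommutativeRing 0ℓ 0ℓ) : Set where
  open CommutativeRing R
  field
    #     : ℕ → Carrier
    inv   : ℕ → Carrier
    #-+   : ∀ m n → # (m ℕ.+ n) ≈ # m + # n
    #-*   : ∀ m n → # (m ℕ.* n) ≈ # m * # n
    #-0   : # 0 ≈ 0#
    #-1   : # 1 ≈ 1#
    inv*# : ∀ n → inv n * # (suc n) ≈ 1#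

module ClosedForms (R : CommutativeRing 0ℓ 0ℓ) (casting : Casting R) where
  open CommutativeRing R
  open Casting casting
  open SetoidReasoning setoid
  open Sums R
  open CExp commutativeSemiring
  open SemiringSolver commutativeSemiring using (solve; _:+_; _:*_; _:=_; con)

  𝐃 : ℕ → Carrier → Carrier → Carrier
  𝐃 n a b = ∑ (𝒟 n) λ μ → a ^ (hk μ ℕ.+ 1) * b ^ pk μ

  -- Indexed by n - 1. For a casting that comes from a coefficient map it unfolds to the same term
  -- as `Evaluation.𝐍` at `suc n`.
  𝐍₁₊ : ℕ → Carrier → Carrier
  𝐍₁₊ n a = inv n * ∑ (map suc (upTo (suc n))) λ k → (# (suc n C k) * # (suc n C (k ∸ 1))) * a ^ k

  #-≡0 : ∀ {n} → n ≡ 0 → # n ≈ 0#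
  #-≡0 ≡.refl = #-0

  ∑<-distribˡ : ∀ n c f → c * ∑< n f ≈ ∑< n (λ i → c * f i)
  ∑<-distribˡ n c f = ∑-distribˡ c (upTo n) f

  1^ : ∀ n → 1# ^ n ≈ 1#
  1^ zero    = refl
  1^ (suc n) = trans (*-identityˡ _) (1^ n)

  Bin-closed : ∀ p q m f → Bin p q m f ≈ ∑< (suc m) λ i → # (m C i) * (p ^ (m ∸ i) * (q ^ i * f i))
  Bin-closed p q zero    f = sym (begin
    # 1 * (1# * (1# * f 0)) + 0#   ≈⟨ +-identityʳ _ ⟩
    # 1 * (1# * (1# * f 0))        ≈⟨ *-cong #-1 (trans (*-identityˡ _) (*-identityˡ _)) ⟩
    1# * f 0                       ≈⟨ *-identityˡ _ ⟩
    f 0                            ∎)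
  Bin-closed p q (suc m) f = sym (begin
    ∑< (suc (suc m)) term                          ≡⟨ ∑<-suc (suc m) term ⟩
    term 0 + ∑< (suc m) (term ∘ suc)               ≈⟨ +-cong term₀ (∑<-cong (suc m) λ i _ → split i) ⟩
    p * s 0 + ∑< (suc m) (λ i → l i + r i)         ≈⟨ +-congˡ (∑-+ (upTo (suc m)) l r) ⟩
    p * s 0 + (∑< (suc m) l + ∑< (suc m) r)        ≈⟨ +-congˡ (+-congˡ (trans (∑<-last m r)
                                                       (trans (+-congˡ r-last) (+-identityʳ _)))) ⟩
    p * s 0 + (∑< (suc m) l + ∑< m r)              ≈⟨ +-congˡ (+-congˡ (∑<-cong m r-shift)) ⟩
    p * s 0 + (∑< (suc m) l + ∑< m (λ i → p * s (suc i)))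
      ≈⟨ +-congˡ (+-cong (∑<-distribˡ (suc m) q s′) (∑<-distribˡ m p (s ∘ suc))) ⟨
    p * s 0 + (q * ∑< (suc m) s′ + p * ∑< m (s ∘ suc)) ≈⟨ regroup p q (s 0) _ _ ⟩
    p * (s 0 + ∑< m (s ∘ suc)) + q * ∑< (suc m) s′ ≡⟨ ≡.cong (λ x → p * x + q * ∑< (suc m) s′) (∑<-suc m s) ⟨
    p * ∑< (suc m) s + q * ∑< (suc m) s′
      ≈⟨ +-cong (*-congˡ (Bin-closed p q m f)) (*-congˡ (Bin-closed p q m (f ∘ suc))) ⟨
    p * Bin p q m f + q * Bin p q m (f ∘ suc)      ∎)
    where
    term s s′ l r : ℕ → Carrier
    term i = # (suc m C i) * (p ^ (suc m ∸ i) * (q ^ i * f i))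
    s i = # (m C i) * (p ^ (m ∸ i) * (q ^ i * f i))
    s′ i = # (m C i) * (p ^ (m ∸ i) * (q ^ i * f (suc i)))
    l i = q * s′ i
    r i = # (m C suc i) * (p ^ (m ∸ i) * (q ^ suc i * f (suc i)))
    term₀ : term 0 ≈ p * s 0
    term₀ = solve 4 (λ o p x y → o :* ((p :* x) :* y) := p :* (o :* (x :* y))) refl (# 1) p (p ^ m) (q ^ 0 * f 0)
    split : ∀ i → term (suc i) ≈ l i + r i
    split i = begin
      # (suc m C suc i) * (x * (q * y * z))           ≡⟨ ≡.cong (λ c → # c * (x * (q * y * z))) (pascal m i) ⟩
      # (m C i ℕ.+ m C suc i) * (x * (q * y * z))     ≈⟨ *-congʳ (#-+ (m C i) (m C suc i)) ⟩
      (# (m C i) + # (m C suc i)) * (x * (q * y * z)) ≈⟨ solve 6 (λ a b x q y z → (a :+ b) :* (x :* (q :* y :* z))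
                := q :* (a :* (x :* (y :* z))) :+ b :* (x :* (q :* y :* z))) refl (# (m C i)) (# (m C suc i)) x q y z ⟩
      l i + r i                                       ∎
      where
      x = p ^ (m ∸ i)
      y = q ^ i
      z = f (suc i)
    r-last : r m ≈ 0#
    r-last = trans (*-congʳ (#-≡0 (k>n⇒nCk≡0 {m} {suc m} ℕₚ.≤-refl))) (zeroˡ _)
    -- Taking a factor `p` out of `p ^ (m ∸ i)` requires i < m, which is why the vanishing last
    -- summand is dropped beforehand.
    r-shift : ∀ i → i ℕ.< m → r i ≈ p * s (suc i)
    r-shift i i<m = begin
      # (m C suc i) * (p ^ (m ∸ i) * w)
        ≡⟨ ≡.cong (λ k → # (m C suc i) * (p ^ k * w)) (ℕₚ.+-∸-assoc 1 i<m) ⟩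
      # (m C suc i) * (p * p ^ (m ∸ suc i) * w)
        ≈⟨ solve 4 (λ c p x w → c :* (p :* x :* w) := p :* (c :* (x :* w))) refl
                                                        (# (m C suc i)) p (p ^ (m ∸ suc i)) w ⟩
      p * s (suc i)                                ∎
      where w = q ^ suc i * f (suc i)
    regroup : ∀ p q a b c → p * a + (q * b + p * c) ≈ p * (a + c) + q * b
    regroup = solve 5 (λ p q a b c → p :* a :+ (q :* b :+ p :* c) := p :* (a :+ c) :+ q :* b) refl

  β-low : ∀ c h i → i ℕ.< h → β c h i ≈ 0#
  β-low c (suc h) zero    _         = refl
  β-low c (suc h) (suc i) (s≤s i<h) = trans (+-cong (β-low c h i i<h)
    (trans (*-congˡ (β-low c (suc (suc h)) i (ℕₚ.m<n⇒m<1+n (ℕₚ.m<n⇒m<1+n i<h)))) (zeroʳ c))) (+-identityˡ _)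

  -- Parity: each ballot step changes the height by one. An up step lowers the excess 2k + 1 of
  -- length over height by two, until the path is too short and `β-low` applies.
  β-odd : ∀ c k h i → i ≡ suc (h ℕ.+ 2 ℕ.* k) → β c h i ≈ 0#
  β-odd c zero zero (suc i) e = trans (*-congˡ (β-low c 1 i (s≤s (ℕₚ.≤-reflexive (ℕₚ.suc-injective e))))) (zeroʳ c)
  β-odd c (suc k) zero (suc i) e =
    trans (*-congˡ (β-odd c k 1 i (≡.trans (ℕₚ.suc-injective e) (+2*suc 0 k)))) (zeroʳ c)
  β-odd c k (suc h) (suc i) e = trans (+-cong (β-odd c k h i (ℕₚ.suc-injective e))
    (trans (*-congˡ (second k (ℕₚ.suc-injective e))) (zeroʳ c))) (+-identityˡ _)
    where
    second : ∀ k → i ≡ suc (h ℕ.+ 2 ℕ.* k) → β c (suc (suc h)) i ≈ 0#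
    second zero    e = β-low c _ i (s≤s (ℕₚ.≤-reflexive (≡.trans e (≡.cong suc (ℕₚ.+-identityʳ h)))))
    second (suc k) e = β-odd c k (suc (suc h)) i (≡.trans e (≡.cong suc (+2*suc h k)))

  β-even : ∀ c k h i → i ≡ h ℕ.+ 2 ℕ.* k → β c h i ≈ # (ballot k h) * c ^ k
  β-even c zero zero zero e = sym (trans (*-identityʳ _) #-1)
  β-even c (suc k) zero (suc i) e = begin
    c * β c 1 i                      ≈⟨ *-congˡ (β-even c k 1 i (ℕₚ.suc-injective (≡.trans e (+2*suc 0 k)))) ⟩
    c * (# (ballot k 1) * c ^ k)     ≈⟨ *-assoc _ _ _ ⟨
    c * # (ballot k 1) * c ^ k       ≈⟨ *-congʳ (*-comm _ _) ⟩
    # (ballot k 1) * c * c ^ k       ≈⟨ *-assoc _ _ _ ⟩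
    # (ballot k 1) * c ^ suc k       ∎
  β-even c (suc k) zero zero e with () ← ≡.trans e (+2*suc 0 k)
  β-even c zero (suc h) (suc i) e = begin
    β c h i + c * β c (suc (suc h)) i
      ≈⟨ +-cong (β-even c 0 h i (ℕₚ.suc-injective e)) (*-congˡ (β-low c (suc (suc h)) i
           (ℕₚ.m<n⇒m<1+n (s≤s (ℕₚ.≤-reflexive (≡.trans (ℕₚ.suc-injective e) (ℕₚ.+-identityʳ h))))))) ⟩
    # 1 * 1# + c * 0#  ≈⟨ trans (+-congˡ (zeroʳ c)) (+-identityʳ _) ⟩
    # 1 * 1#           ∎
  β-even c (suc k) (suc h) (suc i) e = begin
    β c h i + c * β c (suc (suc h)) i
      ≈⟨ +-cong (β-even c (suc k) h i (ℕₚ.suc-injective e))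
           (*-congˡ (β-even c k (suc (suc h)) i (≡.trans (ℕₚ.suc-injective e) (+2*suc h k)))) ⟩
    # y * c ^ suc k + c * (# x * c ^ k)
      ≈⟨ solve 4 (λ x y c p → y :* (c :* p) :+ c :* (x :* p) := (x :+ y) :* (c :* p)) refl (# x) (# y) c (c ^ k) ⟩
    (# x + # y) * c ^ suc k    ≈⟨ *-congʳ (#-+ x y) ⟨
    # (x ℕ.+ y) * c ^ suc k    ∎
    where
    x = ballot k (suc (suc h))
    y = ballot (suc k) h

  ∑<-even : ∀ n f → (∀ k → f (suc (2 ℕ.* k)) ≈ 0#) → ∑< (suc n) f ≈ ∑< (suc ⌊ n /2⌋) (λ k → f (2 ℕ.* k))
  ∑<-even zero       f odd = refl
  ∑<-even (suc zero) f odd = +-congˡ (trans (+-congʳ (odd 0)) (+-identityˡ _))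
  ∑<-even (suc (suc n)) f odd = begin
    ∑< (3 ℕ.+ n) f                   ≡⟨ ∑<-suc (2 ℕ.+ n) f ⟩
    f 0 + ∑< (2 ℕ.+ n) (f ∘ suc)     ≡⟨ ≡.cong (λ x → f 0 + x) (∑<-suc (suc n) (f ∘ suc)) ⟩
    f 0 + (f 1 + ∑< (suc n) f′)      ≈⟨ +-congˡ (trans (+-congʳ (odd 0)) (+-identityˡ _)) ⟩
    f 0 + ∑< (suc n) f′              ≈⟨ +-congˡ (∑<-even n f′ λ k →
      trans (reflexive (≡.cong (f ∘ suc) (≡.sym (+2*suc 0 k)))) (odd (suc k))) ⟩
    f 0 + ∑< (suc ⌊ n /2⌋) (λ k → f′ (2 ℕ.* k))
      ≈⟨ +-congˡ (∑<-cong (suc ⌊ n /2⌋) λ k _ → reflexive (≡.cong f (≡.sym (+2*suc 0 k)))) ⟩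
    f 0 + ∑< (suc ⌊ n /2⌋) (λ k → f (2 ℕ.* suc k)) ≡⟨ ∑<-suc (suc ⌊ n /2⌋) (λ k → f (2 ℕ.* k)) ⟨
    ∑< (suc (suc ⌊ n /2⌋)) (λ k → f (2 ℕ.* k)) ∎
    where
    f′ : ℕ → Carrier
    f′ i = f (suc (suc i))

  #-catalan : ∀ k → inv k * # ((2 ℕ.* k) C k) ≈ # (ballot k 0)
  #-catalan k = begin
    inv k * # ((2 ℕ.* k) C k)               ≡⟨ ≡.cong (λ x → inv k * # x) (catalan k) ⟨
    inv k * # (suc k ℕ.* ballot k 0)        ≈⟨ *-congˡ (#-* (suc k) (ballot k 0)) ⟩
    inv k * (# (suc k) * # (ballot k 0))    ≈⟨ *-assoc _ _ _ ⟨
    inv k * # (suc k) * # (ballot k 0)      ≈⟨ *-congʳ (inv*# k) ⟩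
    1# * # (ballot k 0)                                 ≈⟨ *-identityˡ _ ⟩
    # (ballot k 0)                                      ∎

  M-closed : ∀ b c n → M b c 0 n
    ≈ ∑< (suc ⌊ n /2⌋) λ k → inv k * # ((2 ℕ.* k) C k) * # (n C (2 ℕ.* k)) * (c ^ k * b ^ (n ∸ 2 ℕ.* k))
  M-closed b c n = begin
    M b c 0 n                    ≈⟨ Bin-closed b 1# n (β c 0) ⟩
    ∑< (suc n) term
      ≈⟨ ∑<-even n term (λ k → trans (*-congˡ (trans (*-congˡ
           (trans (*-congˡ (β-odd c k 0 _ ≡.refl)) (zeroʳ _))) (zeroʳ _))) (zeroʳ _)) ⟩
    ∑< (suc ⌊ n /2⌋) (λ k → term (2 ℕ.* k))
      ≈⟨ ∑<-cong (suc ⌊ n /2⌋) (λ k _ → begin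
        # (n C (2 ℕ.* k)) * (b ^ (n ∸ 2 ℕ.* k) * (1# ^ (2 ℕ.* k) * β c 0 (2 ℕ.* k)))
          ≈⟨ *-congˡ (*-congˡ (trans (*-cong (1^ (2 ℕ.* k)) (β-even c k 0 _ ≡.refl)) (*-identityˡ _))) ⟩
        # (n C (2 ℕ.* k)) * (b ^ (n ∸ 2 ℕ.* k) * (# (ballot k 0) * c ^ k))
          ≈⟨ solve 4 (λ x y z w → x :* (y :* (z :* w)) := z :* x :* (w :* y)) refl
               (# (n C (2 ℕ.* k))) (b ^ (n ∸ 2 ℕ.* k)) (# (ballot k 0)) (c ^ k) ⟩
        # (ballot k 0) * # (n C (2 ℕ.* k)) * (c ^ k * b ^ (n ∸ 2 ℕ.* k))
          ≈⟨ *-congʳ (*-congʳ (#-catalan k)) ⟨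
        inv k * # ((2 ℕ.* k) C k) * # (n C (2 ℕ.* k)) * (c ^ k * b ^ (n ∸ 2 ℕ.* k)) ∎) ⟩
    _ ∎
    where
    term : ℕ → Carrier
    term i = # (n C i) * (b ^ (n ∸ i) * (1# ^ i * β c 0 i))

  𝐃-closed : ∀ n a b → 𝐃 (suc n) a b ≈ ∑< (suc ⌊ n /2⌋) λ k →
    inv k * # ((2 ℕ.* k) C k) * # (n C (2 ℕ.* k))
      * a ^ (k ℕ.+ 1) * b ^ (k ℕ.+ 1) * (1# + b) ^ (suc n ∸ 2 ℕ.* k ∸ 1)
  𝐃-closed n a b = begin
    𝐃 (suc n) a b                            ≈⟨ DyckSums.𝐃≈M R a b n ⟩
    a * b * M (1# + b) (a * b) 0 n           ≈⟨ *-congˡ (M-closed (1# + b) (a * b) n) ⟩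
    a * b * ∑< (suc ⌊ n /2⌋) (λ k → coef k * ((a * b) ^ k * p k)) ≈⟨ ∑<-distribˡ (suc ⌊ n /2⌋) (a * b) _ ⟩
    ∑< (suc ⌊ n /2⌋) (λ k → a * b * (coef k * ((a * b) ^ k * p k))) ≈⟨ ∑<-cong (suc ⌊ n /2⌋) (λ k _ → begin
      a * b * (coef k * ((a * b) ^ k * p k))
        ≈⟨ *-congˡ (*-congˡ (*-congʳ (^-distrib-* a b k))) ⟩
      a * b * (coef k * (a ^ k * b ^ k * p k))
        ≈⟨ solve 6 (λ a b x y z w → a :* b :* (x :* (y :* z :* w)) := x :* (a :* y) :* (b :* z) :* w) refl
             a b (coef k) (a ^ k) (b ^ k) (p k) ⟩
      coef k * a ^ suc k * b ^ suc k * p k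
        ≡⟨ ≡.cong₂ (λ i j → coef k * a ^ i * b ^ i * (1# + b) ^ j) (ℕₚ.+-comm 1 k)
             (≡.sym (≡.trans (ℕₚ.∸-+-assoc (suc n) (2 ℕ.* k) 1) (≡.cong (suc n ∸_) (ℕₚ.+-comm (2 ℕ.* k) 1)))) ⟩
      coef k * a ^ (k ℕ.+ 1) * b ^ (k ℕ.+ 1) * (1# + b) ^ (suc n ∸ 2 ℕ.* k ∸ 1) ∎) ⟩
    _ ∎
    where
    coef p : ℕ → Carrier
    coef k = inv k * # ((2 ℕ.* k) C k) * # (n C (2 ℕ.* k))
    p k = (1# + b) ^ (n ∸ 2 ℕ.* k)

  -- A path of length n from height h to 0 has h more down than up steps, so level steps plus twice
  -- the up steps number n - h: this is the degree in ρ.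
  M-homogeneous : ∀ ρ b c n h → ρ ^ h * M (ρ * b) (ρ * ρ * c) h n ≈ ρ ^ n * M b c h n
  M-homogeneous ρ b c zero    zero    = refl
  M-homogeneous ρ b c zero    (suc h) = trans (zeroʳ _) (sym (zeroʳ _))
  M-homogeneous ρ b c (suc n) zero    = begin
    1# * M (ρ * b) (ρ * ρ * c) 0 (suc n)
      ≈⟨ *-congˡ (M-zero-suc (ρ * b) (ρ * ρ * c) n) ⟩
    1# * (ρ * b * m₀ + ρ * ρ * c * m₁)
      ≈⟨ solve 5 (λ ρ b c x y → con 1 :* (ρ :* b :* x :+ ρ :* ρ :* c :* y)
           := ρ :* (b :* (con 1 :* x) :+ c :* (ρ :* con 1 :* y))) refl ρ b c m₀ m₁ ⟩
    ρ * (b * (ρ ^ 0 * m₀) + c * (ρ ^ 1 * m₁))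
      ≈⟨ *-congˡ (+-cong (*-congˡ (M-homogeneous ρ b c n 0)) (*-congˡ (M-homogeneous ρ b c n 1))) ⟩
    ρ * (b * (ρ ^ n * M b c 0 n) + c * (ρ ^ n * M b c 1 n))
      ≈⟨ solve 6 (λ ρ b c p x y → ρ :* (b :* (p :* x) :+ c :* (p :* y)) := ρ :* p :* (b :* x :+ c :* y)) refl
           ρ b c (ρ ^ n) (M b c 0 n) (M b c 1 n) ⟩
    ρ ^ suc n * (b * M b c 0 n + c * M b c 1 n)
      ≈⟨ *-congˡ (M-zero-suc b c n) ⟨
    ρ ^ suc n * M b c 0 (suc n) ∎
    where
    m₀ = M (ρ * b) (ρ * ρ * c) 0 n
    m₁ = M (ρ * b) (ρ * ρ * c) 1 n
  M-homogeneous ρ b c (suc n) (suc h) = begin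
    ρ ^ suc h * M (ρ * b) (ρ * ρ * c) (suc h) (suc n)
      ≈⟨ *-congˡ (M-suc-suc (ρ * b) (ρ * ρ * c) h n) ⟩
    ρ ^ suc h * (ρ * b * m₁ + (m₀ + ρ * ρ * c * m₂))
      ≈⟨ solve 7 (λ ρ b c p x y z → ρ :* p :* (ρ :* b :* y :+ (x :+ ρ :* ρ :* c :* z))
           := ρ :* (b :* (ρ :* p :* y) :+ (p :* x :+ c :* (ρ :* (ρ :* p) :* z)))) refl ρ b c (ρ ^ h) m₀ m₁ m₂ ⟩
    ρ * (b * (ρ ^ suc h * m₁) + (ρ ^ h * m₀ + c * (ρ ^ suc (suc h) * m₂)))
      ≈⟨ *-congˡ (+-cong (*-congˡ (M-homogeneous ρ b c n (suc h)))
           (+-cong (M-homogeneous ρ b c n h) (*-congˡ (M-homogeneous ρ b c n (suc (suc h)))))) ⟩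
    ρ * (b * (ρ ^ n * M b c (suc h) n) + (ρ ^ n * M b c h n + c * (ρ ^ n * M b c (suc (suc h)) n)))
      ≈⟨ solve 7 (λ ρ b c p x y z → ρ :* (b :* (p :* y) :+ (p :* x :+ c :* (p :* z)))
           := ρ :* p :* (b :* y :+ (x :+ c :* z))) refl
           ρ b c (ρ ^ n) (M b c h n) (M b c (suc h) n) (M b c (suc (suc h)) n) ⟩
    ρ ^ suc n * (b * M b c (suc h) n + (M b c h n + c * M b c (suc (suc h)) n))
      ≈⟨ *-congˡ (M-suc-suc b c h n) ⟨
    ρ ^ suc n * M b c (suc h) (suc n) ∎
    where
    m₀ = M (ρ * b) (ρ * ρ * c) h n
    m₁ = M (ρ * b) (ρ * ρ * c) (suc h) n
    m₂ = M (ρ * b) (ρ * ρ * c) (suc (suc h)) n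

  β-cong : ∀ {c c′} h i → c ≈ c′ → β c h i ≈ β c′ h i
  β-cong zero    zero    e = refl
  β-cong (suc h) zero    e = refl
  β-cong zero    (suc i) e = *-cong e (β-cong 1 i e)
  β-cong (suc h) (suc i) e = +-cong (β-cong h i e) (*-cong e (β-cong (suc (suc h)) i e))

  Bin-congˡ : ∀ {p p′ q} m f → p ≈ p′ → Bin p q m f ≈ Bin p′ q m f
  Bin-congˡ zero    f e = refl
  Bin-congˡ (suc m) f e = +-cong (*-cong e (Bin-congˡ m f e)) (*-congˡ (Bin-congˡ m (f ∘ suc) e))

  M-cong : ∀ {b b′ c c′} h n → b ≈ b′ → c ≈ c′ → M b c h n ≈ M b′ c′ h n
  M-cong {b} {b′} {c} {c′} h n e e′ = trans (Bin-congˡ n (β c h) e) (Bin-cong n λ i → β-cong h i e′)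

  module Narayana (s : Carrier) where
    -- The weight of all paths, possibly negative, from height h to 0 with the
    -- Motzkin weights 1 + s, s of M (1 + s) s: these are the coefficients of
    -- (1 + z)(1 + s/z). M-free is the reflection principle.
    free : ℕ → ℕ → Carrier
    free h n = Bin 1# s n (λ j → # (n C (h ℕ.+ j)))

    -- The analogue of `free` at height -1, which a free path from 0 can enter.
    free⁻ : ℕ → Carrier
    free⁻ n = Bin 1# s n (λ j → # (n C⁻ j))

    poly : ℕ → (ℕ → ℕ) → Carrier
    poly n g = ∑< (suc n) λ j → # (g j) * s ^ j

    Bin-poly : ∀ n (g : ℕ → ℕ) → Bin 1# s n (λ j → # (g j)) ≈ poly n (λ j → (n C j) ℕ.* g j)
    Bin-poly n g = trans (Bin-closed 1# s n _) (∑<-cong (suc n) λ j _ → begin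
      # (n C j) * (1# ^ (n ∸ j) * (s ^ j * # (g j)))  ≈⟨ *-congˡ (trans (*-congʳ (1^ (n ∸ j))) (*-identityˡ _)) ⟩
      # (n C j) * (s ^ j * # (g j))                   ≈⟨ *-congˡ (*-comm _ _) ⟩
      # (n C j) * (# (g j) * s ^ j)                   ≈⟨ *-assoc _ _ _ ⟨
      # (n C j) * # (g j) * s ^ j                     ≈⟨ *-congʳ (#-* (n C j) (g j)) ⟨
      # ((n C j) ℕ.* g j) * s ^ j                     ∎)

    -- The leading coefficient has to vanish because `poly n` has no room for s^(n+1).
    poly-shift : ∀ n (g g′ : ℕ → ℕ) → g n ≡ 0 → g′ 0 ≡ 0 → (∀ j → g′ (suc j) ≡ g j) → s * poly n g ≈ poly n g′
    poly-shift n g g′ gₙ g′₀ shift = begin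
      s * poly n g
        ≈⟨ *-congˡ (trans (∑<-last n _) (trans (+-congˡ (trans (*-congʳ (#-≡0 gₙ)) (zeroˡ _))) (+-identityʳ _))) ⟩
      s * ∑< n (λ j → # (g j) * s ^ j)                 ≈⟨ ∑<-distribˡ n s _ ⟩
      ∑< n (λ j → s * (# (g j) * s ^ j))               ≈⟨ ∑<-cong n (λ j _ → begin
          s * (# (g j) * s ^ j)     ≈⟨ *-assoc _ _ _ ⟨
          s * # (g j) * s ^ j       ≈⟨ *-congʳ (*-comm _ _) ⟩
          # (g j) * s * s ^ j       ≈⟨ *-assoc _ _ _ ⟩
          # (g j) * s ^ suc j       ≡⟨ ≡.cong (λ x → # x * s ^ suc j) (shift j) ⟨
          # (g′ (suc j)) * s ^ suc j ∎) ⟩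
      ∑< n (λ j → # (g′ (suc j)) * s ^ suc j)          ≈⟨ +-identityˡ _ ⟨
      0# + ∑< n (λ j → # (g′ (suc j)) * s ^ suc j)     ≈⟨ +-congʳ (trans (*-congʳ (#-≡0 g′₀)) (zeroˡ _)) ⟨
      # (g′ 0) * s ^ 0 + ∑< n (λ j → # (g′ (suc j)) * s ^ suc j) ≡⟨ ∑<-suc n (λ j → # (g′ j) * s ^ j) ⟨
      poly n g′                                        ∎

    -- Mirror symmetry: mirroring a path from 1 exchanges its up and down steps, and it had one down
    -- step more, whence one extra factor `s`.
    free⁻≈ : ∀ n → free⁻ n ≈ s * free 1 n
    free⁻≈ n = sym (begin
      s * free 1 n                                ≈⟨ *-congˡ (Bin-poly n (λ j → n C suc j)) ⟩
      s * poly n (λ j → (n C j) ℕ.* (n C suc j))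
        ≈⟨ poly-shift n (λ j → (n C j) ℕ.* (n C suc j)) (λ j → (n C j) ℕ.* (n C⁻ j))
        (≡.trans (≡.cong ((n C n) ℕ.*_) (k>n⇒nCk≡0 {n} {suc n} ℕₚ.≤-refl)) (ℕₚ.*-zeroʳ (n C n)))
        ≡.refl (λ j → ℕₚ.*-comm (n C suc j) (n C j)) ⟩
      poly n (λ j → (n C j) ℕ.* (n C⁻ j))         ≈⟨ Bin-poly n (n C⁻_) ⟨
      free⁻ n                                     ∎)

    Bin-+′ : ∀ n (g g′ g″ : ℕ → ℕ) → (∀ j → g j ≡ g′ j ℕ.+ g″ j) →
      Bin 1# s n (λ j → # (g j)) ≈ Bin 1# s n (λ j → # (g′ j)) + Bin 1# s n (λ j → # (g″ j))
    Bin-+′ n g g′ g″ e = trans (Bin-cong n (λ j → trans (reflexive (≡.cong # (e j))) (#-+ (g′ j) (g″ j))))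
      (Bin-+ n (λ j → # (g′ j)) (λ j → # (g″ j)))

    free-right : ∀ h n → Bin 1# s n (λ j → # (suc n C (h ℕ.+ suc j))) ≈ free h n + free (suc h) n
    free-right h n = Bin-+′ n (λ j → suc n C (h ℕ.+ suc j)) (λ j → n C (h ℕ.+ j)) (λ j → n C suc (h ℕ.+ j))
      (λ j → ≡.trans (≡.cong (suc n C_) (ℕₚ.+-suc h j)) (pascal n (h ℕ.+ j)))

    -- One `s * free 1 n` is the up step to 1, the other the down step to -1, rewritten by `free⁻≈`.
    free-zero-suc : ∀ n → free 0 (suc n) ≈ (1# + s) * free 0 n + s * free 1 n + s * free 1 n
    free-zero-suc n = begin
      1# * Bin 1# s n (λ j → # (suc n C j)) + s * Bin 1# s n (λ j → # (suc n C suc j))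
        ≈⟨ +-cong (*-congˡ (trans (Bin-+′ n (suc n C_) (n C⁻_) (n C_) (pascal⁻ n)) (+-congʳ (free⁻≈ n))))
             (*-congˡ (free-right 0 n)) ⟩
      1# * (s * free 1 n + free 0 n) + s * (free 0 n + free 1 n)
        ≈⟨ solve 3 (λ s x y → con 1 :* (s :* y :+ x) :+ s :* (x :+ y)
             := (con 1 :+ s) :* x :+ s :* y :+ s :* y) refl s (free 0 n) (free 1 n) ⟩
      (1# + s) * free 0 n + s * free 1 n + s * free 1 n ∎

    free-suc-suc : ∀ h n → free (suc h) (suc n) ≈ (1# + s) * free (suc h) n + (free h n + s * free (suc (suc h)) n)
    free-suc-suc h n = begin
      1# * Bin 1# s n (λ j → # (suc n C suc (h ℕ.+ j))) + s * Bin 1# s n (λ j → # (suc n C (suc h ℕ.+ suc j)))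
        ≈⟨ +-cong (*-congˡ (Bin-+′ n (λ j → suc n C suc (h ℕ.+ j)) (λ j → n C (h ℕ.+ j)) (λ j → n C suc (h ℕ.+ j))
             (λ j → pascal n (h ℕ.+ j))))
             (*-congˡ (free-right (suc h) n)) ⟩
      1# * (free h n + free (suc h) n) + s * (free (suc h) n + free (suc (suc h)) n)
        ≈⟨ solve 4 (λ s x y z → con 1 :* (x :+ y) :+ s :* (y :+ z) := (con 1 :+ s) :* y :+ (x :+ s :* z)) refl
             s (free h n) (free (suc h) n) (free (suc (suc h)) n) ⟩
      (1# + s) * free (suc h) n + (free h n + s * free (suc (suc h)) n) ∎

    M-free : ∀ n h → M (1# + s) s h n + s * free (suc (suc h)) n ≈ free h n
    M-free zero h = trans (+-congˡ (trans (*-congˡ (#-≡0 (k>n⇒nCk≡0 {0} {suc (suc (h ℕ.+ 0))} (s≤s z≤n)))) (zeroʳ s)))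
      (trans (+-identityʳ _) (base h))
      where
      base : ∀ h → β s h 0 ≈ # (0 C (h ℕ.+ 0))
      base zero    = sym #-1
      base (suc h) = sym (#-≡0 (k>n⇒nCk≡0 {0} {suc (h ℕ.+ 0)} (s≤s z≤n)))
    M-free (suc n) zero = begin
      M (1# + s) s 0 (suc n) + s * free 2 (suc n)
        ≈⟨ +-cong (M-zero-suc (1# + s) s n) (*-congˡ (free-suc-suc 1 n)) ⟩
      (1# + s) * m₀ + s * m₁ + s * ((1# + s) * f₂ + (f₁ + s * f₃))
        ≈⟨ solve 6 (λ s m₀ m₁ f₁ f₂ f₃ → (con 1 :+ s) :* m₀ :+ s :* m₁ :+ s :* ((con 1 :+ s) :* f₂ :+ (f₁ :+ s :* f₃))
             := (con 1 :+ s) :* (m₀ :+ s :* f₂) :+ s :* (m₁ :+ s :* f₃) :+ s :* f₁) refl s m₀ m₁ f₁ f₂ f₃ ⟩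
      -- The spare `s * f₁` is the step to -1, forbidden to Motzkin paths but present in
      -- `free-zero-suc`.
      (1# + s) * (m₀ + s * f₂) + s * (m₁ + s * f₃) + s * f₁
        ≈⟨ +-congʳ (+-cong (*-congˡ (M-free n 0)) (*-congˡ (M-free n 1))) ⟩
      (1# + s) * free 0 n + s * f₁ + s * f₁
        ≈⟨ free-zero-suc n ⟨
      free 0 (suc n) ∎
      where
      m₀ = M (1# + s) s 0 n
      m₁ = M (1# + s) s 1 n
      f₁ = free 1 n
      f₂ = free 2 n
      f₃ = free 3 n
    M-free (suc n) (suc h) = begin
      M (1# + s) s (suc h) (suc n) + s * free (3 ℕ.+ h) (suc n)
        ≈⟨ +-cong (M-suc-suc (1# + s) s h n) (*-congˡ (free-suc-suc (2 ℕ.+ h) n)) ⟩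
      (1# + s) * m₁ + (m₀ + s * m₂) + s * ((1# + s) * f₃ + (f₂ + s * f₄))
        ≈⟨ solve 7 (λ s m₀ m₁ m₂ f₂ f₃ f₄ →
             (con 1 :+ s) :* m₁ :+ (m₀ :+ s :* m₂) :+ s :* ((con 1 :+ s) :* f₃ :+ (f₂ :+ s :* f₄))
             := (con 1 :+ s) :* (m₁ :+ s :* f₃) :+ ((m₀ :+ s :* f₂) :+ s :* (m₂ :+ s :* f₄))) refl s m₀ m₁ m₂ f₂ f₃ f₄ ⟩
      (1# + s) * (m₁ + s * f₃) + ((m₀ + s * f₂) + s * (m₂ + s * f₄))
        ≈⟨ +-cong (*-congˡ (M-free n (suc h))) (+-cong (M-free n h) (*-congˡ (M-free n (suc (suc h))))) ⟩
      (1# + s) * free (suc h) n + (free h n + s * free (suc (suc h)) n)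
        ≈⟨ free-suc-suc h n ⟨
      free (suc h) (suc n) ∎
      where
      m₀ = M (1# + s) s h n
      m₁ = M (1# + s) s (suc h) n
      m₂ = M (1# + s) s (suc (suc h)) n
      f₂ = free (2 ℕ.+ h) n
      f₃ = free (3 ℕ.+ h) n
      f₄ = free (4 ℕ.+ h) n

    poly-+ : ∀ n (g g′ : ℕ → ℕ) → poly n (λ j → g j ℕ.+ g′ j) ≈ poly n g + poly n g′
    poly-+ n g g′ = trans (∑<-cong (suc n) λ j _ → trans (*-congʳ (#-+ (g j) (g′ j))) (distribʳ _ _ _))
      (∑-+ (upTo (suc n)) _ _)

    poly-* : ∀ n c (g : ℕ → ℕ) → poly n (λ j → c ℕ.* g j) ≈ # c * poly n g
    poly-* n c g = trans (∑<-cong (suc n) λ j _ → trans (*-congʳ (#-* c (g j))) (*-assoc _ _ _))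
      (sym (∑<-distribˡ (suc n) (# c) _))

    poly-≡ : ∀ n {g g′ : ℕ → ℕ} → (∀ j → g j ≡ g′ j) → poly n g ≈ poly n g′
    poly-≡ n e = ∑<-cong (suc n) λ j _ → reflexive (≡.cong (λ x → # x * s ^ j) (e j))

    -- By reflection the Motzkin polynomial is `free 0 n` minus `s * free 2 n`, whose coefficients
    -- form the determinant in `narayana`; the subtracted part is added on both sides and cancelled.
    narayana-poly : ∀ n → poly n (λ j → (suc n C suc j) ℕ.* (suc n C j)) ≈ # (suc n) * M (1# + s) s 0 n
    narayana-poly n = RingProperties.+-cancelʳ ring (# (suc n) * (s * free 2 n)) _ _ (begin
      poly n N + # (suc n) * (s * free 2 n)              ≈⟨ +-congˡ (*-congˡ s*free₂) ⟩
      poly n N + # (suc n) * poly n G′                   ≈⟨ +-congˡ (poly-* n (suc n) G′) ⟨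
      poly n N + poly n (λ j → suc n ℕ.* G′ j)           ≈⟨ poly-+ n N (λ j → suc n ℕ.* G′ j) ⟨
      poly n (λ j → N j ℕ.+ suc n ℕ.* G′ j)
        ≈⟨ poly-≡ n {λ j → N j ℕ.+ suc n ℕ.* G′ j} {λ j → suc n ℕ.* ((n C j) ℕ.* (n C j))} (narayana n) ⟩
      poly n (λ j → suc n ℕ.* ((n C j) ℕ.* (n C j)))     ≈⟨ poly-* n (suc n) (λ j → (n C j) ℕ.* (n C j)) ⟩
      # (suc n) * poly n (λ j → (n C j) ℕ.* (n C j))     ≈⟨ *-congˡ (Bin-poly n (n C_)) ⟨
      # (suc n) * free 0 n                               ≈⟨ *-congˡ (M-free n 0) ⟨
      # (suc n) * (M (1# + s) s 0 n + s * free 2 n)      ≈⟨ distribˡ _ _ _ ⟩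
      # (suc n) * M (1# + s) s 0 n + # (suc n) * (s * free 2 n) ∎)
      where
      N G′ : ℕ → ℕ
      N j = (suc n C suc j) ℕ.* (suc n C j)
      G′ j = (n C⁻ j) ℕ.* (n C suc j)
      s*free₂ : s * free 2 n ≈ poly n G′
      s*free₂ = trans (*-congˡ (Bin-poly n (λ j → n C (2 ℕ.+ j)))) (poly-shift n (λ j → (n C j) ℕ.* (n C suc (suc j))) G′
        (≡.trans (≡.cong ((n C n) ℕ.*_) (k>n⇒nCk≡0 {n} {suc (suc n)} (ℕₚ.m<n⇒m<1+n ℕₚ.≤-refl)))
          (ℕₚ.*-zeroʳ (n C n))) ≡.refl (λ j → ≡.refl))

    𝐍≈M : ∀ n → 𝐍₁₊ n s ≈ s * M (1# + s) s 0 n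
    𝐍≈M n = begin
      r * ∑ (map suc (upTo (suc n))) (λ k → # (suc n C k) * # (suc n C (k ∸ 1)) * s ^ k)
        ≡⟨ ≡.cong (r *_) (∑-map suc (upTo (suc n)) _) ⟩
      r * ∑< (suc n) (λ j → # (suc n C suc j) * # (suc n C j) * s ^ suc j)
        ≈⟨ *-congˡ (∑<-cong (suc n) λ j _ → trans (*-congʳ (sym (#-* (suc n C suc j) (suc n C j))))
             (x∙yz≈y∙xz _ s (s ^ j))) ⟩
      r * ∑< (suc n) (λ j → s * (# ((suc n C suc j) ℕ.* (suc n C j)) * s ^ j))
        ≈⟨ *-congˡ (∑<-distribˡ (suc n) s _) ⟨
      r * (s * poly n (λ j → (suc n C suc j) ℕ.* (suc n C j)))
        ≈⟨ *-congˡ (*-congˡ (narayana-poly n)) ⟩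
      r * (s * (# (suc n) * m))
        ≈⟨ solve 4 (λ r s x m → r :* (s :* (x :* m)) := r :* x :* (s :* m)) refl r s (# (suc n)) m ⟩
      r * # (suc n) * (s * m)  ≈⟨ *-congʳ (inv*# n) ⟩
      1# * (s * m)             ≈⟨ *-identityˡ _ ⟩
      s * m                    ∎
      where
      r = inv n
      m = M (1# + s) s 0 n
      x∙yz≈y∙xz : ∀ x y z → x * (y * z) ≈ y * (x * z)
      x∙yz≈y∙xz = solve 3 (λ x y z → x :* (y :* z) := y :* (x :* z)) refl

  -- Homogeneity contributes ρ^n and the prefactor ρ². A general ring offers no inverse of ρ, so the
  -- opposite substitution has a lemma of its own.
  ρρab≈s⇒𝐍≈ρ^𝐃 : ∀ n {ρ a b s} → ρ * ρ * (a * b) ≈ s → ρ * (1# + b) ≈ 1# + s →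
    𝐍₁₊ n s ≈ ρ ^ (suc n ℕ.+ 1) * 𝐃 (suc n) a b
  ρρab≈s⇒𝐍≈ρ^𝐃 n {ρ} {a} {b} {s} e e′ = begin
    𝐍₁₊ n s                                    ≈⟨ Narayana.𝐍≈M s n ⟩
    s * M (1# + s) s 0 n                           ≈⟨ *-cong (sym e) (M-cong 0 n (sym e′) (sym e)) ⟩
    ρ * ρ * (a * b) * m′
      ≈⟨ *-congˡ (trans (sym (*-identityˡ m′)) (M-homogeneous ρ (1# + b) (a * b) n 0)) ⟩
    ρ * ρ * (a * b) * (ρ ^ n * m)
      ≈⟨ solve 4 (λ ρ c p m → ρ :* ρ :* c :* (p :* m) := ρ :* (ρ :* p) :* (c :* m)) refl ρ (a * b) (ρ ^ n) m ⟩
    ρ ^ suc (suc n) * (a * b * m)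
      ≈⟨ *-cong (reflexive (≡.cong (ρ ^_) (ℕₚ.+-comm 1 (suc n)))) (sym (DyckSums.𝐃≈M R a b n)) ⟩
    ρ ^ (suc n ℕ.+ 1) * 𝐃 (suc n) a b              ∎
    where
    m = M (1# + b) (a * b) 0 n
    m′ = M (ρ * (1# + b)) (ρ * ρ * (a * b)) 0 n

  ρρs≈ab⇒𝐃≈ρ^𝐍 : ∀ n {ρ a b s} → ρ * ρ * s ≈ a * b → ρ * (1# + s) ≈ 1# + b →
    𝐃 (suc n) a b ≈ ρ ^ (suc n ℕ.+ 1) * 𝐍₁₊ n s
  ρρs≈ab⇒𝐃≈ρ^𝐍 n {ρ} {a} {b} {s} e e′ = begin
    𝐃 (suc n) a b                    ≈⟨ DyckSums.𝐃≈M R a b n ⟩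
    a * b * M (1# + b) (a * b) 0 n   ≈⟨ *-cong (sym e) (M-cong 0 n (sym e′) (sym e)) ⟩
    ρ * ρ * s * m′                   ≈⟨ *-congˡ (trans (sym (*-identityˡ m′)) (M-homogeneous ρ (1# + s) s n 0)) ⟩
    ρ * ρ * s * (ρ ^ n * m)
      ≈⟨ solve 4 (λ ρ c p m → ρ :* ρ :* c :* (p :* m) := ρ :* (ρ :* p) :* (c :* m)) refl ρ s (ρ ^ n) m ⟩
    ρ ^ suc (suc n) * (s * m)
      ≈⟨ *-cong (reflexive (≡.cong (ρ ^_) (ℕₚ.+-comm 1 (suc n)))) (sym (Narayana.𝐍≈M s n)) ⟩
    ρ ^ (suc n ℕ.+ 1) * 𝐍₁₊ n s  ∎
    where
    m = M (1# + s) s 0 n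
    m′ = M (ρ * (1# + s)) (ρ * ρ * s) 0 n

homomorphism⇒casting : ∀ {R : CommutativeRing 0ℓ 0ℓ} {ι} →
  IsRingHomomorphism (CommutativeRing.rawRing ℚ-ring) (CommutativeRing.rawRing R) ι → Casting R
homomorphism⇒casting {R} {ι} hom = record
  { #     = λ n → ι (+ n ℚ./ 1)
  ; inv   = λ n → ι (+ 1 ℚ./ suc n)
  ; #-+   = λ m n → trans (reflexive (≡.cong ι (/1-+ (+ m) (+ n)))) (+-homo _ _)
  ; #-*   = λ m n → trans
      (reflexive (≡.cong ι (≡.trans (≡.cong (ℚ._/ 1) (ℤₚ.pos-* m n)) (/1-* (+ m) (+ n)))))
      (*-homo _ _)
  ; #-0   = 0#-homo
  ; #-1   = 1#-homo
  ; inv*# = λ n → trans (sym (*-homo _ _)) (trans (reflexive (≡.cong ι (1/n*n/1≡1 n))) 1#-homo)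
  }
  where
  open CommutativeRing R
  open IsRingHomomorphism hom using (+-homo; *-homo; 0#-homo; 1#-homo)

-- The substitutions

module _ (R : CommutativeRing 0ℓ 0ℓ) where
  open CommutativeRing R

  polynomialConst-isRingHomomorphism : IsRingHomomorphism rawRing
    (CommutativeRing.rawRing (Polynomial.commutativeRing R)) (Polynomial.const R)
  polynomialConst-isRingHomomorphism = record
    { isSemiringHomomorphism = record
      { isNearSemiringHomomorphism = record
        { +-isMonoidHomomorphism = record
          { isMagmaHomomorphism = record
            { isRelHomomorphism = record { cong = λ e → P.coeffwise λ { zero → e ; (suc _) → refl } }
            ; homo = λ _ _ → P.coeffwise λ _ → refl }
          ; ε-homo = P.coeffwise λ { zero → refl ; (suc _) → refl } }
        ; *-homo = λ _ _ → P.coeffwise λ { zero → sym (+-identityʳ _) ; (suc _) → refl } }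
      ; 1#-homo = P.coeffwise λ _ → refl }
    ; -‿homo = λ _ → P.coeffwise λ _ → refl }
    where module P = Polynomial R

  seriesConst-isRingHomomorphism : IsRingHomomorphism rawRing
    (CommutativeRing.rawRing (PowerSeries.commutativeRing R)) (PowerSeries.const R)
  seriesConst-isRingHomomorphism = record
    { isSemiringHomomorphism = record
      { isNearSemiringHomomorphism = record
        { +-isMonoidHomomorphism = record
          { isMagmaHomomorphism = record
            { isRelHomomorphism = record { cong = λ e → S.coeffwise λ { zero → e ; (suc _) → refl } }
            ; homo = λ _ _ → S.coeffwise λ { zero → refl ; (suc _) → sym (+-identityʳ _) } }
          ; ε-homo = S.coeffwise λ _ → refl }
        ; *-homo = λ a b → S.coeffwise λ
            { zero    → refl
            ; (suc n) → sym (trans (const⊛ a (S.const b) (suc n)) (zeroʳ a)) } }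
      ; 1#-homo = S.coeffwise λ _ → refl }
    ; -‿homo = λ _ → S.coeffwise λ { zero → refl ; (suc _) → sym -0#≈0# } }
    where
    module S = PowerSeries R
    open SeriesProperties R using (const⊛)
    open import Algebra.Properties.Ring ring using (-0#≈0#)

  embed-isRingHomomorphism : (dom : IsDomain R) → IsRingHomomorphism rawRing
    (CommutativeRing.rawRing (Fractions.commutativeRing R dom)) (Fractions.embed R dom)
  embed-isRingHomomorphism dom = record
    { isSemiringHomomorphism = record
      { isNearSemiringHomomorphism = record
        { +-isMonoidHomomorphism = record
          { isMagmaHomomorphism = record
            { isRelHomomorphism = record { cong = λ e → F.cross (*-congʳ e) }
            ; homo = λ a b → F.cross (s a b) }
          ; ε-homo = F.cross refl }
        ; *-homo = λ a b → F.cross (*-congˡ (*-identityˡ 1#)) }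
      ; 1#-homo = F.cross refl }
    ; -‿homo = λ _ → F.cross refl }
    where
    module F = Fractions R dom
    open SemiringSolver commutativeSemiring using (solve; _:+_; _:*_; _:=_; con)
    s : ∀ a b → (a + b) * (1# * 1#) ≈ (a * 1# + b * 1#) * 1#
    s = solve 2 (λ a b → (a :+ b) :* (con 1 :* con 1) := (a :* con 1 :+ b :* con 1) :* con 1) refl

-- Polynomial identities relating the square root, u, v and the ratio

module SubstitutionIdentities (R : CommutativeRing 0ℓ 0ℓ) (ι : ℚ → CommutativeRing.Carrier R)
  (ι-isRingHomomorphism : IsRingHomomorphism (CommutativeRing.rawRing ℚ-ring) (CommutativeRing.rawRing R) ι) where
  open CommutativeRing R
  open Evaluation R ι using (#; _^_)
  open IsRingHomomorphism ι-isRingHomomorphism using (+-homo; *-homo; -‿homo; 0#-homo; 1#-homo)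

  ℤ-rawRing : RawRing 0ℓ 0ℓ
  ℤ-rawRing = record { Carrier = ℤ ; _≈_ = _≡_ ; _+_ = ℤ._+_ ; _*_ = ℤ._*_ ; -_ = ℤ.-_ ; 0# = + 0 ; 1# = + 1 }

  ℤ-morphism : ℤ-rawRing -Raw-AlmostCommutative⟶ fromCommutativeRing R
  ℤ-morphism = record
    { ⟦_⟧    = λ i → ι (i ℚ./ 1)
    ; +-homo = λ i j → trans (reflexive (≡.cong ι (/1-+ i j))) (+-homo _ _)
    ; *-homo = λ i j → trans (reflexive (≡.cong ι (/1-* i j))) (*-homo _ _)
    ; -‿homo = λ i → trans (reflexive (≡.cong ι (/1-neg i))) (-‿homo _)
    ; 0-homo = 0#-homo
    ; 1-homo = 1#-homo }

  -- The solver evaluates the constant 1 to # 1, not to 1#, so the identities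
  -- are stated with o; in ℚ[y]⟦t⟧ the two coincide definitionally.
  open RingSolver ℤ-rawRing (fromCommutativeRing R) ℤ-morphism
    (λ i j → Maybe.map (λ e → reflexive (≡.cong (λ k → ι (k ℚ./ 1)) e)) (dec⇒weaklyDec ℤₚ._≟_ i j))
    using (solve; _:+_; _:*_; _:-_; _:^_; _:=_; con)

  open RingProperties ring using (x∙y⁻¹≈ε⇒x≈y)

  o : Carrier
  o = # 1

  *-≈0 : ∀ {c x y} → x ≈ y → c * (x - y) ≈ 0#
  *-≈0 {c} {x} {y} e = trans (*-congˡ (trans (+-congʳ e) (-‿inverseʳ y))) (zeroʳ c)

  +-≈0 : ∀ {x y} → x ≈ 0# → y ≈ 0# → x + y ≈ 0#
  +-≈0 e e′ = trans (+-cong e e′) (+-identityˡ 0#)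

  -- Each identity below writes a difference as a combination of the residuals
  -- of the defining equations.
  module Forward {y t s u v : Carrier} where
    vₗ vᵣ Δ uₗ uᵣ : Carrier
    Δ = (o + t) ^ 2 - # 4 * y * t
    vₗ = v * (# 2 * y * t)
    vᵣ = (o + t) ^ 2 - # 2 * y * t - (o + t) * s
    uₗ = u * (# 2 * (o - y) * t)
    uᵣ = o + t ^ 2 - # 2 * y * t - (o - t) * s

    -- Modulo the definition of v, 2yt(1 + v) = (1 + t)(1 + t - s). Squaring this and replacing s²
    -- by Δ eliminates the root; the factor 4yt is a remnant of the square.
    v-identity : t * (# 4 * y * (y * t * ((o + v) * (o + v)))) - t * (# 4 * y * ((o + t) * (o + t) * v))
      ≈ (o + t) * (o + t) * (s ^ 2 - Δ) + (vₗ - vᵣ - # 2 * (o + t) * s) * (vₗ - vᵣ)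
    v-identity = solve 4 (λ y t s v →
      let o  = con (+ 1)
          Δ  = (o :+ t) :^ 2 :- con (+ 4) :* y :* t
          vₗ = v :* (con (+ 2) :* y :* t)
          vᵣ = (o :+ t) :^ 2 :- con (+ 2) :* y :* t :- (o :+ t) :* s
      in t :* (con (+ 4) :* y :* (y :* t :* ((o :+ v) :* (o :+ v))))
         :- t :* (con (+ 4) :* y :* ((o :+ t) :* (o :+ t) :* v))
        := (o :+ t) :* (o :+ t) :* (s :^ 2 :- Δ) :+ (vₗ :- vᵣ :- con (+ 2) :* (o :+ t) :* s) :* (vₗ :- vᵣ)) refl y t s v

    -- The cleared form of u = (t - v)/(1 - tv): 4y(1 - y)t² is the product of the denominators in
    -- the definitions of u and v.
    u-identity : t * (t * (# 4 * y * (o - y) * (u + v))) - t * (t * (# 4 * y * (o - y) * (t + t * u * v)))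
      ≈ t * (t * t - o) * (s ^ 2 - Δ) + (# 2 * y * t - t * vₗ) * (uₗ - uᵣ) + (# 2 * (o - y) * t - t * uᵣ) * (vₗ - vᵣ)
    u-identity = solve 5 (λ y t s u v →
      let o  = con (+ 1)
          Δ  = (o :+ t) :^ 2 :- con (+ 4) :* y :* t
          vₗ = v :* (con (+ 2) :* y :* t)
          vᵣ = (o :+ t) :^ 2 :- con (+ 2) :* y :* t :- (o :+ t) :* s
          uₗ = u :* (con (+ 2) :* (o :- y) :* t)
          uᵣ = o :+ t :^ 2 :- con (+ 2) :* y :* t :- (o :- t) :* s
      in t :* (t :* (con (+ 4) :* y :* (o :- y) :* (u :+ v)))
         :- t :* (t :* (con (+ 4) :* y :* (o :- y) :* (t :+ t :* u :* v)))
        := t :* (t :* t :- o) :* (s :^ 2 :- Δ) :+ (con (+ 2) :* y :* t :- t :* vₗ) :* (uₗ :- uᵣ)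
           :+ (con (+ 2) :* (o :- y) :* t :- t :* uᵣ) :* (vₗ :- vᵣ)) refl y t s u v

    module _ (v-eq : vₗ ≈ vᵣ) (s-eq : s ^ 2 ≈ Δ) where
      yt[1+v]²≈[1+t]²v : t * (# 4 * y * (y * t * ((o + v) * (o + v)))) ≈ t * (# 4 * y * ((o + t) * (o + t) * v))
      yt[1+v]²≈[1+t]²v = x∙y⁻¹≈ε⇒x≈y _ _ (trans v-identity (+-≈0 (*-≈0 s-eq) (*-≈0 v-eq)))

      u+v≈t+tuv : uₗ ≈ uᵣ →
        t * (t * (# 4 * y * (o - y) * (u + v)))
          ≈ t * (t * (# 4 * y * (o - y) * (t + t * u * v)))
      u+v≈t+tuv u-eq = x∙y⁻¹≈ε⇒x≈y _ _ (trans u-identity (+-≈0 (+-≈0 (*-≈0 s-eq) (*-≈0 u-eq)) (*-≈0 v-eq)))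

    -- (1 + u)(1 + v) = (1 + uv) + (u + v) = (1 + uv)(1 + t).
    ratio-identity : ∀ {r} → u + v ≈ t + t * u * v → r * (o + u * v) ≈ o + u →
      (o + u * v) * (r * (o + v)) ≈ (o + u * v) * (o + t)
    ratio-identity {r} e e′ = x∙y⁻¹≈ε⇒x≈y _ _ (trans (solve 4 (λ t u v r → let o = con (+ 1) in
      (o :+ u :* v) :* (r :* (o :+ v)) :- (o :+ u :* v) :* (o :+ t)
        := (o :+ v) :* (r :* (o :+ u :* v) :- (o :+ u)) :+ o :* ((u :+ v) :- (t :+ t :* u :* v))) refl t u v r)
      (+-≈0 (*-≈0 e′) (*-≈0 e)))

    -- Both sides equal (1 + t)² v.
    ratio²-identity : ∀ {r} → r * (o + v) ≈ o + t → y * t * ((o + v) * (o + v)) ≈ (o + t) * (o + t) * v →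
      (o + v) * ((o + v) * (r * r * v)) ≈ (o + v) * ((o + v) * (y * t))
    ratio²-identity {r} e e′ = x∙y⁻¹≈ε⇒x≈y _ _ (trans (solve 4 (λ y t v r → let o = con (+ 1) in
      (o :+ v) :* ((o :+ v) :* (r :* r :* v)) :- (o :+ v) :* ((o :+ v) :* (y :* t))
        := (v :* (r :* (o :+ v) :+ (o :+ t))) :* (r :* (o :+ v) :- (o :+ t))
           :+ (con (ℤ.- (+ 1))) :* (y :* t :* ((o :+ v) :* (o :+ v)) :- (o :+ t) :* (o :+ t) :* v)) refl y t v r)
      (+-≈0 (*-≈0 e) (*-≈0 e′)))

  -- Here q = 1/(1 + t) and w = 1 + v.
  module Backward {y t q w u : Carrier}
    (q-eq : (o + t) * q ≈ o) (w-eq : w ≈ o + t * (y * (q * q) * (w * w)))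
    (u-eq : u ≈ t * (o - y * (q * q) * (w * w) + (w - o) * u)) where
    -- Solving 2ytw = (1 + t)(1 + t - s) gives `s`. The ratio is (1 + t)/w, and 1/w = 1 - tyq²w by
    -- the equation for w, which yields a form without division by w.
    s v ratio : Carrier
    s = (o + t) - t * (# 2 * (y * (w * q)))
    v = w - o
    ratio = (o + t) - t * (y * (w * q))

    s-def : s ^ 2 ≈ (o + t) ^ 2 - # 4 * y * t
    s-def = x∙y⁻¹≈ε⇒x≈y _ _ (trans (solve 4 (λ y t q w →
      let o = con (+ 1)
          s = (o :+ t) :- t :* (con (+ 2) :* (y :* (w :* q)))
      in s :^ 2 :- ((o :+ t) :^ 2 :- con (+ 4) :* y :* t)
        := (con (ℤ.- (+ 4)) :* y :* t :* w) :* ((o :+ t) :* q :- o)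
           :+ (con (ℤ.- (+ 4)) :* y :* t) :* (w :- (o :+ t :* (y :* (q :* q) :* (w :* w))))) refl y t q w)
      (+-≈0 (*-≈0 q-eq) (*-≈0 w-eq)))

    v-def : v * (# 2 * y * t) ≈ (o + t) ^ 2 - # 2 * y * t - (o + t) * s
    v-def = x∙y⁻¹≈ε⇒x≈y _ _ (trans (solve 4 (λ y t q w →
      let o = con (+ 1)
          s = (o :+ t) :- t :* (con (+ 2) :* (y :* (w :* q)))
      in (w :- o) :* (con (+ 2) :* y :* t) :- ((o :+ t) :^ 2 :- con (+ 2) :* y :* t :- (o :+ t) :* s)
        := (con (ℤ.- (+ 2)) :* y :* t :* w) :* ((o :+ t) :* q :- o)) refl y t q w)
      (*-≈0 q-eq))

    -- The factor `c` clears the denominator 1 - tv of u and the inverse q of 1 + t; its constant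
    -- term in the series ring is 1, so it cancels there.
    u-def : let c = (o + t) * (o - t * v) in
      c * (u * (# 2 * (o - y) * t)) ≈ c * (o + t ^ 2 - # 2 * y * t - (o - t) * s)
    u-def = x∙y⁻¹≈ε⇒x≈y _ _ (trans (solve 5 (λ y t q w u →
      let o  = con (+ 1)
          s  = (o :+ t) :- t :* (con (+ 2) :* (y :* (w :* q)))
          v  = w :- o
          c  = (o :+ t) :* (o :- t :* v)
          e₄ = (o :+ t) :* q :- o
          e₅ = w :- (o :+ t :* (y :* (q :* q) :* (w :* w)))
          e₆ = u :- t :* (o :- y :* (q :* q) :* (w :* w) :+ (w :- o) :* u)
      in c :* (u :* (con (+ 2) :* (o :- y) :* t)) :- c :* (o :+ t :^ 2 :- con (+ 2) :* y :* t :- (o :- t) :* s)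
        := (con (+ 2) :* (o :+ t) :* (o :- y) :* t) :* e₆
           :+ (con (+ 2) :* t :* ((o :+ t) :* (o :- y) :- (o :- t) :* ((o :+ t) :* (o :+ t)))) :* e₅
           :+ (con (ℤ.- (+ 2)) :* t :* (o :- t) :* y :* w :* ((o :- t :* v) :+ t :* w :* (e₄ :+ con (+ 2)))) :* e₄)
      refl y t q w u)
      (+-≈0 (+-≈0 (*-≈0 u-eq) (*-≈0 w-eq)) (*-≈0 q-eq)))

    -- Multiplied by `w`, the denominator of the ratio, whose constant term is likewise 1.
    ratio-def : w * (ratio * (o + u * v)) ≈ w * (o + u)
    ratio-def = x∙y⁻¹≈ε⇒x≈y _ _ (trans (solve 5 (λ y t q w u →
      let o  = con (+ 1)
          v  = w :- o
          r  = (o :+ t) :- t :* (y :* (w :* q))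
          e₄ = (o :+ t) :* q :- o
          e₅ = w :- (o :+ t :* (y :* (q :* q) :* (w :* w)))
          e₆ = u :- t :* (o :- y :* (q :* q) :* (w :* w) :+ (w :- o) :* u)
      in w :* (r :* (o :+ u :* v)) :- w :* (o :+ u)
        := ((o :+ t) :* (o :+ u :* v) :- o) :* e₅ :+ (t :* y :* w :* w :* q :* (o :+ u :* v)) :* e₄
           :+ con (ℤ.- (+ 1)) :* e₆) refl y t q w u)
      (+-≈0 (+-≈0 (*-≈0 w-eq) (*-≈0 q-eq)) (*-≈0 u-eq)))

ℚ[y]-ι : IsRingHomomorphism (CommutativeRing.rawRing ℚ-ring) ℚ[y].rawRing ℚ[y].ι
ℚ[y]-ι = polynomialConst-isRingHomomorphism ℚ-ring

ℚ[y,t]-ι : IsRingHomomorphism (CommutativeRing.rawRing ℚ-ring) ℚ[y,t].rawRing ℚ[y,t].ι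
ℚ[y,t]-ι = Composition.isRingHomomorphism ℚ[y,t].trans ℚ[y]-ι (polynomialConst-isRingHomomorphism ℚ[y].commutativeRing)

ℚ⟨y,t⟩-ι : IsRingHomomorphism (CommutativeRing.rawRing ℚ-ring) ℚ⟨y,t⟩.rawRing (λ q → ℚ⟨y,t⟩.embed (ℚ[y,t].ι q))
ℚ⟨y,t⟩-ι = Composition.isRingHomomorphism ℚ⟨y,t⟩.trans ℚ[y,t]-ι
  (embed-isRingHomomorphism ℚ[y,t].commutativeRing ℚ[y,t].isDomain)

ℚ[y]⟦t⟧-ι : IsRingHomomorphism (CommutativeRing.rawRing ℚ-ring) ℚ[y]⟦t⟧.rawRing ℚ[y]⟦t⟧.ι
ℚ[y]⟦t⟧-ι = Composition.isRingHomomorphism ℚ[y]⟦t⟧.trans ℚ[y]-ι (seriesConst-isRingHomomorphism ℚ[y].commutativeRing)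

module FractionSubstitution (R : CommutativeRing 0ℓ 0ℓ) (dom : IsDomain R) (y t : CommutativeRing.Carrier R) where
  open CommutativeRing R
  open CExp commutativeSemiring using (_^_)
  open IsDomain dom
  open Fractions R dom using (_/_[_]; embed; cross)
  open SemiringSolver commutativeSemiring using (solve; _:+_; _:*_; _:=_; con)
  private module F = CommutativeRing (Fractions.commutativeRing R dom)

  module _ (1+y≉0 : ¬ 1# + y ≈ 0#) (y+t≉0 : ¬ y + t ≈ 0#) (1+yt≉0 : ¬ 1# + y * t ≈ 0#) where
    ρ a b : F.Carrier
    ρ = (1# + y * t) / (1# + y) [ 1+y≉0 ]
    a = ((1# + y) ^ 2 * t) / ((y + t) * (1# + y * t)) [ *≉0 y+t≉0 1+yt≉0 ]
    b = (y + t) / (1# + y * t) [ 1+yt≉0 ]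

    ρρab≈t : ρ F.* ρ F.* (a F.* b) F.≈ embed t
    -- Numerators and denominators are spelled out as the operations on fractions produce them, with
    -- the square of 1 + y unfolded.
    ρρab≈t = cross (solve 2 (λ y t → let o = con 1 in
      (o :+ y :* t) :* (o :+ y :* t) :* ((o :+ y) :* ((o :+ y) :* o) :* t :* (y :+ t)) :* o
        := t :* ((o :+ y) :* (o :+ y) :* ((y :+ t) :* (o :+ y :* t) :* (o :+ y :* t)))) refl y t)

    ρ[1+b]≈1+t : ρ F.* (F.1# F.+ b) F.≈ F.1# F.+ embed t
    ρ[1+b]≈1+t = cross (solve 2 (λ y t → let o = con 1 in
      (o :+ y :* t) :* (o :* (o :+ y :* t) :+ (y :+ t) :* o) :* (o :* o)
        := (o :* o :+ t :* o) :* ((o :+ y) :* (o :* (o :+ y :* t)))) refl y t)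

module ℚ⟨y,t⟩-Forms = ClosedForms ℚ⟨y,t⟩.commutativeRing (homomorphism⇒casting ℚ⟨y,t⟩-ι)
module ℚ[y]⟦t⟧-Forms = ClosedForms ℚ[y]⟦t⟧.commutativeRing (homomorphism⇒casting ℚ[y]⟦t⟧-ι)
module ℚ[y,t]-Forms = ClosedForms ℚ[y,t].commutativeRing (homomorphism⇒casting ℚ[y,t]-ι)

𝐍≈ρ^𝐃 : ∀ n →
  let open ℚ[y,t]
      open ℚ⟨y,t⟩ using (_/_[_])
      module F = ℚ⟨y,t⟩
  in F.𝐍 (suc n) F.t
       F.≈ ((1# + y * t) / (1# + y) [ 1+y≉0 ]) F.^ (suc n ℕ.+ 1)
         F.* F.𝐃 (suc n) (((1# + y) ^ 2 * t) / ((y + t) * (1# + y * t)) [ *≉0 y+t≉0 1+yt≉0 ])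
                   ((y + t) / (1# + y * t) [ 1+yt≉0 ])
𝐍≈ρ^𝐃 n = ℚ⟨y,t⟩-Forms.ρρab≈s⇒𝐍≈ρ^𝐃 n (ρρab≈t 1+y≉0 y+t≉0 1+yt≉0) (ρ[1+b]≈1+t 1+y≉0 y+t≉0 1+yt≉0)
  where
  open ℚ[y,t] using (1+y≉0; y+t≉0; 1+yt≉0)
  open FractionSubstitution ℚ[y,t].commutativeRing ℚ[y,t].isDomain ℚ[y,t].y ℚ[y,t].t

-- The power series behind the radical substitution: existence and consequences

module AlgebraicSeries where
  open ℚ[y]⟦t⟧
  private
    module A = ℚ[y]
    module P = PowerSeries A.commutativeRing
    module Q = Polynomial ℚ-ring
  open SubstitutionIdentities commutativeRing ι ℚ[y]⟦t⟧-ι using (module Forward; module Backward)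
  open SeriesProperties A.commutativeRing
  open Cancellation (A.isDomain ℚ-isDomain)

  private
    *-ne : ∀ {K L} → Nonexpansive K → Nonexpansive L → Nonexpansive (λ f → K f * L f)
    *-ne {K} {L} = ⊛-nonexpansive {K} {L}

    const-ne : ∀ f → Nonexpansive (λ _ → f)
    const-ne = const-nonexpansive

  module q-solution = Solution A.1# (λ q → - q) (⊖-nonexpansive {λ q → q} id-nonexpansive)

  q : Carrier
  q = q-solution.solution

  q-eq : (1# + t) * q ≈ 1#
  q-eq = trans (distribʳ q 1# t) (trans (+-congʳ (trans (*-identityˡ q) q-solution.solution-≋))
    (trans (+-assoc 1# (t * - q) (t * q)) (trans (+-congˡ (trans (sym (distribˡ t (- q) q))
      (trans (*-congˡ (-‿inverseˡ q)) (zeroʳ t)))) (+-identityʳ 1#))))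

  -- Dividing yt(1 + v)² = (1 + t)² v by (1 + t)² turns w = 1 + v into this fixed point.
  module w-solution = Solution A.1# (λ w → y * (q * q) * (w * w))
    (*-ne {λ _ → y * (q * q)} {λ w → w * w} (const-ne _) (*-ne {λ w → w} {λ w → w} id-nonexpansive id-nonexpansive))

  w : Carrier
  w = w-solution.solution

  -- From u + v = t + tuv, with v written as tyq²w² so that t can be taken out of every term.
  module u-solution = Solution A.0# (λ u → 1# - y * (q * q) * (w * w) + (w - 1#) * u)
    (⊕-nonexpansive {λ _ → 1# - y * (q * q) * (w * w)} {λ u → (w - 1#) * u} (const-ne _)
      (*-ne {λ _ → w - 1#} {λ u → u} (const-ne _) id-nonexpansive))

  u : Carrier
  u = u-solution.solution

  u-eq : u ≈ t * (1# - y * (q * q) * (w * w) + (w - 1#) * u)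
  u-eq = trans u-solution.solution-≋ (+-identityˡ _)

  module B = Backward {y} {t} {q} {w} {u} q-eq w-solution.solution-≋ u-eq

  private
    x-0*y≈x : ∀ x z → x A.+ A.- (A.0# A.* z) A.≈ x
    x-0*y≈x x z = A.trans (A.+-congˡ (A.trans (A.-‿cong (A.zeroˡ z)) (RingProperties.-0#≈0# A.ring))) (A.+-identityʳ x)

    1+0*x≈1 : ∀ z → A.1# A.+ A.0# A.* z A.≈ A.1#
    1+0*x≈1 z = A.trans (A.+-congˡ {A.1#} (A.zeroˡ z)) (A.+-identityʳ A.1#)

    ≈1⇒≉0 : ∀ {x} → x A.≈ A.1# → ¬ x A.≈ A.0#
    ≈1⇒≉0 e e′ with () ← Q.at (A.trans (A.sym e) e′) 0

  √Δ-constant : B.s 0 A.≈ A.1#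
  √Δ-constant = A.trans (x-0*y≈x (A.1# A.+ A.0#) ((# 2 * (y * (w * q))) 0)) (A.+-identityʳ A.1#)

  2yt≉0 : ¬ # 2 * y * t ≈ 0#
  2yt≉0 e with () ← Q.at (P.at e 1) 1

  2[1-y]t≉0 : ¬ # 2 * (1# - y) * t ≈ 0#
  2[1-y]t≉0 e with () ← Q.at (P.at e 1) 0

  substitution : Substitution
  substitution = record
    { √Δ        = B.s
    ; u         = u
    ; v         = B.v
    ; ratio     = B.ratio
    ; √Δ-def    = √Δ-constant , B.s-def
    ; u-def     = 2[1-y]t≉0 , ⊛-cancelˡ ((1# + t) * (1# - t * B.v)) (≈1⇒≉0 c₀) B.u-def
    ; v-def     = 2yt≉0 , B.v-def
    ; ratio-def = (λ e → ≈1⇒≉0 d₀ (P.at e 0)) , ⊛-cancelˡ w (≈1⇒≉0 A.refl) B.ratio-def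
    }
    where
    c₀ : ((1# + t) * (1# - t * B.v)) 0 A.≈ A.1#
    c₀ = A.trans (A.*-cong (A.+-identityʳ A.1#) (x-0*y≈x A.1# (B.v 0))) (A.*-identityˡ A.1#)
    d₀ : (1# + u * B.v) 0 A.≈ A.1#
    d₀ = 1+0*x≈1 (B.v 0)

  module _ (σ : Substitution) where
    open Substitution σ

    module Fw = Forward {y} {t} {√Δ} {Substitution.u σ} {v}

    private
      v-eq = proj₂ v-def
      s-eq = proj₂ √Δ-def

    yt[1+v]²≈[1+t]²v : y * t * ((1# + v) * (1# + v)) ≈ (1# + t) * (1# + t) * v
    yt[1+v]²≈[1+t]²v = ⊛-cancelˡ (# 4 * y) (λ e → 4y≉0 e) (X-cancelˡ (Fw.yt[1+v]²≈[1+t]²v v-eq s-eq))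
      where
      4y≉0 : ¬ (# 4 * y) 0 A.≈ A.0#
      4y≉0 e with () ← Q.at e 1

    -- In the definition of v both sides vanish at t = 0 and reveal nothing; the quadratic equation
    -- for v does fix the constant term. It makes 1 + v and 1 + uv cancellable.
    v₀≈0 : v 0 A.≈ A.0#
    v₀≈0 = A.trans (A.sym (A.trans (A.*-congʳ {v 0} (A.trans (A.*-cong 1+0≈1 1+0≈1) (A.*-identityˡ A.1#)))
        (A.*-identityˡ (v 0))))
      (A.trans (A.sym (P.at yt[1+v]²≈[1+t]²v 0))
        (A.trans (A.*-congʳ {((1# + v) * (1# + v)) 0} (A.zeroʳ (y 0))) (A.zeroˡ (((1# + v) * (1# + v)) 0))))
      where
      1+0≈1 = A.+-identityʳ A.1#

    [1+v]₀≉0 : ¬ (1# + v) 0 A.≈ A.0#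
    [1+v]₀≉0 = ≈1⇒≉0 (A.trans (A.+-congˡ {A.1#} v₀≈0) (A.+-identityʳ A.1#))

    [1+uv]₀≉0 : ¬ (1# + Substitution.u σ * v) 0 A.≈ A.0#
    [1+uv]₀≉0 = ≈1⇒≉0 (A.trans (A.+-congˡ {A.1#} (A.trans
      (A.*-congˡ {Substitution.u σ 0} v₀≈0) (A.zeroʳ (Substitution.u σ 0)))) (A.+-identityʳ A.1#))

    u+v≈t+tuv : Substitution.u σ + v ≈ t + t * Substitution.u σ * v
    u+v≈t+tuv = ⊛-cancelˡ (# 4 * y * (1# - y)) (λ e → 4y[1-y]≉0 e)
      (X-cancelˡ (X-cancelˡ (Fw.u+v≈t+tuv v-eq s-eq (proj₂ u-def))))
      where
      4y[1-y]≉0 : ¬ (# 4 * y * (1# - y)) 0 A.≈ A.0#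
      4y[1-y]≉0 e with () ← Q.at e 1

    ratio[1+v]≈1+t : ratio * (1# + v) ≈ 1# + t
    ratio[1+v]≈1+t = ⊛-cancelˡ (1# + Substitution.u σ * v) [1+uv]₀≉0
      (Fw.ratio-identity u+v≈t+tuv (proj₂ ratio-def))

    ratio²v≈yt : ratio * ratio * v ≈ y * t
    ratio²v≈yt = ⊛-cancelˡ (1# + v) [1+v]₀≉0 (⊛-cancelˡ (1# + v) [1+v]₀≉0
      (Fw.ratio²-identity ratio[1+v]≈1+t yt[1+v]²≈[1+t]²v))

    𝐃≈ratio^𝐍 : ∀ n → 𝐃 (suc n) y t ≈ ratio ^ (suc n ℕ.+ 1) * 𝐍 (suc n) v
    𝐃≈ratio^𝐍 n = ℚ[y]⟦t⟧-Forms.ρρs≈ab⇒𝐃≈ρ^𝐍 n ratio²v≈yt ratio[1+v]≈1+t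

-- Coefficients

-- The coefficient of x^j in x^b (1 + x)^e; for e = 0 it is the Kronecker delta of b and j.
shiftedC : ℕ → ℕ → ℕ → ℕ
shiftedC zero    e j       = e C j
shiftedC (suc b) e zero    = 0
shiftedC (suc b) e (suc j) = shiftedC b e j

shiftedC-self : ∀ b → shiftedC b 0 b ≡ 1
shiftedC-self zero    = ≡.refl
shiftedC-self (suc b) = shiftedC-self b

shiftedC-other : ∀ b j → b ≢ j → shiftedC b 0 j ≡ 0
shiftedC-other zero    zero    b≢j = ⊥-elim (b≢j ≡.refl)
shiftedC-other zero    (suc j) b≢j = k>n⇒nCk≡0 {0} {suc j} (s≤s z≤n)
shiftedC-other (suc b) zero    b≢j = ≡.refl
shiftedC-other (suc b) (suc j) b≢j = shiftedC-other b j (b≢j ∘ ≡.cong suc)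

shiftedC-+ : ∀ b e d → shiftedC b e (b ℕ.+ d) ≡ e C d
shiftedC-+ zero    e d = ≡.refl
shiftedC-+ (suc b) e d = shiftedC-+ b e d

shiftedC-< : ∀ b e j → j ℕ.< b → shiftedC b e j ≡ 0
shiftedC-< (suc b) e zero    _         = ≡.refl
shiftedC-< (suc b) e (suc j) (s≤s j<b) = shiftedC-< b e j j<b

-- The case split is on the sign of j - k - 1: where it is negative, `binom` is 0 by convention and
-- `shiftedC` by the shift.
binom-shiftedC : ∀ a k j → binom (+ a) (+ j ℤ.- + k ℤ.- + 1) ≡ + shiftedC (suc k) a j
binom-shiftedC a k j with ℕₚ.≤-<-connex (suc k) j
... | inj₁ k<j with d , ≡.refl ← ℕₚ.m≤n⇒∃[o]m+o≡n k<j = begin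
  binom (+ a) (+ (suc k ℕ.+ d) ℤ.- + k ℤ.- + 1)  ≡⟨ ≡.cong (λ i → binom (+ a) (i ℤ.- + 1)) (begin
    + (suc k ℕ.+ d) ℤ.- + k       ≡⟨ ℤₚ.m-n≡m⊖n (suc k ℕ.+ d) k ⟩
    (suc k ℕ.+ d) ℤ.⊖ k           ≡⟨ ≡.cong (ℤ._⊖ k) (ℕₚ.+-suc k d) ⟨
    (k ℕ.+ suc d) ℤ.⊖ k           ≡⟨ ℤₚ.⊖-≥ (ℕₚ.m≤m+n k (suc d)) ⟩
    + (k ℕ.+ suc d ∸ k)           ≡⟨ ≡.cong +_ (ℕₚ.m+n∸m≡n k (suc d)) ⟩
    + suc d                       ∎) ⟩
  + (a C d)                             ≡⟨ ≡.cong +_ (shiftedC-+ (suc k) a d) ⟨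
  + shiftedC (suc k) a (suc k ℕ.+ d)    ∎
  where open ≡.≡-Reasoning
... | inj₂ (s≤s j≤k) with d , ≡.refl ← ℕₚ.m≤n⇒∃[o]m+o≡n j≤k = begin
  binom (+ a) (+ j ℤ.- + (j ℕ.+ d) ℤ.- + 1)  ≡⟨ ≡.cong (λ i → binom (+ a) (i ℤ.- + 1)) (begin
    + j ℤ.- + (j ℕ.+ d)       ≡⟨ ℤₚ.m-n≡m⊖n j (j ℕ.+ d) ⟩
    j ℤ.⊖ (j ℕ.+ d)           ≡⟨ ℤₚ.⊖-≤ (ℕₚ.m≤m+n j d) ⟩
    ℤ.- + (j ℕ.+ d ∸ j)       ≡⟨ ≡.cong (λ x → ℤ.- + x) (ℕₚ.m+n∸m≡n j d) ⟩
    ℤ.- + d                   ∎) ⟩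
  binom (+ a) (ℤ.- + d ℤ.- + 1)         ≡⟨ negative d ⟩
  + 0                                   ≡⟨ ≡.cong +_ (shiftedC-< (suc (j ℕ.+ d)) a j (s≤s (ℕₚ.m≤m+n j d))) ⟨
  + shiftedC (suc (j ℕ.+ d)) a j        ∎
  where
  open ≡.≡-Reasoning
  negative : ∀ d → binom (+ a) (ℤ.- + d ℤ.- + 1) ≡ + 0
  negative zero    = ≡.refl
  negative (suc d) = ≡.refl

module PolynomialCoefficients (R : CommutativeRing 0ℓ 0ℓ) where
  open CommutativeRing R
  open Polynomial R using (coeff; coeff-⊛; coeff-const; const; X; _⊛_)
  open SeriesProperties R using (X⊛-zero; X⊛-suc; const⊛)
  private module S = PowerSeries R

  coeff-const⊛ : ∀ a p j → coeff (const a ⊛ p) j ≈ a * coeff p j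
  coeff-const⊛ a p j = trans (coeff-⊛ (const a) p j)
    (trans (S.⊛-cong {g = coeff p} (coeff-const a) (λ _ → refl) j) (const⊛ a (coeff p) j))

  coeff-X⊛ : ∀ p j → coeff (X ⊛ p) j ≈ (S.X S.⊛ coeff p) j
  coeff-X⊛ p j = trans (coeff-⊛ X p j) (S.⊛-cong {g = coeff p} coeff-X (λ _ → refl) j)
    where
    coeff-X : coeff X S.≐ S.X
    coeff-X zero          = refl
    coeff-X (suc zero)    = refl
    coeff-X (suc (suc _)) = refl

  coeff-X⊛-zero : ∀ p → coeff (X ⊛ p) 0 ≈ 0#
  coeff-X⊛-zero p = trans (coeff-X⊛ p 0) (X⊛-zero (coeff p))

  coeff-X⊛-suc : ∀ p j → coeff (X ⊛ p) (suc j) ≈ coeff p j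
  coeff-X⊛-suc p j = trans (coeff-X⊛ p (suc j)) (X⊛-suc (coeff p) j)

module BinomialCoefficients (R : CommutativeRing 0ℓ 0ℓ) (casting : Casting R) where
  open CommutativeRing R
  open Casting casting using (#; #-+; #-0; #-1)
  open Polynomial R using (coeff; X; at; coeff-⊕) renaming (commutativeRing to R[x])
  open PolynomialCoefficients R
  private module P = CommutativeRing R[x]
  open CExp P.commutativeSemiring using (_^_)

  coeff-[1+X]^ : ∀ e j → coeff ((P.1# P.+ X) ^ e) j ≈ # (e C j)
  coeff-[1+X]^ zero    zero    = sym #-1
  coeff-[1+X]^ zero    (suc j) = sym (trans (reflexive (≡.cong # (k>n⇒nCk≡0 {0} {suc j} (s≤s z≤n)))) #-0)
  coeff-[1+X]^ (suc e) j = trans (at (P.trans (P.distribʳ q P.1# X) (P.+-congʳ {X P.* q} (P.*-identityˡ q))) j)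
    (trans (coeff-⊕ q (X P.* q) j) (sum j))
    where
    q = (P.1# P.+ X) ^ e
    sum : ∀ j → coeff q j + coeff (X P.* q) j ≈ # (suc e C j)
    sum zero    = trans (+-cong (coeff-[1+X]^ e 0) (coeff-X⊛-zero q)) (+-identityʳ _)
    sum (suc j) = trans (+-cong (coeff-[1+X]^ e (suc j)) (trans (coeff-X⊛-suc q j) (coeff-[1+X]^ e j)))
      (trans (+-comm _ _) (trans (sym (#-+ (e C j) (e C suc j))) (reflexive (≡.cong # (≡.sym (pascal e j))))))

  coeff-X^[1+X]^ : ∀ b e j → coeff (X ^ b P.* (P.1# P.+ X) ^ e) j ≈ # (shiftedC b e j)
  coeff-X^[1+X]^ zero    e j = trans (at (P.*-identityˡ ((P.1# P.+ X) ^ e)) j) (coeff-[1+X]^ e j)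
  coeff-X^[1+X]^ (suc b) e j = trans (at (P.*-assoc X (X ^ b) ((P.1# P.+ X) ^ e)) j) (shift j)
    where
    shift : ∀ j → coeff (X P.* (X ^ b P.* (P.1# P.+ X) ^ e)) j ≈ # (shiftedC (suc b) e j)
    shift zero    = trans (coeff-X⊛-zero (X ^ b P.* (P.1# P.+ X) ^ e)) (sym #-0)
    shift (suc j) = trans (coeff-X⊛-suc (X ^ b P.* (P.1# P.+ X) ^ e) j) (coeff-X^[1+X]^ b e j)

  coeff-X^ : ∀ b j → coeff (X ^ b) j ≈ # (shiftedC b 0 j)
  coeff-X^ b j = trans (at (P.sym (P.*-identityʳ (X ^ b))) j) (coeff-X^[1+X]^ b 0 j)

cast : ℕ → ℚ
cast n = + n ℚ./ 1

ℚ-casting : Casting ℚ-ring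
ℚ-casting = homomorphism⇒casting (Identity.isRingHomomorphism (CommutativeRing.rawRing ℚ-ring) ≡.refl)

module Coefficients where
  open ℚ[y,t]
  private
    module A = ℚ[y]
    module QP = Polynomial ℚ-ring
    module AP = Polynomial A.commutativeRing
    module Qc = PolynomialCoefficients ℚ-ring
    module Ac = PolynomialCoefficients A.commutativeRing
    module PC = IsRingHomomorphism (polynomialConst-isRingHomomorphism A.commutativeRing)
    module Qb = BinomialCoefficients ℚ-ring ℚ-casting
    module Ab = BinomialCoefficients A.commutativeRing (homomorphism⇒casting ℚ[y]-ι)
    module ∑ℚ = Sums ℚ-ring
    module Exp = CExp A.commutativeSemiring

  -- The coefficient of y^i t^j; t is the outer variable, so `j` is read off before `i`.
  χ : ℕ → ℕ → Carrier → ℚ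
  χ i j p = QP.coeff (AP.coeff p j) i

  χ-cong : ∀ i j {p q} → p ≈ q → χ i j p ≡ χ i j q
  χ-cong i j e = QP.at (AP.at e j) i

  χ-+ : ∀ i j p q → χ i j (p + q) ≡ χ i j p ℚ.+ χ i j q
  χ-+ i j p q = ≡.trans (QP.at (AP.coeff-⊕ p q j) i) (QP.coeff-⊕ (AP.coeff p j) (AP.coeff q j) i)

  χ-∑ : ∀ {X : Set} i j (xs : List X) f → χ i j (∑ xs f) ≡ ∑ℚ.∑ xs (λ x → χ i j (f x))
  χ-∑ i j []       f = ≡.refl
  χ-∑ i j (x ∷ xs) f = ≡.trans (χ-+ i j (f x) (∑ xs f)) (≡.cong (χ i j (f x) ℚ.+_) (χ-∑ i j xs f))

  y^ : ∀ a → y ^ a ≈ AP.const (A.y Exp.^ a)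
  y^ zero    = refl
  y^ (suc a) = trans (*-congˡ {y} (y^ a)) (sym (PC.*-homo A.y (A.y Exp.^ a)))

  -- Covers both expansions of `𝐃`: the monomial of a path, with r = 1 and e = 0, and a summand of
  -- the closed formula.
  χ-monomial : ∀ i j r a b e → χ i j (ι r * y ^ a * t ^ b * (1# + t) ^ e)
    ≡ r ℚ.* (cast (shiftedC b e j) ℚ.* cast (shiftedC a 0 i))
  χ-monomial i j r a b e = ≡.trans (χ-cong i j separate) (≡.trans (QP.at constants i) scalars)
    where
    c = A.ι r A.* A.y Exp.^ a
    x = A.ι (cast (shiftedC b e j))
    p = t ^ b * (1# + t) ^ e
    separate : ι r * y ^ a * t ^ b * (1# + t) ^ e ≈ AP.const c * p
    separate = trans (*-assoc (ι r * y ^ a) (t ^ b) ((1# + t) ^ e))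
      (*-congʳ {p} (trans (*-congˡ {ι r} (y^ a)) (sym (PC.*-homo (A.ι r) (A.y Exp.^ a)))))
    constants : AP.coeff (AP.const c * p) j A.≈ A.ι r A.* (x A.* A.y Exp.^ a)
    constants = A.trans (Ac.coeff-const⊛ c p j) (A.trans (A.*-congˡ {c} (Ab.coeff-X^[1+X]^ b e j))
      (A.trans (A.*-assoc (A.ι r) (A.y Exp.^ a) x) (A.*-congˡ {A.ι r} (A.*-comm (A.y Exp.^ a) x))))
    scalars : QP.coeff (A.ι r A.* (x A.* A.y Exp.^ a)) i ≡ r ℚ.* (cast (shiftedC b e j) ℚ.* cast (shiftedC a 0 i))
    scalars = ≡.trans (Qc.coeff-const⊛ r (x A.* A.y Exp.^ a) i) (≡.cong (r ℚ.*_)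
      (≡.trans (Qc.coeff-const⊛ (cast (shiftedC b e j)) (A.y Exp.^ a) i)
        (≡.cong (cast (shiftedC b e j) ℚ.*_) (Qb.coeff-X^ a i))))

  -- The index `suc k` accounts for the exponent hk + 1 of y. The product of the two deltas is the
  -- indicator of k hooks and j peaks.
  χ-path : ∀ k j μ → χ (suc k) j (y ^ (hk μ ℕ.+ 1) * t ^ pk μ)
    ≡ cast (shiftedC (pk μ) 0 j) ℚ.* cast (shiftedC (hk μ) 0 k)
  χ-path k j μ = ≡.trans
    (χ-cong (suc k) j (sym (trans (*-identityʳ (1# * y ^ (hk μ ℕ.+ 1) * t ^ pk μ))
      (*-congʳ {t ^ pk μ} (*-identityˡ (y ^ (hk μ ℕ.+ 1)))))))
    (≡.trans (χ-monomial (suc k) j 1ℚ (hk μ ℕ.+ 1) (pk μ) 0) (≡.trans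
      (ℚₚ.*-identityˡ (cast (shiftedC (pk μ) 0 j) ℚ.* cast (shiftedC (hk μ ℕ.+ 1) 0 (suc k))))
      (≡.cong (λ a → cast (shiftedC (pk μ) 0 j) ℚ.* cast (shiftedC a 0 (suc k))) (ℕₚ.+-comm (hk μ) 1))))

  Statistics? : ∀ k j μ → Dec (hk μ ≡ k × pk μ ≡ j)
  Statistics? k j μ = (hk μ ℕₚ.≟ k) ×-dec (pk μ ℕₚ.≟ j)

  indicator-zero : ∀ k j μ → ¬ (hk μ ≡ k × pk μ ≡ j) →
    cast (shiftedC (pk μ) 0 j) ℚ.* cast (shiftedC (hk μ) 0 k) ≡ 0ℚ
  indicator-zero k j μ ¬p with hk μ ℕₚ.≟ k
  ... | no hk≢k = ≡.trans (≡.cong (λ m → cast (shiftedC (pk μ) 0 j) ℚ.* cast m) (shiftedC-other (hk μ) k hk≢k))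
    (ℚₚ.*-zeroʳ (cast (shiftedC (pk μ) 0 j)))
  ... | yes hk≡k = ≡.trans
      (≡.cong (λ m → cast m ℚ.* cast (shiftedC (hk μ) 0 k)) (shiftedC-other (pk μ) j (λ pk≡j → ¬p (hk≡k , pk≡j))))
      (ℚₚ.*-zeroˡ (cast (shiftedC (hk μ) 0 k)))

  count : ∀ k j μs → ∑ℚ.∑ μs (λ μ → cast (shiftedC (pk μ) 0 j) ℚ.* cast (shiftedC (hk μ) 0 k))
    ≡ cast (length (filter (Statistics? k j) μs))
  count k j []       = ≡.refl
  count k j (μ ∷ μs) = step (Statistics? k j μ)
    where
    Goal : Set
    Goal = ∑ℚ.∑ (μ ∷ μs) (λ μ → cast (shiftedC (pk μ) 0 j) ℚ.* cast (shiftedC (hk μ) 0 k))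
      ≡ cast (length (filter (Statistics? k j) (μ ∷ μs)))
    step : Dec (hk μ ≡ k × pk μ ≡ j) → Goal
    step (yes p@(≡.refl , ≡.refl)) = ≡.trans
      (≡.cong₂ ℚ._+_ (≡.cong₂ (λ m n → cast m ℚ.* cast n) (shiftedC-self (pk μ)) (shiftedC-self (hk μ))) (count k j μs))
      (≡.trans (≡.sym (/1-+ (+ 1) (+ length (filter (Statistics? k j) μs))))
      (≡.cong (cast ∘ length) (≡.sym (Listₚ.filter-accept (Statistics? k j) {x = μ} {xs = μs} p))))
    step (no ¬p) = ≡.trans (≡.cong₂ ℚ._+_ (indicator-zero k j μ ¬p) (count k j μs)) (≡.trans (ℚₚ.+-identityˡ _)
      (≡.cong (cast ∘ length) (≡.sym (Listₚ.filter-reject (Statistics? k j) {x = μ} {xs = μs} ¬p))))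

  χ-𝐃 : ∀ n k j → χ (suc k) j (𝐃 n y t) ≡ cast (#paths n k j)
  χ-𝐃 n k j = ≡.trans (χ-∑ (suc k) j (𝒟 n) (λ μ → y ^ (hk μ ℕ.+ 1) * t ^ pk μ))
    (≡.trans (∑ℚ.∑-cong (𝒟 n) (χ-path k j)) (count k j (𝒟 n)))

  coef : ℕ → ℕ → ℚ
  coef n k = (+ 1 ℚ./ suc k) ℚ.* cast ((2 ℕ.* k) C k) ℚ.* cast (n C (2 ℕ.* k))

  χ-term : ∀ n i k j → χ (suc k) j (ι (+ 1 ℚ./ suc i) * # ((2 ℕ.* i) C i) * # (n C (2 ℕ.* i))
      * y ^ (i ℕ.+ 1) * t ^ (i ℕ.+ 1) * (1# + t) ^ (suc n ∸ 2 ℕ.* i ∸ 1))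
    ≡ coef n i ℚ.* (cast (shiftedC (suc i) (suc n ∸ 2 ℕ.* i ∸ 1) j) ℚ.* cast (shiftedC i 0 k))
  χ-term n i k j = ≡.trans (χ-cong (suc k) j (*-congʳ {p} (*-congʳ {t ^ (i ℕ.+ 1)} (*-congʳ {y ^ (i ℕ.+ 1)} merge))))
    (≡.trans (χ-monomial (suc k) j (coef n i) (i ℕ.+ 1) (i ℕ.+ 1) e)
      (≡.cong (λ b → coef n i ℚ.* (cast (shiftedC b e j) ℚ.* cast (shiftedC b 0 (suc k)))) (ℕₚ.+-comm i 1)))
    where
    e = suc n ∸ 2 ℕ.* i ∸ 1
    p = (1# + t) ^ e
    module H = IsRingHomomorphism ℚ[y,t]-ι
    merge : ι (+ 1 ℚ./ suc i) * # ((2 ℕ.* i) C i) * # (n C (2 ℕ.* i)) ≈ ι (coef n i)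
    merge = sym (trans (H.*-homo ((+ 1 ℚ./ suc i) ℚ.* cast ((2 ℕ.* i) C i)) (cast (n C (2 ℕ.* i))))
      (*-congʳ {# (n C (2 ℕ.* i))} (H.*-homo (+ 1 ℚ./ suc i) (cast ((2 ℕ.* i) C i)))))

  coef-vanishes : ∀ n k → n ℕ.< 2 ℕ.* k → ∀ x → coef n k ℚ.* x ≡ 0ℚ
  coef-vanishes n k n<2k x = ≡.trans
    (≡.cong (λ c → (+ 1 ℚ./ suc k) ℚ.* cast ((2 ℕ.* k) C k) ℚ.* cast c ℚ.* x) (k>n⇒nCk≡0 {n} n<2k))
    (≡.trans (≡.cong (ℚ._* x) (ℚₚ.*-zeroʳ ((+ 1 ℚ./ suc k) ℚ.* cast ((2 ℕ.* k) C k)))) (ℚₚ.*-zeroˡ x))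

  ⌊n/2⌋<k⇒n<2k : ∀ n k → ⌊ n /2⌋ ℕ.< k → n ℕ.< 2 ℕ.* k
  ⌊n/2⌋<k⇒n<2k zero          (suc k) _         = s≤s z≤n
  ⌊n/2⌋<k⇒n<2k (suc zero)    (suc k) _         = ≡.subst (1 ℕ.<_) (≡.sym (ℕₚ.*-suc 2 k)) (s≤s (s≤s z≤n))
  ⌊n/2⌋<k⇒n<2k (suc (suc n)) (suc k) (s≤s h<k) =
    ≡.subst (suc (suc n) ℕ.<_) (≡.sym (ℕₚ.*-suc 2 k)) (s≤s (s≤s (⌊n/2⌋<k⇒n<2k n k h<k)))

  -- Only the summand i = k carries y^(k+1). If k lies beyond the range of the sum, the right side
  -- vanishes as well, since then C(n,2k) = 0.
  χ-expansion : ∀ n k j → χ (suc k) j (𝐃 (suc n) y t)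
    ≡ coef n k ℚ.* cast (shiftedC (suc k) (suc n ∸ 2 ℕ.* k ∸ 1) j)
  χ-expansion n k j = ≡.trans (χ-cong (suc k) j (ℚ[y,t]-Forms.𝐃-closed n y t))
    (≡.trans (χ-∑ (suc k) j (upTo N) term) (≡.trans (∑ℚ.∑-cong (upTo N) (λ i → χ-term n i k j)) sum))
    where
    N = suc ⌊ n /2⌋
    term : ℕ → Carrier
    term i = ι (+ 1 ℚ./ suc i) * # ((2 ℕ.* i) C i) * # (n C (2 ℕ.* i))
      * y ^ (i ℕ.+ 1) * t ^ (i ℕ.+ 1) * (1# + t) ^ (suc n ∸ 2 ℕ.* i ∸ 1)
    c : ℕ → ℚ
    c i = cast (shiftedC (suc i) (suc n ∸ 2 ℕ.* i ∸ 1) j)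
    val : ℕ → ℚ
    val i = coef n i ℚ.* (c i ℚ.* cast (shiftedC i 0 k))
    val-other : ∀ i → i ≢ k → val i ≡ 0ℚ
    val-other i i≢k = ≡.trans
      (≡.cong (λ δ → coef n i ℚ.* (c i ℚ.* cast δ)) (shiftedC-other i k i≢k))
      (≡.trans (≡.cong (coef n i ℚ.*_) (ℚₚ.*-zeroʳ (c i))) (ℚₚ.*-zeroʳ (coef n i)))
    open ∑ℚ using (∑<-outside; ∑<-single)
    sum : ∑ℚ.∑< N val ≡ coef n k ℚ.* c k
    sum = [ (λ N≤k → ≡.trans (∑<-outside val val-other N≤k)
                       (≡.sym (coef-vanishes n k (⌊n/2⌋<k⇒n<2k n k N≤k) (c k))))
          , (λ k<N → ≡.trans (∑<-single val val-other k<N) (≡.cong (coef n k ℚ.*_)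
                       (≡.trans (≡.cong (λ δ → c k ℚ.* cast δ) (shiftedC-self k)) (ℚₚ.*-identityʳ (c k)))))
          ]′ (ℕₚ.≤-<-connex N k)

  exponent : ∀ n m → m ℕ.≤ n → + suc n ℤ.- + m ℤ.- + 1 ≡ + (suc n ∸ m ∸ 1)
  exponent n m m≤n = begin
    + suc n ℤ.- + m ℤ.- + 1    ≡⟨ ≡.cong (ℤ._- + 1) (≡.trans (ℤₚ.m-n≡m⊖n (suc n) m) (ℤₚ.⊖-≥ (ℕₚ.m≤n⇒m≤1+n m≤n))) ⟩
    + (suc n ∸ m) ℤ.- + 1      ≡⟨ ≡.trans (ℤₚ.m-n≡m⊖n (suc n ∸ m) 1) (ℤₚ.⊖-≥ (ℕₚ.m<n⇒0<n∸m (s≤s m≤n))) ⟩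
    + (suc n ∸ m ∸ 1)          ∎
    where open ≡.≡-Reasoning

  -- For 2k ≤ n the integer subtractions in the upper argument agree with the truncated ones.
  -- Otherwise C(n,2k) = 0 annihilates whatever `binom` gives at a negative upper argument.
  #paths-formula : ∀ n k j → cast (#paths (suc n) k j)
    ≡ coef n k ℚ.* (binom (+ suc n ℤ.- + (2 ℕ.* k) ℤ.- + 1) (+ j ℤ.- + k ℤ.- + 1) ℚ./ 1)
  #paths-formula n k j = ≡.trans (≡.sym (χ-𝐃 (suc n) k j)) (≡.trans (χ-expansion n k j)
    ([ (λ 2k≤n → ≡.cong (λ i → coef n k ℚ.* (i ℚ./ 1)) (≡.sym (≡.trans
         (≡.cong (λ i → binom i (+ j ℤ.- + k ℤ.- + 1)) (exponent n (2 ℕ.* k) 2k≤n))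
         (binom-shiftedC (suc n ∸ 2 ℕ.* k ∸ 1) k j))))
     , (λ n<2k → ≡.trans (coef-vanishes n k n<2k (cast (shiftedC (suc k) (suc n ∸ 2 ℕ.* k ∸ 1) j)))
         (≡.sym (coef-vanishes n k n<2k
           (binom (+ suc n ℤ.- + (2 ℕ.* k) ℤ.- + 1) (+ j ℤ.- + k ℤ.- + 1) ℚ./ 1))))
     ]′ (ℕₚ.≤-<-connex (2 ℕ.* k) n)))

corollary5p10 :
  ℚ[y]⟦t⟧.Substitution ×
  ((n : ℕ) → .{{_ : NonZero n}} →
    (let open ℚ[y,t]
         open ℚ⟨y,t⟩ using (_/_[_])
         module F = ℚ⟨y,t⟩
     in F.𝐍 n F.t
          F.≈ ((1# + y * t) / (1# + y) [ 1+y≉0 ]) F.^ (n ℕ.+ 1)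
            F.* F.𝐃 n (((1# + y) ^ 2 * t) / ((y + t) * (1# + y * t)) [ *≉0 y+t≉0 1+yt≉0 ])
                      ((y + t) / (1# + y * t) [ 1+yt≉0 ]))
    × ((σ : ℚ[y]⟦t⟧.Substitution) →
       let open ℚ[y]⟦t⟧
           open Substitution σ
       in 𝐃 n y t ≈ ratio ^ (n ℕ.+ 1) * 𝐍 n v)
    × (let open ℚ[y,t]
       in 𝐃 n y t
            ≈ ∑ (upTo (suc ⌊ n ∸ 1 /2⌋)) λ k →
                ι (+ 1 ℚ./ suc k) * # ((2 ℕ.* k) C k) * # ((n ∸ 1) C (2 ℕ.* k))
                * y ^ (k ℕ.+ 1) * t ^ (k ℕ.+ 1) * (1# + t) ^ (n ∸ 2 ℕ.* k ∸ 1))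
    × ((k j : ℕ) →
       (+ #paths n k j) ℚ./ 1
         ≡ (+ 1 ℚ./ suc k)
           ℚ.* (+ ((2 ℕ.* k) C k) ℚ./ 1)
           ℚ.* (+ ((n ∸ 1) C (2 ℕ.* k)) ℚ./ 1)
           ℚ.* (binom (+ n ℤ.- + (2 ℕ.* k) ℤ.- + 1) (+ j ℤ.- + k ℤ.- + 1) ℚ./ 1)))
corollary5p10 = AlgebraicSeries.substitution , λ
  { zero {{()}}
  ; (suc n) → 𝐍≈ρ^𝐃 n
            , (λ σ → AlgebraicSeries.𝐃≈ratio^𝐍 σ n)
            , ℚ[y,t]-Forms.𝐃-closed n ℚ[y,t].y ℚ[y,t].t
            , Coefficients.#paths-formula n
  }
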